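{- The parameterized counting problem #$k$-Vertex Cover admits a polynomial kernel.
   Context: Graphs are finite, simple and undirected. A vertex cover of a graph $G$ is a set $S\subseteq V(G)$ containing at least one endpoint of every edge of $G$. #$k$-Vertex Cover: given a graph $G$ and a non-negative integer $k$, output the number of vertex covers of $G$ of size at most $k$ (all of them, not only minimal ones). The parameter is $k$. A parameterized counting problem is a mapping $P:\Sigma^\star\times\mathbb{N}_0\to\mathbb{N}_0$, where $\Sigma=\{0,1\}$ and $\mathbb{N}_0=\{0,1,2,\ldots\}$. The second coordinate of an instance $(x,k)$ is the parameter. A compression of a parameterized counting problem $P$ into a parameterized counting problem $Q$ is a pair $(\mathsf{reduce},\mathsf{lift})$ of polynomial-time procedures such that: (1) given an instance $(x,k)$ of $P$, $\mathsf{reduce}$ outputs an instance $(x',k')$ of $Q$ with $|x'|,k'\le f(k)$ for some computable function $f$; (2) given an instance $(x,k)$ of $P$, the instance $(x',k')$ output by $\mathsf{reduce}$ on $(x,k)$, and $s'=Q(x',k')$, $\mathsf{lift}$ outputs $s=P(x,k)$. Numbers of solutions are encoded in binary. When $P=Q$ a compression is called a kernel; a kernel is polynomial if $f$ is a polynomial function. -}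

module Defs where

open import Data.Bool using (Bool; true; false; T; _∧_; not)
open import Data.Bool.Properties using (T?)
open import Data.Fin as Fin using (Fin; toℕ; fromℕ; inject₁)
open import Data.Fin.Properties using (all?; toℕ-fromℕ; toℕ-inject₁; toℕ<n; toℕ-injective)
open import Data.Fin.Relation.Unary.Top using (view; ‵fromℕ; ‵inject₁)
open import Data.Fin.Subset using (Subset; inside; outside; _∈_; ∣_∣)
open import Data.Fin.Subset.Properties using (_∈?_)
open import Data.List as List using (List; []; _∷_; _++_; length; replicate; foldr; filter)
open import Data.List.Properties using (length-++; length-tabulate)
open import Data.Maybe as Maybe using (Maybe; just; nothing; maybe)
open import Data.Nat
  using (ℕ; zero; suc; _+_; _*_; _⊔_; _⊓_; _≤_; _<_; z≤n; s≤s; _≤?_; _≟_; _≡ᵇ_)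
open import Data.Nat.Properties
  using (⊔-comm; ⊓-comm; m≥n⇒m⊔n≡m; m≥n⇒m⊓n≡n; +-mono-≤; +-monoʳ-<; <-≤-trans;
         <⇒≤; <-irrefl; <-asym; <-cmp; ≡ᵇ⇒≡)
open import Data.Product using (Σ; ∃; _×_; _,_)
open import Data.Sum using (_⊎_)
open import Data.Vec as Vec using (Vec; []; _∷_)
open import Function using (_∘_)
open import Relation.Binary.Definitions using (tri<; tri≈; tri>)
open import Relation.Binary.PropositionalEquality
  using (_≡_; refl; sym; trans; cong; cong₂; subst)
open import Relation.Nullary using (Dec; yes; no; contradiction)
open import Relation.Nullary.Decidable using (_×-dec_; _⊎-dec_; _→-dec_)

Word : Set
Word = List Bool

unary : ℕ → Word
unary k = replicate k true

-- Least significant bit first, without leading zeros; 0 is the empty word.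
increment : Word → Word
increment []           = true ∷ []
increment (false ∷ bs) = true ∷ bs
increment (true  ∷ bs) = false ∷ increment bs

binary : ℕ → Word
binary zero    = []
binary (suc n) = increment (binary n)

-- Coefficients are listed from the constant term upwards.
eval : List ℕ → ℕ → ℕ
eval p n = foldr (λ a r → a + n * r) 0 p

IsPolynomial : (ℕ → ℕ) → Set
IsPolynomial f = ∃ λ p → ∀ n → f n ≡ eval p n

Symbol : Set
Symbol = Maybe Bool

pattern □ = nothing

data Move : Set where
  goLeft stay goRight : Move

-- A two-way infinite tape; both lists start next to the head and are
-- implicitly continued by blanks.
record Tape : Set where
  constructor ⟨_,_,_⟩
  field
    left  : List Symbol
    head  : Symbol
    right : List Symbol

open Tape

blank : Tape
blank = ⟨ [] , □ , [] ⟩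

move : Move → Tape → Tape
move goLeft  ⟨ []     , h , rs     ⟩ = ⟨ []     , □ , h ∷ rs ⟩
move goLeft  ⟨ l ∷ ls , h , rs     ⟩ = ⟨ ls     , l , h ∷ rs ⟩
move stay    t                       = t
move goRight ⟨ ls     , h , []     ⟩ = ⟨ h ∷ ls , □ , []     ⟩
move goRight ⟨ ls     , h , r ∷ rs ⟩ = ⟨ h ∷ ls , r , rs     ⟩

act : Symbol × Move → Tape → Tape
act (s , d) t = move d record t { head = s }

-- The head is on the first letter of the word.
write : Word → Tape
write []       = blank
write (b ∷ bs) = ⟨ [] , just b , List.map just bs ⟩

-- The word starting under the head and ending before the next blank.
read : Tape → Word
read t = prefix (head t ∷ right t)
  where
  prefix : List Symbol → Word
  prefix []            = []
  prefix (□ ∷ _)       = []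
  prefix (just b ∷ ss) = b ∷ prefix ss

-- a input tapes, b output tapes and some number of work tapes.  The machine
-- halts when δ is undefined.
record TM (a b : ℕ) : Set where
  field
    work   : ℕ
    states : ℕ
  tapes : ℕ
  tapes = a + (b + work)
  field
    start : Fin states
    δ     : Fin states → Vec Symbol tapes →
            Maybe (Fin states × Vec (Symbol × Move) tapes)

module _ {a b : ℕ} (M : TM a b) where
  open TM M

  Config : Set
  Config = Fin states × Vec Tape tapes

  initial : Vec Word a → Config
  initial ws = start , Vec.map write ws Vec.++ Vec.replicate (b + work) blank

  output : Config → Vec Word b
  output (_ , ts) = Vec.map read (Vec.take b (Vec.drop a ts))

  step : Config → Maybe Config
  step (q , ts) =
    Maybe.map (λ (q′ , as) → q′ , Vec.zipWith act as ts) (δ q (Vec.map head ts))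

  data HaltsIn : ℕ → Config → Config → Set where
    halt : ∀ {c} → step c ≡ nothing → HaltsIn 0 c c
    next : ∀ {t c c′ d} → step c ≡ just c′ → HaltsIn t c′ d → HaltsIn (suc t) c d

  Outputs_On_In_ : Vec Word b → Vec Word a → ℕ → Set
  Outputs us On ws In t = ∃ λ d → HaltsIn t (initial ws) d × output d ≡ us

size : ∀ {a} → Vec Word a → ℕ
size ws = Vec.sum (Vec.map length ws)

module _ {I O : Set} {a b : ℕ} (encI : I → Vec Word a) (encO : O → Vec Word b) where

  Computable : (I → O) → Set
  Computable f = Σ (TM a b) λ M → ∀ i → ∃ λ t →
    Outputs_On_In_ M (encO (f i)) (encI i) t

  PolyTime : (I → O) → Set
  PolyTime f = Σ (TM a b) λ M → Σ (List ℕ) λ p → ∀ i → ∃ λ t →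
    t ≤ eval p (size (encI i)) × Outputs_On_In_ M (encO (f i)) (encI i) t

Instance : Set
Instance = Word × ℕ

Problem : Set
Problem = Instance → ℕ

-- The parameter is given in unary, so that an instance (x , k) has size
-- |x| + k; numbers of solutions are given in binary.
encInstance : Instance → Vec Word 2
encInstance (x , k) = x ∷ unary k ∷ []

encLift : Instance × Instance × ℕ → Vec Word 5
encLift (I , I′ , s) = encInstance I Vec.++ encInstance I′ Vec.++ binary s ∷ []

record Compression (P Q : Problem) : Set where
  field
    reduce          : Instance → Instance
    lift            : Instance × Instance × ℕ → ℕ
    reduce-polytime : PolyTime encInstance encInstance reduce
    lift-polytime   : PolyTime encLift (λ s → binary s ∷ []) lift
    bound           : ℕ → ℕ
    bound-computable : Computable (λ k → unary k ∷ []) (λ k → unary k ∷ []) bound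
    reduce-bounded  : ∀ x k → let (x′ , k′) = reduce (x , k) in
                      length x′ ≤ bound k × k′ ≤ bound k
    lift-correct    : ∀ I → lift (I , reduce I , Q (reduce I)) ≡ P I

Kernel : Problem → Set
Kernel P = Compression P P

PolynomialKernel : Problem → Set
PolynomialKernel P = Σ (Kernel P) λ K → IsPolynomial (Compression.bound K)

record Graph (n : ℕ) : Set where
  field
    adj        : Fin n → Fin n → Bool
    adj-sym    : ∀ u v → adj u v ≡ adj v u
    adj-irrefl : ∀ u → adj u u ≡ false

open Graph

module _ {n : ℕ} (G : Graph n) where

  IsVertexCover : Subset n → Set
  IsVertexCover S = ∀ u v → T (adj G u v) → u ∈ S ⊎ v ∈ S

  isVertexCover? : ∀ S → Dec (IsVertexCover S)
  isVertexCover? S =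
    all? λ u → all? λ v → T? (adj G u v) →-dec ((u ∈? S) ⊎-dec (v ∈? S))

subsets : ∀ n → List (Subset n)
subsets zero    = [] ∷ []
subsets (suc n) = List.map (outside ∷_) (subsets n) ++ List.map (inside ∷_) (subsets n)

countVertexCovers : ∀ {n} → Graph n → ℕ → ℕ
countVertexCovers {n} G k =
  length (filter (λ S → isVertexCover? G S ×-dec (∣ S ∣ ≤? k)) (subsets n))

-- The rows of the adjacency matrix strictly below the diagonal, from top to
-- bottom.
lowerTriangle : ∀ n → (Fin n → Fin n → Bool) → Word
lowerTriangle zero    _ = []
lowerTriangle (suc n) A =
  lowerTriangle n (λ u v → A (inject₁ u) (inject₁ v)) ++
  List.tabulate (λ v → A (fromℕ n) (inject₁ v))

encode : ∀ {n} → Graph n → Word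
encode {n} G = unary n ++ false ∷ lowerTriangle n (adj G)

-- The number of entries in the first n rows of a lower triangle.
triangle : ℕ → ℕ
triangle zero    = 0
triangle (suc n) = triangle n + n

bit : Word → ℕ → Bool
bit []       _       = false
bit (b ∷ _)  zero    = b
bit (_ ∷ bs) (suc i) = bit bs i

fromTriangle : ∀ n → Word → Graph n
fromTriangle n w = record
  { adj        = λ u v → entry (toℕ u) (toℕ v)
  ; adj-sym    = λ u v → entry-sym (toℕ u) (toℕ v)
  ; adj-irrefl = λ u → entry-irrefl (toℕ u)
  }
  where
  entry : ℕ → ℕ → Bool
  entry i j = not (i ≡ᵇ j) ∧ bit w (triangle (i ⊔ j) + (i ⊓ j))

  ≡ᵇ-sym : ∀ i j → (i ≡ᵇ j) ≡ (j ≡ᵇ i)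
  ≡ᵇ-sym zero    zero    = refl
  ≡ᵇ-sym zero    (suc _) = refl
  ≡ᵇ-sym (suc _) zero    = refl
  ≡ᵇ-sym (suc i) (suc j) = ≡ᵇ-sym i j

  ≡ᵇ-refl : ∀ i → (i ≡ᵇ i) ≡ true
  ≡ᵇ-refl zero    = refl
  ≡ᵇ-refl (suc i) = ≡ᵇ-refl i

  entry-sym : ∀ i j → entry i j ≡ entry j i
  entry-sym i j rewrite ≡ᵇ-sym i j | ⊔-comm i j | ⊓-comm i j = refl

  entry-irrefl : ∀ i → entry i i ≡ false
  entry-irrefl i rewrite ≡ᵇ-refl i = refl

splitUnary : Word → Maybe (ℕ × Word)
splitUnary []          = nothing
splitUnary (false ∷ w) = just (0 , w)
splitUnary (true ∷ w)  = Maybe.map (λ (n , w′) → suc n , w′) (splitUnary w)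

toGraph : ℕ × Word → Maybe (∃ Graph)
toGraph (n , w) with length w ≟ triangle n
... | yes _ = just (n , fromTriangle n w)
... | no  _ = nothing

decode : Word → Maybe (∃ Graph)
decode w = splitUnary w Maybe.>>= toGraph

module _ where

  private
    triangle-mono : ∀ {i n} → i ≤ n → triangle i ≤ triangle n
    triangle-mono z≤n     = z≤n
    triangle-mono (s≤s p) = +-mono-≤ (triangle-mono p) p

    length-lowerTriangle : ∀ n A → length (lowerTriangle n A) ≡ triangle n
    length-lowerTriangle zero    A = refl
    length-lowerTriangle (suc n) A =
      trans (length-++ (lowerTriangle n _))
            (cong₂ _+_ (length-lowerTriangle n _) (length-tabulate _))

    bit-++ˡ : ∀ xs ys {i} → i < length xs → bit (xs ++ ys) i ≡ bit xs i
    bit-++ˡ (x ∷ xs) ys {zero}  _       = refl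
    bit-++ˡ (x ∷ xs) ys {suc i} (s≤s p) = bit-++ˡ xs ys p

    bit-++ʳ : ∀ xs ys {i} → bit (xs ++ ys) (length xs + i) ≡ bit ys i
    bit-++ʳ []       ys = refl
    bit-++ʳ (x ∷ xs) ys = bit-++ʳ xs ys

    bit-tabulate : ∀ {n} (f : Fin n → Bool) i → bit (List.tabulate f) (toℕ i) ≡ f i
    bit-tabulate f Fin.zero    = refl
    bit-tabulate f (Fin.suc i) = bit-tabulate (f ∘ Fin.suc) i

    bit-lowerTriangle : ∀ n A (u v : Fin n) → toℕ v < toℕ u →
                        bit (lowerTriangle n A) (triangle (toℕ u) + toℕ v) ≡ A u v
    bit-lowerTriangle (suc n) A u v v<u with view u | view v
    ... | ‵fromℕ     | ‵fromℕ     = contradiction v<u (<-irrefl refl)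
    ... | ‵fromℕ     | ‵inject₁ v′
      rewrite toℕ-fromℕ n | toℕ-inject₁ v′ =
      trans (cong (λ m → bit (lowerTriangle (suc n) A) (m + toℕ v′))
                  (sym (length-lowerTriangle n _)))
            (trans (bit-++ʳ (lowerTriangle n _) _) (bit-tabulate _ v′))
    ... | ‵inject₁ u′ | ‵fromℕ
      rewrite toℕ-fromℕ n | toℕ-inject₁ u′ = contradiction (toℕ<n u′) (<-asym v<u)
    ... | ‵inject₁ u′ | ‵inject₁ v′
      rewrite toℕ-inject₁ u′ | toℕ-inject₁ v′ =
      trans (bit-++ˡ (lowerTriangle n _) _
              (subst (triangle (toℕ u′) + toℕ v′ <_) (sym (length-lowerTriangle n _))
                (<-≤-trans (+-monoʳ-< (triangle (toℕ u′)) v<u)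
                           (triangle-mono (toℕ<n u′)))))
            (bit-lowerTriangle n _ u′ v′ v<u)

    splitUnary-unary : ∀ n w → splitUnary (unary n ++ false ∷ w) ≡ just (n , w)
    splitUnary-unary zero    w = refl
    splitUnary-unary (suc n) w rewrite splitUnary-unary n w = refl

    toGraph-just : ∀ n w → length w ≡ triangle n →
                   toGraph (n , w) ≡ just (n , fromTriangle n w)
    toGraph-just n w eq with length w ≟ triangle n
    ... | yes _  = refl
    ... | no neq = contradiction eq neq

    adj-below : ∀ {n} w (u v : Fin n) → toℕ v < toℕ u →
                adj (fromTriangle n w) u v ≡ bit w (triangle (toℕ u) + toℕ v)
    adj-below w u v v<u with toℕ u ≡ᵇ toℕ v in eq
    ... | true  = contradiction v<u
                    (<-irrefl (sym (≡ᵇ⇒≡ (toℕ u) (toℕ v) (subst T (sym eq) _))))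
    ... | false rewrite m≥n⇒m⊔n≡m (<⇒≤ v<u) | m≥n⇒m⊓n≡n (<⇒≤ v<u) = refl

  decode-encode : ∀ {n} (G : Graph n) → ∃ λ H →
                  decode (encode G) ≡ just (n , H) × (∀ u v → adj H u v ≡ adj G u v)
  decode-encode {n} G = H , decodes , agrees
    where
    w = lowerTriangle n (adj G)
    H = fromTriangle n w

    decodes : decode (encode G) ≡ just (n , H)
    decodes rewrite splitUnary-unary n w = toGraph-just n w (length-lowerTriangle n _)

    below : ∀ u v → toℕ v < toℕ u → adj H u v ≡ adj G u v
    below u v v<u = trans (adj-below w u v v<u) (bit-lowerTriangle n (adj G) u v v<u)

    agrees : ∀ u v → adj H u v ≡ adj G u v
    agrees u v with <-cmp (toℕ u) (toℕ v)
    ... | tri> _ _ v<u = below u v v<u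
    ... | tri< u<v _ _ =
      trans (adj-sym H u v) (trans (below v u u<v) (adj-sym G v u))
    ... | tri≈ _ u≡v _ with refl ← toℕ-injective u≡v =
      trans (adj-irrefl H u) (sym (adj-irrefl G u))

-- Words that do not encode a graph have no solutions.
#VertexCover : Problem
#VertexCover (x , k) = maybe (λ (_ , G) → countVertexCovers G k) 0 (decode x)

-- Call a vertex of G heavy if its degree exceeds k and light otherwise, and
-- let the core be the set of light vertices that have a light neighbour.  A set
-- S of at most k vertices covers G if and only if it contains all heavy
-- vertices and its restriction to the core covers G[core]; if there is such an
-- S, the core has c ≤ k + k² vertices.  The kernel is G[core] with c + 1 pendant
-- vertices at each core vertex and a parameter that does not restrict the size
-- of covers.  A cover T of G[core] extends to 2^((c+1)|T|) covers of the kernel,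
-- so the digits in base 2^(c+1) of their number s are the numbers of covers of
-- G[core] of each size.  To recover the answer, these digits are read in the
-- larger base B = 2^(n+1), the result is multiplied by B for every heavy vertex
-- and by 1 + B for every light vertex outside the core, and the digits
-- 0, ..., k of the product are added up.  Rejected instances are mapped to a word
-- that encodes no graph: then s = 0, which is lifted to 0.
--
-- Polynomial time is obtained from an algebra of functions in the style of
-- Cobham, in which a recursion on a word comes with a polynomial bound on the
-- length of its values.  Such functions are compiled to loop programs on
-- registers that hold words, and these to Turing machines that use every tape as
-- a stack whose top is under the head.

module Submission where

open import Defs
open import Data.Bool using (Bool; T; _xor_; _∧_; _∨_; false; if_then_else_; not; true)
open import Data.Bool.Properties using (T?; ∧-identityʳ)
open import Data.Empty using (⊥-elim)
open import Data.Fin as Fin using (Fin; join; splitAt; toℕ)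
open import Data.Fin.Properties using (splitAt-join; toℕ-fromℕ<; toℕ<n)
open import Data.Fin.Subset using (Subset; _∈_; inside; outside; ∣_∣)
open import Data.List as List using (List; []; _++_; _ʳ++_; _∷_; drop; filter; length; replicate; take)
open import Data.List.Properties
  using (++-assoc; ++-identityʳ; drop-drop; filter-++; length-++; length-drop; length-replicate;
         length-reverse; length-ʳ++; reverse-involutive)
open import Data.Maybe as Maybe using (Maybe; just; maybe; nothing)
open import Data.Nat
  using (ℕ; zero; suc; pred; _+_; _*_; _∸_; _^_; _⊔_; _⊓_; _≤_; _<_; z≤n; s≤s;
         _≡ᵇ_; _≤ᵇ_; _<ᵇ_; _≟_; _≤?_)
open import Data.Nat.DivMod using ([m+kn]%n≡m%n; _%_; m<n⇒m%n≡m)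
open import Data.Nat.Properties
open import Data.Nat.Solver using (module +-*-Solver)
open import Data.Product using (Σ; ∃; _×_; _,_; proj₁; proj₂)
open import Data.Sum as Sum using (_⊎_; inj₁; inj₂)
open import Data.Unit using (tt; ⊤)
open import Data.Vec as Vec using (Vec; []; _∷_; lookup)
open import Data.Vec.Properties using ([]=⇒lookup; lookup⇒[]=)
open import Function using (_∘_; id)
open import Relation.Binary.Definitions using (tri<; tri>; tri≈)
open import Relation.Binary.PropositionalEquality
open import Relation.Nullary using (Dec; contradiction; does; no; yes; ¬_)
open import Relation.Nullary.Decidable using (_×-dec_)
open +-*-Solver using (solve; _:=_; _:+_; _:*_; con)

-- The budget for a cover of the core is not fixed: it is what the heavy vertices and the chosen
-- light vertices outside the core leave of `k`. A single query must therefore reveal the number of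
-- covers of the core for every size at once. It does so as Kronecker substitution does: a
-- polynomial is determined by its value at a power of two that exceeds all its coefficients, since
-- then no carries occur. The polynomial here is the generating function of covers by size. Among c
-- vertices there are at most 2^c sets of a given size, hence the base 2^(c+1) in the kernel. After
-- the multiplication by the factors of the remaining vertices the coefficients count subsets of all
-- n vertices, hence the base 2^(n+1) in `lift`. Light vertices outside the core have heavy
-- neighbours only, so `k` does not bound their number and they cannot enter the kernel. The lift
-- sees the original instance and restores them as factors of the generating function.

private variable
  m n : ℕ
  X : Set

State : Set
State = ℕ → Word

upd : State → ℕ → Word → State
upd s r w q = if q ≡ᵇ r then w else s q

-- Loop programs and their compilation to Turing machines

-- loop r p pops the letters of register r one by one, until it is empty, and
-- runs p b after popping the letter b.
data Prog : Set where
  skip : Prog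
  push : Bool → ℕ → Prog
  _⨟_  : Prog → Prog → Prog
  loop : ℕ → (Bool → Prog) → Prog

infixr 5 _⨟_

-- The costs are exact numbers of machine steps. A push takes two, one to move left and one to
-- write; a test for emptiness or a pop takes one; passing from one program to the next takes none.
data Run : Prog → State → ℕ → State → Set where
  skip  : ∀ {s} → Run skip s 1 s
  push  : ∀ {b r s} → Run (push b r) s 2 (upd s r (b ∷ s r))
  _⨟_   : ∀ {p q s t s′ t′ s″} → Run p s t s′ → Run q s′ t′ s″ → Run (p ⨟ q) s (t + t′) s″
  done  : ∀ {r p s} → s r ≡ [] → Run (loop r p) s 1 s
  again : ∀ {r p s b w t s′ t′ s″} → s r ≡ b ∷ w → Run (p b) (upd s r w) t s′ →
          Run (loop r p) s′ t′ s″ → Run (loop r p) s (suc (t + t′)) s″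

-- Only registers that are read have to be backed by a tape. A push to any other register changes
-- nothing that a loop can observe.
Below : ℕ → Prog → Set
Below m skip       = ⊤
Below m (push _ _) = ⊤
Below m (p ⨟ q)    = Below m p × Below m q
Below m (loop r p) = r < m × (∀ b → Below m (p b))

registers : Prog → ℕ
registers skip       = 0
registers (push _ _) = 0
registers (p ⨟ q)    = registers p ⊔ registers q
registers (loop r p) = suc r ⊔ (registers (p false) ⊔ registers (p true))

below : ∀ p {m} → registers p ≤ m → Below m p
below skip       _ = tt
below (push _ _) _ = tt
below (p ⨟ q)    h = below p (m⊔n≤o⇒m≤o _ _ h) , below q (m⊔n≤o⇒n≤o (registers p) _ h)
below (loop r p) h = m⊔n≤o⇒m≤o (suc r) (registers (p false) ⊔ registers (p true)) h , λ where
    false → below (p false) (m⊔n≤o⇒m≤o _ _ h′)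
    true  → below (p true) (m⊔n≤o⇒n≤o (registers (p false)) _ h′)
  where h′ = m⊔n≤o⇒n≤o (suc r) _ h

Label : Prog → Set
Label skip       = ⊤
Label (push _ _) = Bool
Label (p ⨟ q)    = Label p ⊎ Label q
Label (loop r p) = Maybe (Label (p false) ⊎ Label (p true))

entry : ∀ p → Label p
entry skip       = tt
entry (push _ _) = false
entry (p ⨟ q)    = inj₁ (entry p)
entry (loop r p) = nothing

enterBody : ∀ {r} (p : Bool → Prog) b → Label (p b) → Label (loop r p)
enterBody p false = just ∘ inj₁
enterBody p true  = just ∘ inj₂

Act : Set
Act = Symbol × Move

idle : ∀ {m} → Vec Symbol m → Vec Act m
idle = Vec.map (_, stay)

actAt : ∀ {m} → ℕ → Act → Vec Symbol m → Vec Act m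
actAt _       a []       = []
actAt zero    a (s ∷ ss) = a ∷ idle ss
actAt (suc r) a (s ∷ ss) = (s , stay) ∷ actAt r a ss

symbol : ∀ {m} → ℕ → Vec Symbol m → Symbol
symbol _       []       = □
symbol zero    (s ∷ _)  = s
symbol (suc r) (_ ∷ ss) = symbol r ss

-- The label nothing is the exit of the program.
transition : ∀ {m} p → Label p → Vec Symbol m → Maybe (Label p) × Vec Act m
transition skip       _     ss = nothing , idle ss
transition (push b r) false ss = just true , actAt r (symbol r ss , goLeft) ss
transition (push b r) true  ss = nothing , actAt r (just b , stay) ss
transition (p ⨟ q) (inj₁ l) ss = let l′ , as = transition p l ss in just (maybe inj₁ (inj₂ (entry q)) l′) , as
transition (p ⨟ q) (inj₂ l) ss = let l′ , as = transition q l ss in Maybe.map inj₂ l′ , as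
transition (loop r p) nothing ss with symbol r ss
... | □      = nothing , idle ss
... | just b = just (enterBody {r} p b (entry (p b))) , actAt r (just b , goRight) ss
transition (loop r p) (just (inj₁ l)) ss =
  let l′ , as = transition (p false) l ss in just (maybe (just ∘ inj₁) nothing l′) , as
transition (loop r p) (just (inj₂ l)) ss =
  let l′ , as = transition (p true) l ss in just (maybe (just ∘ inj₂) nothing l′) , as

-- Nothing is said about symbols beyond the first blank, and `Holds` says nothing about those to the
-- left of the head. Hence letters that remain on the tape after a pop do no harm: a later push
-- overwrites them.
data Shows : List Symbol → Word → Set where
  end   : Shows [] []
  void : ∀ {ss} → Shows (□ ∷ ss) []
  _∷_   : ∀ {ss w} b → Shows ss w → Shows (just b ∷ ss) (b ∷ w)

Holds : Tape → Word → Set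
Holds t w = Shows (Tape.head t ∷ Tape.right t) w

All-hold : ∀ {m} → Vec Tape m → State → Set
All-hold []       s = ⊤
All-hold (t ∷ ts) s = Holds t (s 0) × All-hold ts (s ∘ suc)

heads : ∀ {m} → Vec Tape m → Vec Symbol m
heads = Vec.map Tape.head

apply : ∀ {m} → Vec Act m → Vec Tape m → Vec Tape m
apply = Vec.zipWith act

apply-idle : ∀ {m} (ts : Vec Tape m) → apply (idle (heads ts)) ts ≡ ts
apply-idle []       = refl
apply-idle (t ∷ ts) = cong (t ∷_) (apply-idle ts)

holds-push : ∀ t {w} b → Holds t w →
             Holds (act (just b , stay) (act (Tape.head t , goLeft) t)) (b ∷ w)
holds-push ⟨ []    , _ , _ ⟩ b H = b ∷ H
holds-push ⟨ _ ∷ _ , _ , _ ⟩ b H = b ∷ H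

all-hold-push : ∀ {m} (ts : Vec Tape m) s b r → All-hold ts s →
  let ts′ = apply (actAt r (symbol r (heads ts) , goLeft) (heads ts)) ts
  in All-hold (apply (actAt r (just b , stay) (heads ts′)) ts′) (upd s r (b ∷ s r))
all-hold-push []       s b r       H        = tt
all-hold-push (t ∷ ts) s b zero    (H , Hs)
  rewrite apply-idle ts | apply-idle ts = holds-push t b H , Hs
all-hold-push (t ∷ ts) s b (suc r) (H , Hs) = H , all-hold-push ts (s ∘ suc) b r Hs

holds-pop : ∀ t {b w} → Holds t (b ∷ w) → Holds (act (just b , goRight) t) w
holds-pop ⟨ _ , _ , []    ⟩ (b ∷ end) = void
holds-pop ⟨ _ , _ , _ ∷ _ ⟩ (b ∷ H)   = H

all-hold-pop : ∀ {m} (ts : Vec Tape m) s {b w} r → All-hold ts s → s r ≡ b ∷ w →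
               All-hold (apply (actAt r (just b , goRight) (heads ts)) ts) (upd s r w)
all-hold-pop []       s r       H        eq = tt
all-hold-pop (t ∷ ts) s zero    (H , Hs) eq
  rewrite apply-idle ts = holds-pop t (subst (Holds t) eq H) , Hs
all-hold-pop (t ∷ ts) s (suc r) (H , Hs) eq = H , all-hold-pop ts (s ∘ suc) r Hs eq

symbol-[] : ∀ {m} (ts : Vec Tape m) s r → All-hold ts s → s r ≡ [] → symbol r (heads ts) ≡ □
symbol-[] []       s r       H        eq = refl
symbol-[] (t ∷ ts) s zero    (H , Hs) eq with void ← subst (Holds t) eq H = refl
symbol-[] (t ∷ ts) s (suc r) (H , Hs) eq = symbol-[] ts (s ∘ suc) r Hs eq

symbol-∷ : ∀ {m} (ts : Vec Tape m) s {b w} r → r < m → All-hold ts s → s r ≡ b ∷ w →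
           symbol r (heads ts) ≡ just b
symbol-∷ (t ∷ ts) s zero    _       (H , Hs) eq with _ ∷ _ ← subst (Holds t) eq H = refl
symbol-∷ (t ∷ ts) s (suc r) (s≤s h) (H , Hs) eq = symbol-∷ ts (s ∘ suc) r h Hs eq

data Exits (p : Prog) {m} : Label p → Vec Tape m → ℕ → Vec Tape m → Set where
  last : ∀ {l ts as} → transition p l (heads ts) ≡ (nothing , as) → Exits p l ts 1 (apply as ts)
  next : ∀ {l l′ ts as t ts′} → transition p l (heads ts) ≡ (just l′ , as) →
         Exits p l′ (apply as ts) t ts′ → Exits p l ts (suc t) ts′

module _ {p P : Prog} (ι : Label p → Label P) where

  embed-last : ∀ {m} →
    (∀ l (ss : Vec Symbol m) → transition P (ι l) ss ≡ (let l′ , as = transition p l ss in Maybe.map ι l′ , as)) →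
    ∀ {l} {ts : Vec Tape m} {t ts′} → Exits p l ts t ts′ → Exits P (ι l) ts t ts′
  embed-last h (last eq)   = last (trans (h _ _) (cong (λ (l′ , as) → Maybe.map ι l′ , as) eq))
  embed-last h (next eq e) =
    next (trans (h _ _) (cong (λ (l′ , as) → Maybe.map ι l′ , as) eq)) (embed-last h e)

  -- The last step of `p` already enters the label `k`, so redirecting the exit costs no step and
  -- the times add up exactly.
  embed-then : ∀ {m} k →
    (∀ l (ss : Vec Symbol m) → transition P (ι l) ss ≡ (let l′ , as = transition p l ss in just (maybe ι k l′) , as)) →
    ∀ {l} {ts : Vec Tape m} {t ts′ t′ ts″} → Exits p l ts t ts′ → Exits P k ts′ t′ ts″ →
    Exits P (ι l) ts (t + t′) ts″
  embed-then k h (last eq)   e′ = next (trans (h _ _) (cong (λ (l′ , as) → just (maybe ι k l′) , as) eq)) e′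
  embed-then k h (next eq e) e′ =
    next (trans (h _ _) (cong (λ (l′ , as) → just (maybe ι k l′) , as) eq)) (embed-then k h e e′)

simulate : ∀ {m p s t s′} → Run p s t s′ → Below m p → (ts : Vec Tape m) → All-hold ts s →
           ∃ λ ts′ → All-hold ts′ s′ × Exits p (entry p) ts t ts′
simulate skip _ ts H = _ , subst (λ ts′ → All-hold ts′ _) (sym (apply-idle ts)) H , last refl
simulate (push {b} {r} {s}) _ ts H = _ , all-hold-push ts s b r H , next refl (last refl)
simulate (_⨟_ {p} {q} R R′) (B , B′) ts H
  with ts₁ , H₁ , E₁ ← simulate R B ts H
  with ts₂ , H₂ , E₂ ← simulate R′ B′ ts₁ H₁ =
  ts₂ , H₂ , embed-then inj₁ _ (λ _ _ → refl) E₁ (embed-last inj₂ (λ _ _ → refl) E₂)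
simulate (done {r} {p} {s} eq) B ts H =
  _ , subst (λ ts′ → All-hold ts′ s) (sym (apply-idle ts)) H , last test
  where
  test : transition (loop r p) nothing (heads ts) ≡ (nothing , idle (heads ts))
  test rewrite symbol-[] ts s r H eq = refl
simulate (again {r} {p} {s} {b} eq R R′) B ts H
  with ts₁ , H₁ , E₁ ← simulate R (proj₂ B b) _ (all-hold-pop ts s r H eq)
  with ts₂ , H₂ , E₂ ← simulate R′ B ts₁ H₁ =
  ts₂ , H₂ , next test (body b E₁)
  where
  test : transition (loop r p) nothing (heads ts) ≡
         (just (enterBody {r} p b (entry (p b))) , actAt r (just b , goRight) (heads ts))
  test rewrite symbol-∷ ts s r (proj₁ B) H eq = refl
  popped = apply (actAt r (just b , goRight) (heads ts)) ts
  body : ∀ b {t} → Exits (p b) (entry (p b)) popped t ts₁ →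
         Exits (loop r p) (enterBody {r} p b (entry (p b))) popped (t + _) ts₂
  body false E₁ = embed-then (just ∘ inj₁) nothing (λ _ _ → refl) E₁ E₂
  body true  E₁ = embed-then (just ∘ inj₂) nothing (λ _ _ → refl) E₁ E₂

record Finite (A : Set) : Set where
  field
    card    : ℕ
    code    : A → Fin card
    element : Fin card → A
    element-code : ∀ a → element (code a) ≡ a

open Finite

finite-⊤ : Finite ⊤
finite-⊤ = record { card = 1 ; code = λ _ → Fin.zero ; element = λ _ → tt ; element-code = λ _ → refl }

finite-⊎ : ∀ {A B} → Finite A → Finite B → Finite (A ⊎ B)
finite-⊎ {A} {B} F G = record
  { card = card F + card G
  ; code = join _ _ ∘ Sum.map (code F) (code G)
  ; element = Sum.map (element F) (element G) ∘ splitAt (card F)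
  ; element-code = λ x → trans (cong (Sum.map _ _) (splitAt-join (card F) _ (Sum.map _ _ x))) (inverse x)
  }
  where
  inverse : (x : A ⊎ B) → Sum.map (element F) (element G) (Sum.map (code F) (code G) x) ≡ x
  inverse (inj₁ a) = cong inj₁ (element-code F a)
  inverse (inj₂ b) = cong inj₂ (element-code G b)

finite-Maybe : ∀ {A} → Finite A → Finite (Maybe A)
finite-Maybe F = record
  { card = suc (card F)
  ; code = maybe (Fin.suc ∘ code F) Fin.zero
  ; element = λ { Fin.zero → nothing ; (Fin.suc i) → just (element F i) }
  ; element-code = λ { nothing → refl ; (just a) → cong just (element-code F a) }
  }

finite-Bool : Finite Bool
finite-Bool = record
  { card = 2
  ; code = λ { false → Fin.zero ; true → Fin.suc Fin.zero }
  ; element = λ { Fin.zero → false ; (Fin.suc _) → true }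
  ; element-code = λ { false → refl ; true → refl }
  }

finite-Label : ∀ p → Finite (Label p)
finite-Label skip       = finite-⊤
finite-Label (push _ _) = finite-Bool
finite-Label (p ⨟ q)    = finite-⊎ (finite-Label p) (finite-Label q)
finite-Label (loop r p) = finite-Maybe (finite-⊎ (finite-Label (p false)) (finite-Label (p true)))

inputs : ∀ {a} → Vec Word a → State
inputs []       r       = []
inputs (w ∷ ws) zero    = w
inputs (w ∷ ws) (suc r) = inputs ws r

holds-write : ∀ w → Holds (write w) w
holds-write []       = void
holds-write (b ∷ bs) = b ∷ shows bs
  where
  shows : ∀ w → Shows (List.map just w) w
  shows []      = end
  shows (b ∷ w) = b ∷ shows w

all-hold-initial : ∀ {a m} (ws : Vec Word a) →
  All-hold (Vec.map write ws Vec.++ Vec.replicate m blank) (inputs ws)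
all-hold-initial {m = zero}  []       = tt
all-hold-initial {m = suc m} []       = void , all-hold-initial {m = m} []
all-hold-initial             (w ∷ ws) = holds-write w , all-hold-initial ws

holds-read : ∀ t {w} → Holds t w → read t ≡ w
holds-read ⟨ _ , _ , _ ⟩      void          = refl
holds-read ⟨ _ , _ , [] ⟩     (b ∷ end)     = refl
holds-read ⟨ _ , _ , s ∷ ss ⟩ (b ∷ H)       = cong (b ∷_) (holds-read ⟨ [] , s , ss ⟩ H)

module _ (a b : ℕ) (p : Prog) where

  private
    F = finite-Label p

  machine : TM a b
  machine = record
    { work   = registers p
    ; states = suc (card F)
    ; start  = Fin.suc (code F (entry p))
    -- State zero has no transition and is where every exit leads; the label `l` is the state
    -- `Fin.suc (code F l)`.
    ; δ      = λ where
        Fin.zero    ss → nothing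
        (Fin.suc i) ss → let l , as = transition p (element F i) ss
                         in just (maybe (Fin.suc ∘ code F) Fin.zero l , as)
    }

  halts : ∀ {l ts t ts′} → Exits p l ts t ts′ →
          HaltsIn machine t (Fin.suc (code F l) , ts) (Fin.zero , ts′)
  halts {l} {ts} (last {as = as} eq) = next step₁ (halt refl)
    where
    step₁ : step machine (Fin.suc (code F l) , ts) ≡ just (Fin.zero , apply as ts)
    step₁ rewrite element-code F l | eq = refl
  halts {l} {ts} (next {l′ = l′} {as = as} eq e) = next step₁ (halts e)
    where
    step₁ : step machine (Fin.suc (code F l) , ts) ≡ just (Fin.suc (code F l′) , apply as ts)
    step₁ rewrite element-code F l | eq = refl

output-holds : ∀ a {b m} (ts : Vec Tape (a + (b + m))) s (us : Vec Word b) → All-hold ts s →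
               (∀ j → s (a + toℕ j) ≡ lookup us j) → Vec.map read (Vec.take b (Vec.drop a ts)) ≡ us
output-holds zero    ts       s []       H        eq = refl
output-holds zero    (t ∷ ts) s (u ∷ us) (H , Hs) eq =
  cong₂ _∷_ (trans (holds-read t H) (eq Fin.zero)) (output-holds zero ts (s ∘ suc) us Hs (eq ∘ Fin.suc))
output-holds (suc a) (t ∷ ts) s us       (_ , Hs) eq = output-holds a ts (s ∘ suc) us Hs eq

machine-outputs : ∀ {a b} p {ws : Vec Word a} {us : Vec Word b} {t s} → Run p (inputs ws) t s →
                  (∀ j → s (a + toℕ j) ≡ lookup us j) → Outputs_On_In_ (machine a b p) us ws t
machine-outputs {a} {b} p {ws} {us} R eq
  with ts , H , E ← simulate R (below p (≤-trans (m≤n+m _ b) (m≤n+m _ a))) _ (all-hold-initial ws) =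
  _ , halts a b p E , output-holds a ts _ us H eq

-- Polynomial-time functions

-- Every polynomial is dominated by some (2 + N) ^ c, and these bounds are closed
-- under sums, products and composition.
record Bd {n} {X : Set} (ρ : X → Vec Word n) (f : X → ℕ) : Set where
  constructor _,_
  field
    exponent : ℕ
    bounded  : ∀ x → f x ≤ (2 + size (ρ x)) ^ exponent

-- The intermediate states of a right fold over the word e x: the suffix w has
-- been consumed, b is the next letter, and v is what remains, in reverse.
At : {X : Set} → (X → Word) → Bool → Set
At {X} e b = Σ X λ x → Σ Word λ w → ∃ λ v → v ʳ++ (b ∷ w) ≡ e x

-- PT ρ f: there is an algorithm that finds f x when given the words ρ x, for
-- every x in X.  Here X is the set of valid inputs, so nothing is required on
-- words outside the image of ρ.  A fold is given by the function h that it
-- computes; its step is an algorithm for h x (b ∷ w) that is given w and h x w.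
data PT {n} {X : Set} (ρ : X → Vec Word n) : (X → Word) → Set₁ where
  var  : ∀ i → PT ρ (λ x → lookup (ρ x) i)
  nil  : PT ρ (λ _ → [])
  cons : ∀ b {f} → PT ρ f → PT ρ (λ x → b ∷ f x)
  fold : ∀ {e} (h : X → Word → Word) → PT ρ e → PT ρ (λ x → h x []) →
         (∀ b → PT {suc (suc n)} {At e b} (λ (x , w , _) → w ∷ h x w ∷ ρ x) (λ (x , w , _) → h x (b ∷ w))) →
         Bd {suc n} {X × Word} (λ (x , w) → w ∷ ρ x) (λ (x , w) → length (h x w)) →
         PT ρ (λ x → h x (e x))
  ren  : ∀ {m Y} {σ : Y → Vec Word m} {f} → PT σ f → (g : X → Y) (τ : Fin m → Fin n) →
         (∀ x i → lookup (σ (g x)) i ≡ lookup (ρ x) (τ i)) → PT ρ (f ∘ g)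
  ext  : ∀ {f g} → PT ρ f → (∀ x → f x ≡ g x) → PT ρ g

-- Closure properties of polynomial bounds

1≤pow : ∀ m c → 1 ≤ (2 + m) ^ c
1≤pow m c = m^n>0 (2 + m) c

bd-≤ : ∀ {n X} {ρ : X → Vec Word n} {f g} → Bd ρ g → (∀ x → f x ≤ g x) → Bd ρ f
bd-≤ (c , h) f≤g = c , λ x → ≤-trans (f≤g x) (h x)

bd-const : ∀ {n X} {ρ : X → Vec Word n} k → Bd ρ (λ _ → k)
bd-const {ρ = ρ} k = k , λ x → ≤-trans (k≤2^k k) (^-monoˡ-≤ k (m≤m+n 2 (size (ρ x))))
  where
  k≤2^k : ∀ k → k ≤ 2 ^ k
  k≤2^k zero    = z≤n
  k≤2^k (suc k) = +-mono-≤ (1≤pow 0 k) (≤-trans (k≤2^k k) (m≤m+n (2 ^ k) 0))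

module _ {n} {X : Set} {ρ : X → Vec Word n} where

  bd-* : ∀ {f g : X → ℕ} → Bd ρ f → Bd ρ g → Bd ρ (λ x → f x * g x)
  bd-* (c , h) (c′ , h′) = c + c′ , λ x →
    ≤-trans (*-mono-≤ (h x) (h′ x)) (≤-reflexive (sym (^-distribˡ-+-* (2 + size (ρ x)) c c′)))

  -- The base `2 + size` is at least 2, so a factor of two is paid for by one more unit in the
  -- exponent.
  bd-+ : ∀ {f g : X → ℕ} → Bd ρ f → Bd ρ g → Bd ρ (λ x → f x + g x)
  bd-+ {f} {g} (c , h) (c′ , h′) = suc (c + c′) , λ x → begin
    f x + g x              ≤⟨ +-mono-≤ (≤-trans (h x) (^-monoʳ-≤ (P x) (m≤m+n c c′)))
                                       (≤-trans (h′ x) (^-monoʳ-≤ (P x) (m≤n+m c′ c))) ⟩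
    Q x + Q x              ≡⟨ cong (Q x +_) (+-identityʳ (Q x)) ⟨
    2 * Q x                ≤⟨ *-monoˡ-≤ (Q x) (m≤m+n 2 (size (ρ x))) ⟩
    P x * Q x              ∎
    where
    open ≤-Reasoning
    P Q : X → ℕ
    P x = 2 + size (ρ x)
    Q x = P x ^ (c + c′)

  bd-size : Bd ρ (size ∘ ρ)
  bd-size = 1 , λ x → ≤-trans (m≤n+m _ 2) (≤-reflexive (sym (*-identityʳ _)))

  -- If the inner size is at most `Q`, then adding 2 gives at most three, hence four, times `Q`; the
  -- factor 4 is absorbed by two more units in the exponent.
  bd-∘ : ∀ {m Y} {σ : Y → Vec Word m} {f : Y → ℕ} → Bd σ f → (g : X → Y) → Bd ρ (λ x → size (σ (g x))) → Bd ρ (f ∘ g)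
  bd-∘ {σ = σ} {f} (c , h) g (d , h′) = (2 + d) * c , λ x → begin
    f (g x)                       ≤⟨ h (g x) ⟩
    (2 + size (σ (g x))) ^ c      ≤⟨ ^-monoˡ-≤ c (begin
      2 + size (σ (g x))            ≤⟨ +-mono-≤ (+-mono-≤ (1≤pow (size (ρ x)) d) (1≤pow (size (ρ x)) d)) (h′ x) ⟩
      Q x + Q x + Q x               ≤⟨ three (Q x) ⟩
      2 * (2 * Q x)                 ≤⟨ *-mono-≤ (m≤m+n 2 (size (ρ x))) (*-monoˡ-≤ (Q x) (m≤m+n 2 (size (ρ x)))) ⟩
      P x * (P x * Q x)             ∎) ⟩
    (P x ^ (2 + d)) ^ c           ≡⟨ ^-*-assoc (P x) (2 + d) c ⟩
    P x ^ ((2 + d) * c)           ∎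
    where
    open ≤-Reasoning
    P Q : X → ℕ
    P x = 2 + size (ρ x)
    Q x = P x ^ d
    three : ∀ q → q + q + q ≤ 2 * (2 * q)
    three q = begin
      q + q + q           ≡⟨ +-assoc q q q ⟩
      q + (q + q)         ≤⟨ m≤m+n _ q ⟩
      q + (q + q) + q     ≡⟨ +-comm (q + (q + q)) q ⟩
      q + (q + (q + q))   ≡⟨ +-assoc q q (q + q) ⟨
      (q + q) + (q + q)   ≡⟨ cong₂ _+_ (cong (q +_) (+-identityʳ q)) (trans (+-identityʳ _) (cong (q +_) (+-identityʳ q))) ⟨
      2 * (2 * q)         ∎

length-lookup≤size : ∀ {n} (ws : Vec Word n) i → length (lookup ws i) ≤ size ws
length-lookup≤size (w ∷ ws) Fin.zero    = m≤m+n (length w) (size ws)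
length-lookup≤size (w ∷ ws) (Fin.suc i) = ≤-trans (length-lookup≤size ws i) (m≤n+m (size ws) (length w))

size≤ : ∀ {n} (ws : Vec Word n) {B} → (∀ i → length (lookup ws i) ≤ B) → size ws ≤ n * B
size≤ []       h = z≤n
size≤ (w ∷ ws) h = +-mono-≤ (h Fin.zero) (size≤ ws (h ∘ Fin.suc))

bd-ren : ∀ {n m} {X Y : Set} {ρ : X → Vec Word n} {σ : Y → Vec Word m} (g : X → Y) (τ : Fin m → Fin n) →
         (∀ x i → lookup (σ (g x)) i ≡ lookup (ρ x) (τ i)) → Bd ρ (λ x → size (σ (g x)))
bd-ren {m = m} {ρ = ρ} {σ} g τ eq = bd-≤ {ρ = ρ} (bd-* (bd-const m) bd-size) λ x →
  size≤ (σ (g x)) λ i → subst (λ w → length w ≤ size (ρ x)) (sym (eq x i)) (length-lookup≤size (ρ x) (τ i))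

bd-length : ∀ {n X} {ρ : X → Vec Word n} {f} → PT ρ f → Bd ρ (length ∘ f)
bd-length {ρ = ρ} (var i)         = bd-≤ bd-size λ x → length-lookup≤size (ρ x) i
bd-length         nil             = bd-const 0
bd-length         (cons b p)      = bd-+ (bd-const 1) (bd-length p)
bd-length         (fold h e z s H) = bd-∘ H (λ x → x , _) (bd-+ (bd-length e) bd-size)
bd-length {ρ = ρ} (ren {σ = σ} p g τ eq)  = bd-∘ (bd-length p) g (bd-ren {ρ = ρ} {σ} g τ eq)
bd-length         (ext p eq)      = bd-≤ (bd-length p) λ x → ≤-reflexive (cong length (sym (eq x)))

-- Compilation of the algorithms to loop programs

popCost : ℕ → Word → ℕ
popCost a []      = 1
popCost a (_ ∷ w) = suc (a + popCost a w)

-- The equation is carried along because the cost of a step is defined only on the valid states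
-- `At`. It passes to the next letter unchanged, since `(b ∷ v) ʳ++ w` reduces to `v ʳ++ (b ∷ w)`.
foldCost : ∀ {u : Word} → (∀ b (v w : Word) → v ʳ++ (b ∷ w) ≡ u → ℕ) → ∀ (v w : Word) → v ʳ++ w ≡ u → ℕ
foldCost c []      w eq = 1
foldCost c (b ∷ v) w eq = suc (c b v w eq + foldCost c v (b ∷ w) eq)

reverse² : ∀ (w : Word) → (w ʳ++ []) ʳ++ [] ≡ w
reverse² = reverse-involutive

updateCost : Word → Word → ℕ
updateCost u v = popCost 1 u + (popCost 2 v + (popCost 2 (v ʳ++ []) + 2))

cost : ∀ {n X} {ρ : X → Vec Word n} {f} → PT ρ f → X → ℕ
cost {ρ = ρ} (var i)              x = let w = lookup (ρ x) i in popCost 2 w + popCost 4 (w ʳ++ [])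
cost         nil                  x = 1
cost         (cons b p)           x = cost p x + 2
cost         (fold {e} h pe z s _) x =
  cost z x + (cost pe x + (popCost 2 (e x) +
    (foldCost {e x} (λ b v w eq → cost (s b) (x , w , v , eq) + updateCost (h x w) (h x (b ∷ w)))
              (e x ʳ++ []) [] (reverse² (e x)) + popCost 1 (e x))))
cost         (ren p g τ eq)       x = cost p (g x)
cost         (ext p eq)           x = cost p x

clear : ℕ → Prog
clear r = loop r λ _ → skip

pour : ℕ → ℕ → Prog
pour r r′ = loop r λ b → push b r′

-- Reading a register destroys it. To copy one, it is poured away, which reverses the word, and then
-- poured back into two registers, which restores both the order and the original.
pour₂ : ℕ → ℕ → ℕ → Prog
pour₂ t r r′ = loop t λ b → push b r ⨟ push b r′

-- During a fold, register `k` holds the value on the consumed suffix, `1 + k` the suffix itself,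
-- and `2 + k` the remaining letters, with the next one on top. The step leaves the new value in
-- `3 + k`, and `4 + k` serves to move it to `k` without reversing it.
underTwo : ∀ {n} → ℕ → (Fin n → ℕ) → Fin (2 + n) → ℕ
underTwo k env Fin.zero              = 1 + k
underTwo k env (Fin.suc Fin.zero)    = k
underTwo k env (Fin.suc (Fin.suc i)) = env i

update : ℕ → Bool → Prog
update k b = clear k ⨟ pour (3 + k) (4 + k) ⨟ pour (4 + k) k ⨟ push b (1 + k)

-- The result is left in register k; the registers above k are scratch space.
compile : ∀ {n X} {ρ : X → Vec Word n} {f} → PT ρ f → (Fin n → ℕ) → ℕ → Prog
compile (var i)        env k = pour (env i) (1 + k) ⨟ pour₂ (1 + k) (env i) k
compile nil            env k = skip
compile (cons b p)     env k = compile p env k ⨟ push b k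
compile (fold h e z s _) env k =
  compile z env k ⨟ compile e env (1 + k) ⨟ pour (1 + k) (2 + k) ⨟
  loop (2 + k) (λ b → compile (s b) (underTwo k env) (3 + k) ⨟ update k b) ⨟ clear (1 + k)
compile (ren p g τ eq) env k = compile p (env ∘ τ) k
compile (ext p eq)     env k = compile p env k

≡ᵇ-refl : ∀ r → (r ≡ᵇ r) ≡ true
≡ᵇ-refl zero    = refl
≡ᵇ-refl (suc r) = ≡ᵇ-refl r

upd-same : ∀ s r {w} → upd s r w r ≡ w
upd-same s r rewrite ≡ᵇ-refl r = refl

upd-other : ∀ s {q r w} → q ≢ r → upd s r w q ≡ s q
upd-other s {q} {r} ne with q ≡ᵇ r in eq
... | true  = contradiction (≡ᵇ⇒≡ q r (subst T (sym eq) tt)) ne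
... | false = refl

clear-run : ∀ w s r → s r ≡ w →
  ∃ λ s′ → Run (clear r) s (popCost 1 w) s′ × s′ r ≡ [] × (∀ q → q ≢ r → s′ q ≡ s q)
clear-run []      s r eq = s , done eq , eq , λ _ _ → refl
clear-run (b ∷ w) s r eq
  with s′ , R , e , F ← clear-run w (upd s r w) r (upd-same s r) =
  s′ , again eq skip R , e , λ q ne → trans (F q ne) (upd-other s ne)

pour-run : ∀ w s {r r′} → r ≢ r′ → s r ≡ w →
  ∃ λ s′ → Run (pour r r′) s (popCost 2 w) s′ × s′ r ≡ [] × s′ r′ ≡ w ʳ++ s r′ ×
           (∀ q → q ≢ r → q ≢ r′ → s′ q ≡ s q)
pour-run []      s ne eq = s , done eq , eq , refl , λ _ _ _ → refl
pour-run (b ∷ w) s {r} {r′} ne eq =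
  let s₁ = upd s r w
      s₂ = upd s₁ r′ (b ∷ s₁ r′)
      s′ , R , e , e′ , F = pour-run w s₂ ne (trans (upd-other s₁ ne) (upd-same s r))
  in s′ , again eq push R , e ,
     trans e′ (cong (w ʳ++_) (trans (upd-same s₁ r′) (cong (b ∷_) (upd-other s (ne ∘ sym))))) ,
     λ q n n′ → trans (F q n n′) (trans (upd-other s₁ n′) (upd-other s n))

pour₂-run : ∀ w s {t r r′} → t ≢ r → t ≢ r′ → r ≢ r′ → s t ≡ w →
  ∃ λ s′ → Run (pour₂ t r r′) s (popCost 4 w) s′ × s′ t ≡ [] × s′ r ≡ w ʳ++ s r × s′ r′ ≡ w ʳ++ s r′ ×
           (∀ q → q ≢ t → q ≢ r → q ≢ r′ → s′ q ≡ s q)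
pour₂-run []      s tr tr′ rr′ eq = s , done eq , eq , refl , refl , λ _ _ _ _ → refl
pour₂-run (b ∷ w) s {t} {r} {r′} tr tr′ rr′ eq =
  let s₁ = upd s t w
      s₂ = upd s₁ r (b ∷ s₁ r)
      s₃ = upd s₂ r′ (b ∷ s₂ r′)
      s′ , R , e , e′ , e″ , F = pour₂-run w s₃ tr tr′ rr′
        (trans (upd-other s₂ tr′) (trans (upd-other s₁ tr) (upd-same s t)))
  in s′ , again eq (push ⨟ push) R , e ,
     trans e′ (cong (w ʳ++_) (trans (upd-other s₂ rr′)
       (trans (upd-same s₁ r) (cong (b ∷_) (upd-other s (tr ∘ sym)))))) ,
     trans e″ (cong (w ʳ++_) (trans (upd-same s₂ r′)
       (cong (b ∷_) (trans (upd-other s₁ (rr′ ∘ sym)) (upd-other s (tr′ ∘ sym)))))) ,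
     λ q n n′ n″ → trans (F q n n′ n″) (trans (upd-other s₂ n″) (trans (upd-other s₁ n′) (upd-other s n)))

-- For frame conditions: a scratch register that was used and emptied again is treated on its own,
-- and all other registers by chaining the frame conditions of the parts.
except : ∀ a {P : ℕ → Set} → P a → (∀ q → q ≢ a → P q) → ∀ q → P q
except a Pa f q with q ≟ a
... | yes refl = Pa
... | no n     = f q n

apart : ∀ {a b} k → a ≢ b → a + k ≢ b + k
apart {a} {b} k ne eq = ne (+-cancelʳ-≡ k a b eq)

under : ∀ {r k} a → r < k → r ≢ a + k
under a r<k = <⇒≢ (≤-trans r<k (m≤n+m _ a))

over : ∀ {r k} a {b} → a < b → b + k ≤ r → r ≢ a + k
over {r} {k} a a<b le eq = <⇒≢ (≤-trans (+-monoˡ-≤ k a<b) le) (sym eq)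

update-run : ∀ k b {u v} s → s k ≡ u → s (3 + k) ≡ v → s (4 + k) ≡ [] →
  ∃ λ s′ → Run (update k b) s (updateCost u v) s′ × s′ k ≡ v × s′ (1 + k) ≡ b ∷ s (1 + k) × s′ (3 + k) ≡ [] ×
           s′ (4 + k) ≡ [] × (∀ q → q ≢ k → q ≢ 1 + k → q ≢ 3 + k → q ≢ 4 + k → s′ q ≡ s q)
update-run k b {u} {v} s eu ev e₄
  with s₁ , R₁ , e₁k , F₁ ← clear-run u s k eu
  with s₂ , R₂ , e₂₃ , e₂₄ , F₂ ← pour-run v s₁ {3 + k} {4 + k} (apart k λ ()) (trans (F₁ _ (apart k λ ())) ev)
  with eq₂ ← trans e₂₄ (cong (v ʳ++_) (trans (F₁ _ (apart k λ ())) e₄))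
  with s₃ , R₃ , e₃₄ , e₃k , F₃ ← pour-run (v ʳ++ []) s₂ {4 + k} {k} (apart k λ ()) eq₂ =
  upd s₃ (1 + k) (b ∷ s₃ (1 + k)) , R₁ ⨟ R₂ ⨟ R₃ ⨟ push ,
  trans (upd-other s₃ (apart k λ ()))
    (trans e₃k (trans (cong ((v ʳ++ []) ʳ++_) (trans (F₂ _ (apart k λ ()) (apart k λ ())) e₁k)) (reverse² v))) ,
  trans (upd-same s₃ (1 + k)) (cong (b ∷_) (trans (F₃ _ (apart k λ ()) (apart k λ ()))
    (trans (F₂ _ (apart k λ ()) (apart k λ ())) (F₁ _ (apart k λ ()))))) ,
  trans (upd-other s₃ (apart {3} {1} k λ ())) (trans (F₃ _ (apart k λ ()) (apart k λ ())) e₂₃) ,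
  trans (upd-other s₃ (apart {4} {1} k λ ())) e₃₄ ,
  λ q n n₁ n₃ n₄ → trans (upd-other s₃ n₁) (trans (F₃ q n₄ n) (trans (F₂ q n₃ n₄) (F₁ q n)))

Computes : ℕ → Prog → State → ℕ → Word → Set
Computes k p s t u = ∃ λ s′ → Run p s t s′ × s′ k ≡ u × (∀ q → q ≢ k → s′ q ≡ s q)

-- Everything except register `k` is restored, including the scratch space above it. So the
-- registers above `k` are empty again and the next subprogram can be started there.
correct : ∀ {n X} {ρ : X → Vec Word n} {f} (p : PT ρ f) env k → (∀ i → env i < k) → ∀ s x →
          (∀ i → s (env i) ≡ lookup (ρ x) i) → (∀ r → k ≤ r → s r ≡ []) →
          Computes k (compile p env k) s (cost p x) (f x)

-- Correctness of the step is a parameter: `fold-run` recurses on the remaining letters, while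
-- `correct` keeps recursing on subterms of the algorithm.
module _ {n} {X : Set} {ρ : X → Vec Word n} {e : X → Word} (h : X → Word → Word)
  (s : ∀ b → PT {suc (suc n)} {At e b} (λ (x , w , _) → w ∷ h x w ∷ ρ x) (λ (x , w , _) → h x (b ∷ w)))
  (env : Fin n → ℕ) (k : ℕ) (env< : ∀ i → env i < k) (x : X)
  (correct-s : ∀ b s₀ y → (∀ i → s₀ (underTwo k env i) ≡ lookup (proj₁ (proj₂ y) ∷ h (proj₁ y) (proj₁ (proj₂ y)) ∷ ρ (proj₁ y)) i) →
     (∀ r → 3 + k ≤ r → s₀ r ≡ []) →
     Computes (3 + k) (compile (s b) (underTwo k env) (3 + k)) s₀ (cost (s b) y) (h (proj₁ y) (b ∷ proj₁ (proj₂ y))))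
  where

  body : Bool → Prog
  body b = compile (s b) (underTwo k env) (3 + k) ⨟ update k b

  bodyCost : ∀ b v w → v ʳ++ (b ∷ w) ≡ e x → ℕ
  bodyCost b v w eq = cost (s b) (x , w , v , eq) + updateCost (h x w) (h x (b ∷ w))

  body-run : ∀ b v w eq s₀ → s₀ (1 + k) ≡ w → s₀ k ≡ h x w →
    (∀ i → s₀ (env i) ≡ lookup (ρ x) i) → (∀ r → 3 + k ≤ r → s₀ r ≡ []) →
    ∃ λ s′ → Run (body b) s₀ (bodyCost b v w eq) s′ × s′ (1 + k) ≡ b ∷ w × s′ k ≡ h x (b ∷ w) ×
             (∀ q → q ≢ k → q ≢ 1 + k → s′ q ≡ s₀ q)
  body-run b v w eq s₀ ew eh eρ free =
    let s₁ , R₁ , e₁ , F₁ = correct-s b s₀ (x , w , v , eq)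
           (λ { Fin.zero → ew ; (Fin.suc Fin.zero) → eh ; (Fin.suc (Fin.suc i)) → eρ i }) free
        s₂ , R₂ , e₂k , e₂₁ , e₂₃ , e₂₄ , F₂ = update-run k b s₁
           (trans (F₁ k (apart {0} {3} k λ ())) eh) e₁
           (trans (F₁ (4 + k) (apart {4} {3} k λ ())) (free (4 + k) (n≤1+n _)))
    in s₂ , R₁ ⨟ R₂ , trans e₂₁ (cong (b ∷_) (trans (F₁ (1 + k) (apart {1} {3} k λ ())) ew)) , e₂k ,
       except (3 + k) (λ _ _ → trans e₂₃ (sym (free (3 + k) ≤-refl))) (λ q n₃ →
         except (4 + k) {λ q → q ≢ 3 + k → q ≢ k → q ≢ 1 + k → s₂ q ≡ s₀ q}
           (λ _ _ _ → trans e₂₄ (sym (free (4 + k) (n≤1+n _))))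
           (λ q n₄ n₃ n n₁ → trans (F₂ q n n₁ n₃ n₄) (F₁ q n₃)) q n₃)

  fold-run : ∀ v w eq s₀ → s₀ (2 + k) ≡ v → s₀ (1 + k) ≡ w → s₀ k ≡ h x w →
    (∀ i → s₀ (env i) ≡ lookup (ρ x) i) → (∀ r → 3 + k ≤ r → s₀ r ≡ []) →
    ∃ λ s′ → Run (loop (2 + k) body) s₀ (foldCost bodyCost v w eq) s′ ×
             s′ (2 + k) ≡ [] × s′ (1 + k) ≡ e x × s′ k ≡ h x (e x) ×
             (∀ q → q ≢ k → q ≢ 1 + k → q ≢ 2 + k → s′ q ≡ s₀ q)
  fold-run []      w eq s₀ ev ew eh eρ free =
    s₀ , done ev , ev , trans ew eq , trans eh (cong (h x) eq) , λ _ _ _ _ → refl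
  fold-run (b ∷ v) w eq s₀ ev ew eh eρ free =
    let s₀′ = upd s₀ (2 + k) v
        s₁ , R₁ , e₁₁ , e₁k , F₁ = body-run b v w eq s₀′
           (trans (upd-other s₀ (apart {1} {2} k λ ())) ew) (trans (upd-other s₀ (apart {0} {2} k λ ())) eh)
           (λ i → trans (upd-other s₀ (under 2 (env< i))) (eρ i))
           (λ r le → trans (upd-other s₀ (over 2 ≤-refl le)) (free r le))
        s₂ , R₂ , e₂₂ , e₂₁ , e₂k , F₂ = fold-run v (b ∷ w) eq s₁
           (trans (F₁ (2 + k) (apart {2} {0} k λ ()) (apart {2} {1} k λ ())) (upd-same s₀ (2 + k))) e₁₁ e₁k
           (λ i → trans (F₁ _ (under 0 (env< i)) (under 1 (env< i)))
             (trans (upd-other s₀ (under 2 (env< i))) (eρ i)))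
           (λ r le → trans (F₁ r (over 0 (s≤s z≤n) le) (over 1 (s≤s (s≤s z≤n)) le))
             (trans (upd-other s₀ (over 2 ≤-refl le)) (free r le)))
    in s₂ , again ev R₁ R₂ , e₂₂ , e₂₁ , e₂k ,
       λ q n n₁ n₂ → trans (F₂ q n n₁ n₂) (trans (F₁ q n n₁) (upd-other s₀ n₂))

correct {ρ = ρ} (var i) env k env< s x eρ free =
  let w = lookup (ρ x) i
      r = env i
      r≢k  = under 0 (env< i)
      r≢1k = under 1 (env< i)
      s₁ , R₁ , e₁ᵢ , e₁₁ , F₁ = pour-run w s {r} {1 + k} r≢1k (eρ i)
      s₂ , R₂ , e₂₁ , e₂ᵢ , e₂k , F₂ = pour₂-run (w ʳ++ []) s₁ {1 + k} {r} {k}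
        (r≢1k ∘ sym) (apart {1} {0} k λ ()) r≢k
        (trans e₁₁ (cong (w ʳ++_) (free (1 + k) (n≤1+n k))))
  in s₂ , R₁ ⨟ R₂ ,
     trans e₂k (trans (cong ((w ʳ++ []) ʳ++_)
       (trans (F₁ k (r≢k ∘ sym) (apart {0} {1} k λ ())) (free k ≤-refl))) (reverse² w)) ,
     except (1 + k) (λ _ → trans e₂₁ (sym (free (1 + k) (n≤1+n k)))) (λ q n₁ →
       except r {λ q → q ≢ 1 + k → q ≢ k → s₂ q ≡ s q}
         (λ _ _ → trans e₂ᵢ (trans (cong ((w ʳ++ []) ʳ++_) e₁ᵢ) (trans (reverse² w) (sym (eρ i)))))
         (λ q nᵢ n₁ n → trans (F₂ q n₁ nᵢ n) (F₁ q nᵢ n₁)) q n₁)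
correct nil env k env< s x eρ free = s , skip , free k ≤-refl , λ _ _ → refl
correct (cons b p) env k env< s x eρ free =
  let s₁ , R₁ , e₁ , F₁ = correct p env k env< s x eρ free
  in upd s₁ k (b ∷ s₁ k) , R₁ ⨟ push , trans (upd-same s₁ k) (cong (b ∷_) e₁) ,
     λ q n → trans (upd-other s₁ n) (F₁ q n)
correct {ρ = ρ} (fold {e} h pe pz ps _) env k env< s x eρ free =
  let s₁ , R₁ , e₁ , F₁ = correct pz env k env< s x eρ free
      s₂ , R₂ , e₂ , F₂ = correct pe env (1 + k) (m≤n⇒m≤1+n ∘ env<) s₁ x
        (λ i → trans (F₁ _ (under 0 (env< i))) (eρ i))
        (λ r le → trans (F₁ r (over 0 (s≤s z≤n) le)) (free r (≤-trans (n≤1+n k) le)))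
      s₃ , R₃ , e₃₁ , e₃₂ , F₃ = pour-run (e x) s₂ {1 + k} {2 + k} (apart {1} {2} k λ ()) e₂
      s₄ , R₄ , e₄₂ , e₄₁ , e₄k , F₄ = fold-run {ρ = ρ} {e} h ps env k env< x
        (λ b s₀ y → correct (ps b) (underTwo k env) (3 + k)
          (λ { Fin.zero → s≤s (s≤s (n≤1+n k)) ; (Fin.suc Fin.zero) → s≤s (m≤n+m k 2)
             ; (Fin.suc (Fin.suc i)) → ≤-trans (env< i) (m≤n+m k 3) }) s₀ y)
        (e x ʳ++ []) [] (reverse² (e x)) s₃
        (trans e₃₂ (cong (e x ʳ++_) (trans (F₂ (2 + k) (apart {2} {1} k λ ()))
          (trans (F₁ (2 + k) (apart {2} {0} k λ ())) (free (2 + k) (m≤n+m k 2))))))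
        e₃₁
        (trans (F₃ k (apart {0} {1} k λ ()) (apart {0} {2} k λ ())) (trans (F₂ k (apart {0} {1} k λ ())) e₁))
        (λ i → trans (F₃ _ (under 1 (env< i)) (under 2 (env< i)))
          (trans (F₂ _ (under 1 (env< i))) (trans (F₁ _ (under 0 (env< i))) (eρ i))))
        (λ r le → trans (F₃ r (over 1 (s≤s (s≤s z≤n)) le) (over 2 ≤-refl le))
          (trans (F₂ r (over 1 (s≤s (s≤s z≤n)) le))
            (trans (F₁ r (over 0 (s≤s z≤n) le)) (free r (≤-trans (m≤n+m k 3) le)))))
      s₅ , R₅ , e₅ , F₅ = clear-run (e x) s₄ (1 + k) e₄₁
  in s₅ , R₁ ⨟ R₂ ⨟ R₃ ⨟ R₄ ⨟ R₅ , trans (F₅ k (apart {0} {1} k λ ())) e₄k ,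
     except (1 + k) (λ _ → trans e₅ (sym (free (1 + k) (n≤1+n k)))) (λ q n₁ →
       except (2 + k) {λ q → q ≢ 1 + k → q ≢ k → s₅ q ≡ s q}
         (λ n₁ _ → trans (F₅ (2 + k) n₁) (trans e₄₂ (sym (free (2 + k) (m≤n+m k 2)))))
         (λ q n₂ n₁ n → trans (F₅ q n₁) (trans (F₄ q n n₁ n₂) (trans (F₃ q n₁ n₂) (trans (F₂ q n₁) (F₁ q n)))))
         q n₁)
correct (ren p g τ eq) env k env< s x eρ free =
  correct p (env ∘ τ) k (env< ∘ τ) s (g x) (λ i → trans (eρ (τ i)) (sym (eq x i))) free
correct (ext p eq) env k env< s x eρ free =
  let s₁ , R₁ , e₁ , F₁ = correct p env k env< s x eρ free in s₁ , R₁ , trans e₁ (eq x) , F₁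

-- Polynomial running time

bd-^ : ∀ {n} {X : Set} {ρ : X → Vec Word n} {f : X → ℕ} → Bd ρ f → ∀ c → Bd ρ (λ x → f x ^ c)
bd-^ H zero    = bd-const 1
bd-^ H (suc c) = bd-* H (bd-^ H c)

popCost≤ : ∀ a w {n} → length w ≤ n → popCost a w ≤ 1 + suc a * n
popCost≤ a []      _       = s≤s z≤n
popCost≤ a (_ ∷ w) {suc n} (s≤s h) = s≤s (begin
  a + popCost a w           ≤⟨ +-monoʳ-≤ a (popCost≤ a w h) ⟩
  a + suc (suc a * n)       ≡⟨ +-suc a _ ⟩
  suc a + suc a * n         ≡⟨ *-suc (suc a) n ⟨
  suc a * suc n             ∎)
  where open ≤-Reasoning

updateCost≤ : ∀ u v {n} → length u ≤ n → length v ≤ n →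
              updateCost u v ≤ (1 + 2 * n) + ((1 + 3 * n) + ((1 + 3 * n) + 2))
updateCost≤ u v hu hv = +-mono-≤ (popCost≤ 1 u hu) (+-mono-≤ (popCost≤ 2 v hv)
  (+-monoˡ-≤ 2 (popCost≤ 2 (v ʳ++ []) (≤-trans (≤-reflexive (length-reverse v)) hv))))

foldCost≤ : ∀ {u : Word} (c : ∀ b (v w : Word) → v ʳ++ (b ∷ w) ≡ u → ℕ) {B} → (∀ b v w eq → c b v w eq ≤ B) →
            ∀ v w eq → foldCost c v w eq ≤ 1 + length v * suc B
foldCost≤ c h []      w eq = ≤-refl
foldCost≤ c {B} h (b ∷ v) w eq = s≤s (begin
  c b v w eq + foldCost c v (b ∷ w) eq ≤⟨ +-mono-≤ (h b v w eq) (foldCost≤ c h v (b ∷ w) eq) ⟩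
  B + suc (length v * suc B)           ≡⟨ +-suc B _ ⟩
  suc B + length v * suc B             ∎)
  where open ≤-Reasoning

-- The critical case is a fold. Its length bound limits all intermediate values by `A x`, so every
-- step is run on words of total size at most `U x` and there is one bound `perLetter x` for all
-- letters. Without it, values could double in every step.
bd-cost : ∀ {n} {X : Set} {ρ : X → Vec Word n} {f} (p : PT ρ f) → Bd ρ (cost p)
bd-cost {ρ = ρ} (var i) = bd-≤ (bd-+ (bd-+ (bd-const 1) (bd-* (bd-const 3) bd-size))
                                     (bd-+ (bd-const 1) (bd-* (bd-const 5) bd-size))) λ x →
  let w = lookup (ρ x) i ; h = length-lookup≤size (ρ x) i
  in +-mono-≤ (popCost≤ 2 w h) (popCost≤ 4 (w ʳ++ []) (≤-trans (≤-reflexive (length-reverse w)) h))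
bd-cost nil = bd-const 1
bd-cost (cons b p) = bd-+ (bd-cost p) (bd-const 2)
bd-cost {n} {X} {ρ = ρ} (fold {e} h pe pz ps (c , H)) =
  bd-≤ (bd-+ (bd-cost pz) (bd-+ (bd-cost pe) (bd-+ (bd-pop 2)
    (bd-+ (bd-+ (bd-const 1) (bd-* bd-E (bd-+ (bd-const 1) bd-perLetter))) (bd-pop 1))))) λ x →
  +-monoʳ-≤ (cost pz x) (+-monoʳ-≤ (cost pe x) (+-mono-≤ (popCost≤ 2 (e x) ≤-refl) (+-mono-≤
    (≤-trans (foldCost≤ _ {perLetter x} (perLetter≤ x) (e x ʳ++ []) [] (reverse² (e x)))
      (≤-reflexive (cong (λ l → 1 + l * suc (perLetter x)) (length-reverse (e x)))))
    (popCost≤ 1 (e x) ≤-refl))))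
  where
  E A : X → ℕ
  E x = length (e x)
  A x = (2 + (E x + size (ρ x))) ^ c

  bd-E : Bd ρ E
  bd-E = bd-length pe

  bd-pop : ∀ a → Bd ρ (λ x → 1 + suc a * E x)
  bd-pop a = bd-+ (bd-const 1) (bd-* (bd-const (suc a)) bd-E)

  bd-A : Bd ρ A
  bd-A = bd-^ (bd-+ (bd-const 2) (bd-+ bd-E bd-size)) c

  C : Bool → ℕ
  C b = Bd.exponent (bd-cost (ps b))

  U upd-bound perLetter : X → ℕ
  U x = 2 + (E x + (A x + size (ρ x)))
  upd-bound x = (1 + 2 * A x) + ((1 + 3 * A x) + ((1 + 3 * A x) + 2))
  perLetter x = (U x ^ C false + U x ^ C true) + upd-bound x

  bd-U : Bd ρ U
  bd-U = bd-+ (bd-const 2) (bd-+ bd-E (bd-+ bd-A bd-size))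

  bd-perLetter : Bd ρ perLetter
  bd-perLetter = bd-+ (bd-+ (bd-^ bd-U (C false)) (bd-^ bd-U (C true)))
    (bd-+ (bd-+ (bd-const 1) (bd-* (bd-const 2) bd-A))
      (bd-+ (bd-+ (bd-const 1) (bd-* (bd-const 3) bd-A)) (bd-+ (bd-+ (bd-const 1) (bd-* (bd-const 3) bd-A)) (bd-const 2))))

  h≤A : ∀ x w → length w ≤ E x → length (h x w) ≤ A x
  h≤A x w le = ≤-trans (H (x , w)) (^-monoˡ-≤ c (+-monoʳ-≤ 2 (+-monoˡ-≤ (size (ρ x)) le)))

  cost≤ : ∀ b x w v eq → length w ≤ E x → cost (ps b) (x , w , v , eq) ≤ U x ^ C b
  cost≤ b x w v eq le = ≤-trans (Bd.bounded (bd-cost (ps b)) (x , w , v , eq))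
    (^-monoˡ-≤ (C b) (+-monoʳ-≤ 2 (+-mono-≤ le (+-monoˡ-≤ (size (ρ x)) (h≤A x w le)))))

  either : ∀ b x → U x ^ C b ≤ U x ^ C false + U x ^ C true
  either false x = m≤m+n _ _
  either true  x = m≤n+m _ _

  perLetter≤ : ∀ x b v w eq → cost (ps b) (x , w , v , eq) + updateCost (h x w) (h x (b ∷ w)) ≤ perLetter x
  perLetter≤ x b v w eq = +-mono-≤ (≤-trans (cost≤ b x w v eq (≤-trans (n≤1+n _) le)) (either b x))
    (updateCost≤ (h x w) (h x (b ∷ w)) (h≤A x w (≤-trans (n≤1+n _) le)) (h≤A x (b ∷ w) le))
    where
    -- The equation in `At` makes `b ∷ w` a suffix of `e x`, so the length bound is only used up to
    -- the length of `e x`.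
    le : length (b ∷ w) ≤ E x
    le = ≤-trans (m≤n+m _ (length v)) (≤-reflexive (trans (sym (length-ʳ++ v)) (cong length eq)))
bd-cost {ρ = ρ} (ren {σ = σ} p g τ eq) = bd-∘ (bd-cost p) g (bd-ren {ρ = ρ} {σ} g τ eq)
bd-cost (ext p eq) = bd-cost p

-- The coefficients of a + (2 + X) p, where `a` is the coefficient that multiplication by X shifts
-- into the current place.
timesTwoPlusX : ℕ → List ℕ → List ℕ
timesTwoPlusX a []      = a ∷ []
timesTwoPlusX a (b ∷ p) = (a + 2 * b) ∷ timesTwoPlusX b p

eval-timesTwoPlusX : ∀ a p n → eval (timesTwoPlusX a p) n ≡ a + (2 + n) * eval p n
eval-timesTwoPlusX a []      n = cong (a +_) (trans (*-zeroʳ n) (sym (*-zeroʳ (2 + n))))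
eval-timesTwoPlusX a (b ∷ p) n rewrite eval-timesTwoPlusX b p n = solve 4
  (λ a b n q → a :+ con 2 :* b :+ n :* (b :+ (con 2 :+ n) :* q) :=
               a :+ (con 2 :+ n) :* (b :+ n :* q)) refl a b n (eval p n)

twoPlusX^ : ℕ → List ℕ
twoPlusX^ zero    = 1 ∷ []
twoPlusX^ (suc c) = timesTwoPlusX 0 (twoPlusX^ c)

eval-twoPlusX^ : ∀ c n → eval (twoPlusX^ c) n ≡ (2 + n) ^ c
eval-twoPlusX^ zero    n = cong suc (*-zeroʳ n)
eval-twoPlusX^ (suc c) n = trans (eval-timesTwoPlusX 0 (twoPlusX^ c) n) (cong ((2 + n) *_) (eval-twoPlusX^ c n))

-- From algorithms to Turing machines with several outputs

data PTs {n} {X : Set} (ρ : X → Vec Word n) : ∀ {m} → (X → Vec Word m) → Set₁ where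
  []  : PTs ρ (λ _ → [])
  _∷_ : ∀ {f m} {σ : X → Vec Word m} → PT ρ f → PTs ρ σ → PTs ρ (λ x → f x ∷ σ x)

module _ {n} {X : Set} {ρ : X → Vec Word n} where

  compiles : ∀ {m} {σ : X → Vec Word m} → PTs ρ σ → ℕ → Prog
  compiles []       k = skip
  compiles (p ∷ ps) k = compile p toℕ k ⨟ compiles ps (1 + k)

  costs : ∀ {m} {σ : X → Vec Word m} → PTs ρ σ → X → ℕ
  costs []       x = 1
  costs (p ∷ ps) x = cost p x + costs ps x

  bd-costs : ∀ {m} {σ : X → Vec Word m} (ps : PTs ρ σ) → Bd ρ (costs ps)
  bd-costs []       = bd-const 1
  bd-costs (p ∷ ps) = bd-+ (bd-cost p) (bd-costs ps)

  corrects : ∀ {m} {σ : X → Vec Word m} (ps : PTs ρ σ) k → n ≤ k → ∀ s x →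
    (∀ i → s (toℕ i) ≡ lookup (ρ x) i) → (∀ r → k ≤ r → s r ≡ []) →
    ∃ λ s′ → Run (compiles ps k) s (costs ps x) s′ × (∀ i → s′ (k + toℕ i) ≡ lookup (σ x) i) ×
             (∀ q → q < k → s′ q ≡ s q)
  corrects []       k n≤k s x eρ free = s , skip , (λ ()) , λ _ _ → refl
  corrects (p ∷ ps) k n≤k s x eρ free =
    let s₁ , R₁ , e₁ , F₁ = correct p toℕ k (λ i → ≤-trans (toℕ<n i) n≤k) s x eρ free
        s₂ , R₂ , e₂ , F₂ = corrects ps (1 + k) (m≤n⇒m≤1+n n≤k) s₁ x
          (λ i → trans (F₁ _ (<⇒≢ (≤-trans (toℕ<n i) n≤k))) (eρ i))
          (λ r le → trans (F₁ r (<⇒≢ le ∘ sym)) (free r (≤-trans (n≤1+n k) le)))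
    in s₂ , R₁ ⨟ R₂ ,
       (λ { Fin.zero    → trans (cong s₂ (+-identityʳ k)) (trans (F₂ k ≤-refl) e₁)
          ; (Fin.suc i) → trans (cong s₂ (+-suc k (toℕ i))) (e₂ i) }) ,
       λ q lt → trans (F₂ q (m≤n⇒m≤1+n lt)) (F₁ q (<⇒≢ lt))

inputs-lookup : ∀ {a} (ws : Vec Word a) i → inputs ws (toℕ i) ≡ lookup ws i
inputs-lookup (w ∷ ws) Fin.zero    = refl
inputs-lookup (w ∷ ws) (Fin.suc i) = inputs-lookup ws i

inputs-beyond : ∀ {a} (ws : Vec Word a) r → a ≤ r → inputs ws r ≡ []
inputs-beyond []       r       _       = refl
inputs-beyond (w ∷ ws) (suc r) (s≤s h) = inputs-beyond ws r h

polyTime : ∀ {I O : Set} {a b} (encI : I → Vec Word a) (encO : O → Vec Word b) (f : I → O) →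
           PTs encI (encO ∘ f) → PolyTime encI encO f
polyTime {a = a} {b} encI encO f ps =
  machine a b (compiles ps a) , twoPlusX^ (Bd.exponent bd) , λ i →
  let s , R , e , _ = corrects ps a ≤-refl (inputs (encI i)) i (inputs-lookup (encI i)) (inputs-beyond (encI i))
  in costs ps i , ≤-trans (Bd.bounded bd i) (≤-reflexive (sym (eval-twoPlusX^ (Bd.exponent bd) (size (encI i))))) ,
     machine-outputs (compiles ps a) R e
  where bd = bd-costs ps

computable : ∀ {I O : Set} {a b} (encI : I → Vec Word a) (encO : O → Vec Word b) (f : I → O) →
             PTs encI (encO ∘ f) → Computable encI encO f
computable encI encO f ps = let M , _ , h = polyTime encI encO f ps in M , λ i → let t , _ , o = h i in t , o

-- Arithmetic in unary, Booleans and words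

flag : Bool → Word
flag b = if b then true ∷ [] else []

infixl 6 _▹
_▹ : (X → Vec Word n) → X × ℕ → Vec Word (suc n)
(ρ ▹) (x , j) = unary j ∷ ρ x

suffix-unary : ∀ v {b w} m → v ʳ++ (b ∷ w) ≡ unary m → w ≡ unary (length w)
suffix-unary []      (suc m) refl = cong unary (sym (length-replicate m))
suffix-unary (c ∷ v) m       eq   with suffix-unary v m eq
... | eq′ = cong (List.drop 1) eq′

module _ {ρ : X → Vec Word n} where

  wk : ∀ {f} → PT ρ f → PT (ρ ▹) (f ∘ proj₁)
  wk p = ren p proj₁ Fin.suc λ _ _ → refl

  wk₂ : ∀ {Z : Set} {a b : Z → Word} {f} (g : Z → X) → PT ρ f → PT (λ z → a z ∷ b z ∷ ρ (g z)) (f ∘ g)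
  wk₂ g p = ren p g (Fin.suc ∘ Fin.suc) λ _ _ → refl

  wkAcc : ∀ {a : X × ℕ → Word} {f} → PT (ρ ▹) f → PT (λ z → unary (proj₂ z) ∷ a z ∷ ρ (proj₁ z)) f
  wkAcc p = ren p id (λ { Fin.zero → Fin.zero ; (Fin.suc i) → Fin.suc (Fin.suc i) })
                     (λ { _ Fin.zero → refl ; _ (Fin.suc i) → refl })

  -- A fold over a unary word, whose consumed suffix is the loop counter. The step is an algorithm
  -- for unary counters only; this suffices because `At` admits only suffixes of `unary (e x)`,
  -- which are unary by `suffix-unary`.
  loopℕ : ∀ {e : X → ℕ} (h : X → ℕ → Word) → PT ρ (unary ∘ e) → PT ρ (λ x → h x 0) →
          PT (λ ((x , j) : X × ℕ) → unary j ∷ h x j ∷ ρ x) (λ (x , j) → h x (suc j)) →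
          Bd (ρ ▹) (λ (x , j) → length (h x j)) → PT ρ (λ x → h x (e x))
  loopℕ {e} h pe pz ps (c , H) =
    ext (fold (λ x w → h x (length w)) pe pz
          (λ b → ren ps (λ (x , w , _) → x , length w) id λ where
            (x , w , v , eq) Fin.zero    → sym (suffix-unary v (e x) eq)
            _                (Fin.suc i) → refl)
          (c , λ (x , w) → ≤-trans (H (x , length w))
            (≤-reflexive (cong (λ l → (2 + (l + size (ρ x))) ^ c) (length-replicate (length w))))))
      (λ x → cong (h x) (length-replicate (e x)))

  bd-unary : ∀ {f} → PT ρ (unary ∘ f) → Bd ρ f
  bd-unary {f} p = bd-≤ (bd-length p) λ x → ≤-reflexive (sym (length-replicate (f x)))

  bd-len-unary : ∀ {f} → Bd ρ f → Bd ρ (length ∘ unary ∘ f)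
  bd-len-unary {f} H = bd-≤ H λ x → ≤-reflexive (length-replicate (f x))

  bd-wk : ∀ {f} → Bd ρ f → Bd (ρ ▹) (f ∘ proj₁)
  bd-wk H = bd-∘ H proj₁ (bd-≤ bd-size λ (x , j) → m≤n+m _ (length (unary j)))

bd-index : {ρ : X → Vec Word n} → Bd (ρ ▹) proj₂
bd-index = bd-≤ bd-size λ (x , j) → ≤-trans (≤-reflexive (sym (length-replicate j))) (m≤m+n _ _)

-- The bound on the increments grows with the index, so its value at `j` dominates all `j`
-- increments before it, and `j` times this value is again polynomial.
bd-additive : {ρ : X → Vec Word n} (h g : X → ℕ → ℕ) → (∀ x j → h x (suc j) ≤ g x j + h x j) →
              Bd ρ (λ x → h x 0) → Bd (ρ ▹) (λ (x , j) → g x j) → Bd (ρ ▹) (λ (x , j) → h x j)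
bd-additive {ρ = ρ} h g h≤ H₀ (c , G) = bd-≤ (bd-+ (bd-* bd-index (bd-^ (bd-+ (bd-const 2) bd-size) c)) (bd-wk H₀))
  λ (x , j) → go x j j ≤-refl
  where
  go : ∀ x j i → i ≤ j → h x i ≤ i * (2 + size ((ρ ▹) (x , j))) ^ c + h x 0
  go x j zero    _  = ≤-refl
  go x j (suc i) lt = ≤-trans (h≤ x i) (≤-trans (+-mono-≤ (≤-trans (G (x , i)) (^-monoˡ-≤ c
      (+-monoʳ-≤ 2 (+-monoˡ-≤ (size (ρ x)) (subst₂ _≤_ (sym (length-replicate i)) (sym (length-replicate j)) (≤-trans (n≤1+n i) lt))))))
      (go x j i (≤-trans (n≤1+n i) lt)))
    (≤-reflexive (sym (+-assoc P _ _))))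
    where P = (2 + size ((ρ ▹) (x , j))) ^ c

module _ {ρ : X → Vec Word n} where

  app : ∀ {f g} → PT ρ f → PT ρ g → PT ρ (λ x → f x ++ g x)
  app {f} {g} p q = fold (λ x w → w ++ g x) p q (λ b → cons b (var (Fin.suc Fin.zero)))
    (bd-≤ (bd-+ (bd-size) (bd-∘ (bd-length q) proj₁ (bd-≤ bd-size λ (x , w) → m≤n+m _ (length w)))) λ (x , w) →
      ≤-trans (≤-reflexive (length-++ w)) (+-monoˡ-≤ _ (m≤m+n (length w) _)))

  -- Branching is a fold whose step ignores the previous value: a single letter is enough to replace
  -- `f x` by `g x`.
  ifNull : ∀ {e f g} → PT ρ e → PT ρ f → PT ρ g → PT ρ (λ x → if List.null (e x) then f x else g x)
  ifNull {f = f} {g} p q r = fold (λ x w → if List.null w then f x else g x) p q (λ b → wk₂ proj₁ r)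
    (bd-≤ (bd-∘ (bd-+ (bd-length q) (bd-length r)) proj₁ (bd-≤ bd-size λ (x , w) → m≤n+m _ (length w)))
      λ { (x , []) → m≤m+n _ _ ; (x , _ ∷ _) → m≤n+m _ _ })

  ite : ∀ {p f g} → PT ρ (flag ∘ p) → PT ρ f → PT ρ g → PT ρ (λ x → if p x then f x else g x)
  ite {p} P F G = ext (ifNull P G F) λ x → lemma (p x)
    where
    lemma : ∀ b {u v : Word} → (if List.null (flag b) then u else v) ≡ (if b then v else u)
    lemma false = refl
    lemma true  = refl

  tail : ∀ {f} → PT ρ f → PT ρ (λ x → drop 1 (f x))
  tail p = fold (λ x w → drop 1 w) p nil (λ b → var Fin.zero)
    (bd-≤ bd-size λ (x , w) → ≤-trans (≤-reflexive (length-drop 1 w)) (≤-trans (m∸n≤m (length w) 1) (m≤m+n _ _)))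

  constℕ : ∀ k → PT ρ (λ _ → unary k)
  constℕ zero    = nil
  constℕ (suc k) = cons true (constℕ k)

  constB : ∀ b → PT ρ (λ _ → flag b)
  constB false = nil
  constB true  = cons true nil

module _ {ρ : X → Vec Word n} where

  plus : ∀ {f g : X → ℕ} → PT ρ (unary ∘ f) → PT ρ (unary ∘ g) → PT ρ (λ x → unary (f x + g x))
  plus {g = g} p q = loopℕ (λ x j → unary (j + g x)) p q (cons true (var (Fin.suc Fin.zero)))
    (bd-len-unary (bd-+ bd-index (bd-wk (bd-unary q))))

  predℕ : ∀ {f : X → ℕ} → PT ρ (unary ∘ f) → PT ρ (λ x → unary (pred (f x)))
  predℕ p = loopℕ (λ x j → unary (pred j)) p nil (var Fin.zero)
    (bd-len-unary (bd-≤ bd-index λ (x , j) → pred[n]≤n))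

-- Reopening the module makes `plus` and `predℕ` available at the environment of a loop body.
module _ {ρ : X → Vec Word n} where

  times : ∀ {f g : X → ℕ} → PT ρ (unary ∘ f) → PT ρ (unary ∘ g) → PT ρ (λ x → unary (f x * g x))
  times {g = g} p q = loopℕ (λ x j → unary (j * g x)) p nil (plus (wk₂ proj₁ q) (var (Fin.suc Fin.zero)))
    (bd-len-unary (bd-* bd-index (bd-wk (bd-unary q))))

  monus : ∀ {f g : X → ℕ} → PT ρ (unary ∘ f) → PT ρ (unary ∘ g) → PT ρ (λ x → unary (f x ∸ g x))
  monus {f} p q = loopℕ (λ x j → unary (f x ∸ j)) q p
    (ext (predℕ {f = λ (x , j) → f x ∸ j} (var (Fin.suc Fin.zero))) λ (x , j) → cong unary (pred[m∸n]≡m∸[1+n] (f x) j))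
    (bd-len-unary (bd-≤ (bd-wk (bd-unary p)) λ (x , j) → m∸n≤m (f x) j))

  isZero : ∀ {f : X → ℕ} → PT ρ (unary ∘ f) → PT ρ (λ x → flag (f x ≡ᵇ 0))
  isZero p = loopℕ (λ x j → flag (j ≡ᵇ 0)) p (cons true nil) nil
    (bd-≤ (bd-const 1) λ { (x , zero) → ≤-refl ; (x , suc j) → z≤n })

  notB : ∀ {p : X → Bool} → PT ρ (flag ∘ p) → PT ρ (flag ∘ not ∘ p)
  notB {p} P = ext (ite P nil (constB true)) λ x → lemma (p x)
    where
    lemma : ∀ b → (if b then [] else flag true) ≡ flag (not b)
    lemma false = refl
    lemma true  = refl

  andB : ∀ {p q : X → Bool} → PT ρ (flag ∘ p) → PT ρ (flag ∘ q) → PT ρ (λ x → flag (p x ∧ q x))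
  andB {p} {q} P Q = ext (ite P Q nil) λ x → lemma (p x) (q x)
    where
    lemma : ∀ b c → (if b then flag c else []) ≡ flag (b ∧ c)
    lemma false c = refl
    lemma true  c = refl

  orB : ∀ {p q : X → Bool} → PT ρ (flag ∘ p) → PT ρ (flag ∘ q) → PT ρ (λ x → flag (p x ∨ q x))
  orB {p} {q} P Q = ext (ite P (constB true) Q) λ x → lemma (p x) (q x)
    where
    lemma : ∀ b c → (if b then flag true else flag c) ≡ flag (b ∨ c)
    lemma false c = refl
    lemma true  c = refl

  letter : ∀ {p : X → Bool} → PT ρ (flag ∘ p) → PT ρ (λ x → p x ∷ [])
  letter {p} P = ext (ite P (cons true nil) (cons false nil)) λ x → lemma (p x)
    where
    lemma : ∀ b → (if b then true ∷ [] else false ∷ []) ≡ b ∷ []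
    lemma false = refl
    lemma true  = refl

module _ {ρ : X → Vec Word n} where

  xorB : ∀ {p q : X → Bool} → PT ρ (flag ∘ p) → PT ρ (flag ∘ q) → PT ρ (λ x → flag (p x xor q x))
  xorB {p} {q} P Q = ext (ite P (notB Q) Q) λ x → lemma (p x) (q x)
    where
    lemma : ∀ b c → (if b then flag (not c) else flag c) ≡ flag (b xor c)
    lemma false c = refl
    lemma true  c = refl

  leq : ∀ {f g : X → ℕ} → PT ρ (unary ∘ f) → PT ρ (unary ∘ g) → PT ρ (λ x → flag (f x ≤ᵇ g x))
  leq {f} {g} p q = ext (isZero (monus p q)) λ x → cong flag (lemma (f x) (g x))
    where
    lemma : ∀ i j → (i ∸ j ≡ᵇ 0) ≡ (i ≤ᵇ j)
    lemma zero    zero    = refl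
    lemma zero    (suc j) = refl
    lemma (suc i) zero    = refl
    lemma (suc zero)    (suc j) = lemma zero j
    lemma (suc (suc i)) (suc j) = lemma (suc i) j

  equal : ∀ {f g : X → ℕ} → PT ρ (unary ∘ f) → PT ρ (unary ∘ g) → PT ρ (λ x → flag (f x ≡ᵇ g x))
  equal {f} {g} p q = ext (isZero (plus (monus p q) (monus q p))) λ x → cong flag (lemma (f x) (g x))
    where
    lemma : ∀ i j → ((i ∸ j) + (j ∸ i) ≡ᵇ 0) ≡ (i ≡ᵇ j)
    lemma zero    zero    = refl
    lemma zero    (suc j) = refl
    lemma (suc i) zero    = refl
    lemma (suc i) (suc j) = lemma i j

  lengthℕ : ∀ {f} → PT ρ f → PT ρ (λ x → unary (length (f x)))
  lengthℕ p = fold (λ x w → unary (length w)) p nil (λ b → cons true (var (Fin.suc Fin.zero)))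
    (bd-≤ bd-size λ (x , w) → ≤-trans (≤-reflexive (length-replicate (length w))) (m≤m+n _ _))

  headB : ∀ {f} → PT ρ f → PT ρ (λ x → flag (bit (f x) 0))
  headB p = fold (λ x w → flag (bit w 0)) p nil (λ { false → nil ; true → cons true nil })
    (bd-≤ (bd-const 1) λ { (x , []) → z≤n ; (x , false ∷ w) → z≤n ; (x , true ∷ w) → ≤-refl })

  dropℕ : ∀ {e : X → ℕ} {f} → PT ρ (unary ∘ e) → PT ρ f → PT ρ (λ x → drop (e x) (f x))
  dropℕ {f = f} p q = loopℕ (λ x j → drop j (f x)) p q
    (ext (tail (var (Fin.suc Fin.zero))) λ (x , j) → trans (drop-drop j 1 (f x)) (cong (λ i → drop i (f x)) (+-comm j 1)))
    (bd-≤ (bd-wk (bd-length q)) λ (x , j) → ≤-trans (≤-reflexive (length-drop j (f x))) (m∸n≤m _ j))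

bit-drop : ∀ i w → bit (drop i w) 0 ≡ bit w i
bit-drop zero    w       = refl
bit-drop (suc i) []      = refl
bit-drop (suc i) (b ∷ w) = bit-drop i w

catenate : ℕ → (ℕ → Word) → Word
catenate zero    F = []
catenate (suc j) F = catenate j F ++ F j

bit→ℕ : Bool → ℕ
bit→ℕ false = 0
bit→ℕ true  = 1

bit≤1 : ∀ b → bit→ℕ b ≤ 1
bit≤1 false = z≤n
bit≤1 true  = ≤-refl

sumBelow : ℕ → (ℕ → ℕ) → ℕ
sumBelow zero    t = 0
sumBelow (suc j) t = t j + sumBelow j t

countBelow : ℕ → (ℕ → Bool) → ℕ
countBelow n P = sumBelow n (bit→ℕ ∘ P)

module _ {ρ : X → Vec Word n} where

  bitB : ∀ {w} {i : X → ℕ} → PT ρ w → PT ρ (unary ∘ i) → PT ρ (λ x → flag (bit (w x) (i x)))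
  bitB {w} {i} p q = ext (headB (dropℕ q p)) λ x → cong flag (bit-drop (i x) (w x))

  forEach : ∀ {e : X → ℕ} {F : X → ℕ → Word} → PT ρ (unary ∘ e) → PT (ρ ▹) (λ (x , j) → F x j) →
            PT ρ (λ x → catenate (e x) (F x))
  forEach {F = F} p q = loopℕ (λ x j → catenate j (F x)) p nil (app (var (Fin.suc Fin.zero)) (wkAcc q))
    (bd-additive (λ x j → length (catenate j (F x))) (λ x j → length (F x j))
      (λ x j → ≤-reflexive (trans (length-++ (catenate j (F x))) (+-comm _ (length (F x j)))))
      (bd-const 0) (bd-length q))

  count : ∀ {e : X → ℕ} {P : X → ℕ → Bool} → PT ρ (unary ∘ e) → PT (ρ ▹) (λ (x , j) → flag (P x j)) →
          PT ρ (λ x → unary (countBelow (e x) (P x)))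
  count {P = P} p q = loopℕ (λ x j → unary (countBelow j (P x))) p nil
    (plus {f = λ (x , j) → bit→ℕ (P x j)} (ext (wkAcc q) λ (x , j) → flag-unary (P x j)) (var (Fin.suc Fin.zero)))
    (bd-len-unary (bd-≤ bd-index λ (x , j) → count≤ (P x) j))
    where
    flag-unary : ∀ b → flag b ≡ unary (bit→ℕ b)
    flag-unary false = refl
    flag-unary true  = refl
    count≤ : ∀ P j → countBelow j P ≤ j
    count≤ P zero    = z≤n
    count≤ P (suc j) with P j
    ... | false = m≤n⇒m≤1+n (count≤ P j)
    ... | true  = s≤s (count≤ P j)

  zeros : ∀ {e : X → ℕ} → PT ρ (unary ∘ e) → PT ρ (λ x → replicate (e x) false)
  zeros p = loopℕ (λ x j → replicate j false) p nil (cons false (var (Fin.suc Fin.zero)))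
    (bd-≤ bd-index λ (x , j) → ≤-reflexive (length-replicate j))

  triangleℕ : ∀ {e : X → ℕ} → PT ρ (unary ∘ e) → PT ρ (λ x → unary (triangle (e x)))
  triangleℕ p = loopℕ (λ x j → unary (triangle j)) p nil
    (plus {f = λ (x , j) → triangle j} (var (Fin.suc Fin.zero)) (var Fin.zero))
    (bd-len-unary (bd-additive (λ x j → triangle j) (λ x j → j) (λ x j → ≤-reflexive (+-comm (triangle j) j)) (bd-const 0) bd-index))

-- Arithmetic in binary

value : Word → ℕ
value []      = 0
value (b ∷ w) = bit→ℕ b + 2 * value w

value-increment : ∀ w → value (increment w) ≡ suc (value w)
value-increment []          = refl
value-increment (false ∷ w) = refl
value-increment (true ∷ w)  = trans (cong (2 *_) (value-increment w)) (*-suc 2 (value w))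

value-binary : ∀ m → value (binary m) ≡ m
value-binary zero    = refl
value-binary (suc m) = trans (value-increment (binary m)) (cong suc (value-binary m))

binary-odd : ∀ m → binary (1 + 2 * m) ≡ true ∷ binary m
binary-odd zero    = refl
binary-odd (suc m) = begin
  binary (1 + 2 * suc m)                        ≡⟨ cong (binary ∘ suc) (*-suc 2 m) ⟩
  increment (increment (binary (1 + 2 * m)))    ≡⟨ cong (increment ∘ increment) (binary-odd m) ⟩
  true ∷ binary (suc m)                         ∎
  where open ≡-Reasoning

null-increment : ∀ w → List.null (increment w) ≡ false
null-increment []          = refl
null-increment (false ∷ w) = refl
null-increment (true ∷ w)  = refl

binary-even : ∀ m → (if List.null (binary m) then [] else false ∷ binary m) ≡ binary (2 * m)
binary-even zero    = refl
binary-even (suc m) rewrite null-increment (binary m) = begin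
  increment (true ∷ binary m)           ≡⟨ cong increment (binary-odd m) ⟨
  binary (2 + 2 * m)                    ≡⟨ cong binary (*-suc 2 m) ⟨
  binary (2 * suc m)                    ∎
  where open ≡-Reasoning

length-binary-value : ∀ w → length (binary (value w)) ≤ length w
length-binary-value []          = z≤n
length-binary-value (true ∷ w)  rewrite binary-odd (value w) = s≤s (length-binary-value w)
length-binary-value (false ∷ w) rewrite sym (binary-even (value w)) with List.null (binary (value w))
... | true  = z≤n
... | false = s≤s (length-binary-value w)

value< : ∀ w → value w < 2 ^ length w
value< []      = s≤s z≤n
value< (b ∷ w) = begin
  suc (bit→ℕ b + 2 * value w)  ≤⟨ s≤s (+-monoˡ-≤ _ (bit≤1 b)) ⟩
  2 + 2 * value w              ≡⟨ *-suc 2 (value w) ⟨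
  2 * suc (value w)            ≤⟨ *-monoʳ-≤ 2 (value< w) ⟩
  2 ^ length (b ∷ w)           ∎
  where
  open ≤-Reasoning

value-++ : ∀ u v → value (u ++ v) ≡ value u + 2 ^ length u * value v
value-++ []      v = sym (+-identityʳ _)
value-++ (b ∷ u) v rewrite value-++ u v = solve 4
  (λ b u p v → b :+ con 2 :* (u :+ p :* v) := b :+ con 2 :* u :+ con 2 :* p :* v) refl
  (bit→ℕ b) (value u) (2 ^ length u) (value v)

-- Unlike `take`, this pads with zeros, so that the length is always `d`.
low : ℕ → Word → Word
low d w = catenate d λ i → bit w i ∷ []

length-letters : ∀ n (P : ℕ → Bool) → length (catenate n λ i → P i ∷ []) ≡ n
length-letters zero    P = refl
length-letters (suc n) P =
  trans (length-++ (catenate n _)) (trans (+-comm _ 1) (cong suc (length-letters n P)))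

catenate-suc : ∀ n F → catenate (suc n) F ≡ F 0 ++ catenate n (F ∘ suc)
catenate-suc zero    F = sym (++-identityʳ (F 0))
catenate-suc (suc n) F = trans (cong (_++ F (suc n)) (catenate-suc n F)) (++-assoc (F 0) _ _)

catenate-cong : ∀ n {F G} → (∀ i → F i ≡ G i) → catenate n F ≡ catenate n G
catenate-cong zero    eq = refl
catenate-cong (suc n) eq = cong₂ _++_ (catenate-cong n eq) (eq n)

value-low-[] : ∀ d → value (low d []) ≡ 0
value-low-[] zero    = refl
value-low-[] (suc d) rewrite catenate-suc d (λ i → bit [] i ∷ []) | value-low-[] d = refl

value-split : ∀ d w → value w ≡ value (low d w) + 2 ^ d * value (drop d w)
value-split zero    w       = sym (+-identityʳ _)
value-split (suc d) []      rewrite value-low-[] (suc d) = sym (*-zeroʳ (2 ^ suc d))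
value-split (suc d) (b ∷ w)
  rewrite catenate-suc d (λ i → bit (b ∷ w) i ∷ []) | value-split d w = solve 4
  (λ b l p r → b :+ con 2 :* (l :+ p :* r) := b :+ con 2 :* l :+ con 2 :* p :* r) refl
  (bit→ℕ b) (value (low d w)) (2 ^ d) (value (drop d w))

drop-all : ∀ d (w : Word) → length w ≤ d → drop d w ≡ []
drop-all zero    []      _       = refl
drop-all (suc d) []      _       = refl
drop-all (suc d) (b ∷ w) (s≤s h) = drop-all d w h

value-low : ∀ d w → length w ≤ d → value (low d w) ≡ value w
value-low d w h = sym (trans (value-split d w)
  (trans (cong (λ v → value (low d w) + 2 ^ d * value v) (drop-all d w h))
    (trans (cong (value (low d w) +_) (*-zeroʳ (2 ^ d))) (+-identityʳ _))))

value-low< : ∀ d w → value (low d w) < 2 ^ d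
value-low< d w = subst (λ l → value (low d w) < 2 ^ l) (length-letters d (bit w)) (value< (low d w))

remainder-unique : ∀ {m a a′} b b′ → a < m → a′ < m → a + m * b ≡ a′ + m * b′ → a ≡ a′
remainder-unique {suc m} {a} {a′} b b′ lt lt′ eq = begin
  a                          ≡⟨ m<n⇒m%n≡m lt ⟨
  a % suc m                  ≡⟨ [m+kn]%n≡m%n a b (suc m) ⟨
  (a + b * suc m) % suc m    ≡⟨ cong (λ c → (a + c) % suc m) (*-comm b (suc m)) ⟩
  (a + suc m * b) % suc m    ≡⟨ cong (_% suc m) eq ⟩
  (a′ + suc m * b′) % suc m  ≡⟨ cong (λ c → (a′ + c) % suc m) (*-comm b′ (suc m)) ⟨
  (a′ + b′ * suc m) % suc m  ≡⟨ [m+kn]%n≡m%n a′ b′ (suc m) ⟩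
  a′ % suc m                 ≡⟨ m<n⇒m%n≡m lt′ ⟩
  a′                         ∎
  where open ≡-Reasoning

quotient-unique : ∀ {m a a′} b b′ → a < m → a′ < m → a + m * b ≡ a′ + m * b′ → b ≡ b′
quotient-unique {suc m} {a} b b′ lt lt′ eq with refl ← remainder-unique b b′ lt lt′ eq =
  *-cancelˡ-≡ b b′ (suc m) (+-cancelˡ-≡ a _ _ eq)

-- The number (s div 2^o) mod 2^d, read off from the bits of `s`.
digits : ℕ → ℕ → ℕ → ℕ
digits o d s = value (catenate d λ i → bit (binary s) (o + i) ∷ [])

bit-drop-+ : ∀ o w i → bit w (o + i) ≡ bit (drop o w) i
bit-drop-+ zero    w       i = refl
bit-drop-+ (suc o) []      i = refl
bit-drop-+ (suc o) (b ∷ w) i = bit-drop-+ o w i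

digits-unique : ∀ o d {a x} r → a < 2 ^ o → x < 2 ^ d → digits o d (a + 2 ^ o * (x + 2 ^ d * r)) ≡ x
digits-unique o d {a} {x} r a< x< = trans
  (cong value (catenate-cong d λ i → cong (_∷ []) (bit-drop-+ o w i)))
  (remainder-unique (value (drop d w′)) r (value-low< d w′) x< (trans (sym (value-split d w′))
    (quotient-unique (value w′) (x + 2 ^ d * r) (value-low< o w) a<
      (trans (sym (value-split o w)) (value-binary _)))))
  where
  w w′ : Word
  w  = binary (a + 2 ^ o * (x + 2 ^ d * r))
  w′ = drop o w

-- The `L` lowest bits already have the value `m`, and the binary form of the value of a word is
-- never longer than the word.
length-binary : ∀ L m → m < 2 ^ L → length (binary m) ≤ L
length-binary L m lt = subst₂ _≤_ (cong (length ∘ binary) eq) (length-letters L (bit w)) (length-binary-value (low L w))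
  where
  w : Word
  w = binary m
  eq : value (low L w) ≡ m
  eq = remainder-unique (value (drop L w)) 0 (value-low< L w) lt
    (trans (sym (value-split L w)) (trans (value-binary m) (sym (trans (cong (m +_) (*-zeroʳ (2 ^ L))) (+-identityʳ m)))))

<2^length-binary : ∀ m → m < 2 ^ length (binary m)
<2^length-binary m = subst (_< 2 ^ length (binary m)) (value-binary m) (value< (binary m))

majority : Bool → Bool → Bool → Bool
majority a b c = (a ∧ b) ∨ (c ∧ (a xor b))

-- A fold consumes one word only, so addition does not run through both summands in parallel;
-- carries and sum bits are computed from their position instead.
carry : Word → Word → ℕ → Bool
carry u v zero    = false
carry u v (suc j) = majority (bit u j) (bit v j) (carry u v j)

sumBit : Word → Word → ℕ → Bool
sumBit u v j = (bit u j xor bit v j) xor carry u v j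

full-adder : ∀ a b c → bit→ℕ ((a xor b) xor c) + 2 * bit→ℕ (majority a b c) ≡ bit→ℕ a + bit→ℕ b + bit→ℕ c
full-adder false false false = refl
full-adder false false true  = refl
full-adder false true  false = refl
full-adder false true  true  = refl
full-adder true  false false = refl
full-adder true  false true  = refl
full-adder true  true  false = refl
full-adder true  true  true  = refl

value-letters-suc : ∀ n (P : ℕ → Bool) →
  value (catenate (suc n) λ i → P i ∷ []) ≡ value (catenate n λ i → P i ∷ []) + 2 ^ n * bit→ℕ (P n)
value-letters-suc n P = trans (value-++ (catenate n _) (P n ∷ []))
  (cong₂ (λ l b → value (catenate n _) + 2 ^ l * b) (length-letters n P) (+-identityʳ _))

ripple : ∀ u v n → value (catenate n λ j → sumBit u v j ∷ []) + 2 ^ n * bit→ℕ (carry u v n) ≡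
                   value (low n u) + value (low n v)
ripple u v zero    = refl
ripple u v (suc n)
  rewrite value-letters-suc n (sumBit u v) | value-letters-suc n (bit u) | value-letters-suc n (bit v) = begin
  (S + p * s) + 2 * p * c′         ≡⟨ solve 4 (λ S p s c → (S :+ p :* s) :+ con 2 :* p :* c := S :+ p :* (s :+ con 2 :* c))
                                        refl S p s c′ ⟩
  S + p * (s + 2 * c′)             ≡⟨ cong (λ x → S + p * x) (full-adder (bit u n) (bit v n) (carry u v n)) ⟩
  S + p * (a + b + c)              ≡⟨ solve 5 (λ S p a b c → S :+ p :* (a :+ b :+ c) := (S :+ p :* c) :+ (p :* a :+ p :* b))
                                        refl S p a b c ⟩
  (S + p * c) + (p * a + p * b)    ≡⟨ cong (_+ (p * a + p * b)) (ripple u v n) ⟩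
  (U + V) + (p * a + p * b)        ≡⟨ solve 4 (λ U V x y → (U :+ V) :+ (x :+ y) := (U :+ x) :+ (V :+ y)) refl U V (p * a) (p * b) ⟩
  (U + p * a) + (V + p * b)        ∎
  where
  open ≡-Reasoning
  S = value (catenate n λ j → sumBit u v j ∷ [])
  U = value (low n u)
  V = value (low n v)
  p = 2 ^ n
  s = bit→ℕ (sumBit u v n)
  c = bit→ℕ (carry u v n)
  c′ = bit→ℕ (carry u v (suc n))
  a = bit→ℕ (bit u n)
  b = bit→ℕ (bit v n)

+-<2^ : ∀ {a b} m n → a < 2 ^ m → b < 2 ^ n → a + b < 2 ^ suc (m + n)
+-<2^ {a} {b} m n a< b< = begin-strict
  a + b                    <⟨ +-mono-< (<-≤-trans a< (^-monoʳ-≤ 2 (m≤m+n m n))) (<-≤-trans b< (^-monoʳ-≤ 2 (m≤n+m n m))) ⟩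
  2 ^ (m + n) + 2 ^ (m + n) ≡⟨ cong (2 ^ (m + n) +_) (+-identityʳ _) ⟨
  2 ^ suc (m + n)          ∎
  where open ≤-Reasoning

-- By `ripple` both sides agree modulo 2^L, and both are below 2^L; the final carry need not be
-- examined.
value-sum : ∀ u v → value (catenate (suc (length u + length v)) λ j → sumBit u v j ∷ []) ≡ value u + value v
value-sum u v = remainder-unique {2 ^ L} (bit→ℕ (carry u v L)) 0
  (subst (λ l → value w < 2 ^ l) (length-letters L (sumBit u v)) (value< w))
  (+-<2^ (length u) (length v) (value< u) (value< v))
  (trans (ripple u v L) (trans (cong₂ _+_ (value-low L u (m≤n⇒m≤1+n (m≤m+n _ _))) (value-low L v (m≤n⇒m≤1+n (m≤n+m _ _))))
    (sym (trans (cong (value u + value v +_) (*-zeroʳ (2 ^ L))) (+-identityʳ _)))))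
  where
  L : ℕ
  L = suc (length u + length v)
  w : Word
  w = catenate L λ j → sumBit u v j ∷ []

module _ {ρ : X → Vec Word n} where

  trim : ∀ {f} → PT ρ f → PT ρ (λ x → binary (value (f x)))
  trim p = fold (λ x w → binary (value w)) p nil
    (λ { false → ext (ifNull (var (Fin.suc Fin.zero)) nil (cons false (var (Fin.suc Fin.zero))))
                   λ (_ , w , _) → binary-even (value w)
       ; true  → ext (cons true (var (Fin.suc Fin.zero))) λ (_ , w , _) → sym (binary-odd (value w)) })
    (bd-≤ bd-size λ (x , w) → ≤-trans (length-binary-value w) (m≤m+n _ _))

  carryB : ∀ {f g} {e : X → ℕ} → PT ρ f → PT ρ g → PT ρ (unary ∘ e) → PT ρ (λ x → flag (carry (f x) (g x) (e x)))
  carryB {f} {g} p q r = loopℕ (λ x j → flag (carry (f x) (g x) j)) r nil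
    (let a = bitB {w = f ∘ proj₁} {i = proj₂} (wk₂ proj₁ p) (var Fin.zero)
         b = bitB {w = g ∘ proj₁} {i = proj₂} (wk₂ proj₁ q) (var Fin.zero)
     in orB (andB a b) (andB {p = λ (x , j) → carry (f x) (g x) j} (var (Fin.suc Fin.zero)) (xorB a b)))
    (bd-≤ (bd-const 1) λ (x , j) → flag≤1 (carry (f x) (g x) j))
    where
    flag≤1 : ∀ b → length (flag b) ≤ 1
    flag≤1 false = z≤n
    flag≤1 true  = ≤-refl

  digitsB : ∀ {o d s : X → ℕ} → PT ρ (unary ∘ o) → PT ρ (unary ∘ d) → PT ρ (binary ∘ s) →
            PT ρ (λ x → binary (digits (o x) (d x) (s x)))
  digitsB {o} {d} {s} po pd ps =
    trim (forEach {F = λ x i → bit (binary (s x)) (o x + i) ∷ []} pd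
      (letter (bitB (wk ps) (plus {f = o ∘ proj₁} {g = proj₂} (wk po) (var Fin.zero)))))

  shiftB : ∀ {d f : X → ℕ} → PT ρ (unary ∘ d) → PT ρ (binary ∘ f) → PT ρ (λ x → binary (2 ^ d x * f x))
  shiftB {d} {f} p q = ext (trim (app (zeros p) q)) λ x → cong binary (lemma (d x) (f x))
    where
    lemma : ∀ d m → value (replicate d false ++ binary m) ≡ 2 ^ d * m
    lemma zero    m = trans (value-binary m) (sym (+-identityʳ m))
    lemma (suc d) m = trans (cong (2 *_) (lemma d m)) (sym (*-assoc 2 (2 ^ d) m))

module _ {ρ : X → Vec Word n} where

  plusB : ∀ {f g : X → ℕ} → PT ρ (binary ∘ f) → PT ρ (binary ∘ g) → PT ρ (λ x → binary (f x + g x))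
  plusB {f} {g} p q = ext
    (trim (forEach {F = λ x j → sumBit (binary (f x)) (binary (g x)) j ∷ []} (cons true (plus (lengthℕ p) (lengthℕ q)))
      (letter (xorB (xorB (bitB {i = proj₂} (wk p) (var Fin.zero)) (bitB {i = proj₂} (wk q) (var Fin.zero)))
                    (carryB {e = proj₂} (wk p) (wk q) (var Fin.zero))))))
    λ x → cong binary (trans (value-sum (binary (f x)) (binary (g x))) (cong₂ _+_ (value-binary (f x)) (value-binary (g x))))

module _ {ρ : X → Vec Word n} where

  sumB : ∀ {e : X → ℕ} {t : X → ℕ → ℕ} → PT ρ (unary ∘ e) → PT (ρ ▹) (λ (x , j) → binary (t x j)) →
         PT ρ (λ x → binary (sumBelow (e x) (t x)))
  sumB {t = t} p q = loopℕ (λ x j → binary (sumBelow j (t x))) p nil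
    (plusB {f = λ (x , j) → t x j} {g = λ (x , j) → sumBelow j (t x)} (wkAcc q) (var (Fin.suc Fin.zero)))
    (bd-additive (λ x j → length (binary (sumBelow j (t x)))) (λ x j → suc (length (binary (t x j))))
      (λ x j → length-binary _ _ (+-<2^ (length (binary (t x j))) _ (<2^length-binary (t x j)) (<2^length-binary (sumBelow j (t x)))))
      (bd-const 0) (bd-+ (bd-const 1) (bd-length q)))

  -- Multiplication by 1 + 2^d is a shift followed by an addition and makes the number longer by at
  -- most d + 1 bits, so the `i`-fold repetition stays within polynomial length.
  dilate : ∀ {d i f : X → ℕ} → PT ρ (unary ∘ d) → PT ρ (unary ∘ i) → PT ρ (binary ∘ f) →
           PT ρ (λ x → binary ((1 + 2 ^ d x) ^ i x * f x))
  dilate {d} {i} {f} pd pi pf = loopℕ (λ x j → binary (a x j)) pi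
    (ext pf λ x → cong binary (sym (+-identityʳ (f x))))
    (ext (plusB {f = λ (x , j) → a x j} (var (Fin.suc Fin.zero)) (shiftB {f = λ (x , j) → a x j} (wk₂ proj₁ pd) (var (Fin.suc Fin.zero))))
      λ (x , j) → cong binary (expand x j))
    (bd-additive (λ x j → length (binary (a x j))) (λ x j → suc (d x)) small
      (bd-≤ (bd-length pf) λ x → ≤-reflexive (cong (length ∘ binary) (+-identityʳ (f x))))
      (bd-+ (bd-const 1) (bd-wk (bd-unary pd))))
    where
    a : X → ℕ → ℕ
    a x j = (1 + 2 ^ d x) ^ j * f x
    expand : ∀ x j → a x j + 2 ^ d x * a x j ≡ a x (suc j)
    expand x j = sym (*-assoc (1 + 2 ^ d x) ((1 + 2 ^ d x) ^ j) (f x))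
    small : ∀ x j → length (binary (a x (suc j))) ≤ suc (d x) + length (binary (a x j))
    small x j = length-binary _ (a x (suc j)) (begin-strict
      a x (suc j)              ≡⟨ expand x j ⟨
      a x j + 2 ^ d x * a x j  ≤⟨ +-monoˡ-≤ _ (m≤n*m (a x j) (2 ^ d x) ⦃ m^n≢0 2 (d x) ⦄) ⟩
      2 ^ d x * a x j + 2 ^ d x * a x j ≡⟨ cong (2 ^ d x * a x j +_) (+-identityʳ _) ⟨
      2 * (2 ^ d x * a x j)    ≡⟨ *-assoc 2 (2 ^ d x) (a x j) ⟨
      2 ^ suc (d x) * a x j    <⟨ *-monoʳ-< (2 ^ suc (d x)) ⦃ m^n≢0 2 (suc (d x)) ⦄ (<2^length-binary (a x j)) ⟩
      2 ^ suc (d x) * 2 ^ length (binary (a x j)) ≡⟨ ^-distribˡ-+-* 2 (suc (d x)) _ ⟨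
      2 ^ (suc (d x) + length (binary (a x j))) ∎)
      where open ≤-Reasoning

-- Sums over subsets

sumBelow-cong : ∀ n {s t} → (∀ i → i < n → s i ≡ t i) → sumBelow n s ≡ sumBelow n t
sumBelow-cong zero    eq = refl
sumBelow-cong (suc n) eq = cong₂ _+_ (eq n ≤-refl) (sumBelow-cong n λ i lt → eq i (m≤n⇒m≤1+n lt))

sumBelow-≤ : ∀ n {s t} → (∀ i → i < n → s i ≤ t i) → sumBelow n s ≤ sumBelow n t
sumBelow-≤ zero    le = z≤n
sumBelow-≤ (suc n) le = +-mono-≤ (le n ≤-refl) (sumBelow-≤ n λ i lt → le i (m≤n⇒m≤1+n lt))

interchange : ∀ a b c d → (a + b) + (c + d) ≡ (a + c) + (b + d)
interchange = solve 4 (λ a b c d → (a :+ b) :+ (c :+ d) := (a :+ c) :+ (b :+ d)) refl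

sumBelow-+ : ∀ n s t → sumBelow n (λ i → s i + t i) ≡ sumBelow n s + sumBelow n t
sumBelow-+ zero    s t = refl
sumBelow-+ (suc n) s t rewrite sumBelow-+ n s t = interchange (s n) (t n) _ _

sumBelow-* : ∀ n a t → sumBelow n (λ i → t i * a) ≡ sumBelow n t * a
sumBelow-* zero    a t = refl
sumBelow-* (suc n) a t rewrite sumBelow-* n a t = sym (*-distribʳ-+ a (t n) (sumBelow n t))

sumBelow-0 : ∀ n → sumBelow n (λ _ → 0) ≡ 0
sumBelow-0 zero    = refl
sumBelow-0 (suc n) = sumBelow-0 n

sumBelow-swap : ∀ m n (t : ℕ → ℕ → ℕ) →
                sumBelow m (λ i → sumBelow n (t i)) ≡ sumBelow n (λ j → sumBelow m (λ i → t i j))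
sumBelow-swap zero    n t = sym (sumBelow-0 n)
sumBelow-swap (suc m) n t rewrite sumBelow-swap m n t = sym (sumBelow-+ n (t m) _)

sumBelow-split : ∀ m n t → sumBelow (m + n) t ≡ sumBelow m t + sumBelow n (λ i → t (m + i))
sumBelow-split m zero    t rewrite +-identityʳ m = sym (+-identityʳ _)
sumBelow-split m (suc n) t rewrite +-suc m n | sumBelow-split m n t =
  solve 3 (λ a b c → c :+ (a :+ b) := a :+ (c :+ b)) refl (sumBelow m t) _ (t (m + n))

-- A subset of {0, ..., n - 1} is a word of length n; the last letter is split off
-- first because vertices are added to a lower triangle at the end.
sumSubsets : ℕ → (Word → ℕ) → ℕ
sumSubsets zero    f = f []
sumSubsets (suc n) f = sumSubsets n λ S → f (S ++ false ∷ []) + f (S ++ true ∷ [])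

length-snoc : ∀ (S : Word) b {n} → length S ≡ n → length (S ++ b ∷ []) ≡ suc n
length-snoc S b refl = trans (length-++ S) (+-comm _ 1)

sumSubsets-cong : ∀ n {f g} → (∀ S → length S ≡ n → f S ≡ g S) → sumSubsets n f ≡ sumSubsets n g
sumSubsets-cong zero    eq = eq [] refl
sumSubsets-cong (suc n) eq = sumSubsets-cong n λ S len →
  cong₂ _+_ (eq _ (length-snoc S false len)) (eq _ (length-snoc S true len))

-- Links sums that split off the last vertex with the enumeration `subsets`, which splits off the
-- first.
sumSubsets-cons : ∀ n f → sumSubsets (suc n) f ≡ sumSubsets n (f ∘ (false ∷_)) + sumSubsets n (f ∘ (true ∷_))
sumSubsets-cons zero    f = refl
sumSubsets-cons (suc n) f = sumSubsets-cons n λ S → f (S ++ false ∷ []) + f (S ++ true ∷ [])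

sumSubsets-+ : ∀ n f g → sumSubsets n (λ S → f S + g S) ≡ sumSubsets n f + sumSubsets n g
sumSubsets-+ zero    f g = refl
sumSubsets-+ (suc n) f g = trans (sumSubsets-cong n λ S _ → interchange (f (S ++ false ∷ [])) (g (S ++ false ∷ [])) _ _) (sumSubsets-+ n _ _)

sumSubsets-* : ∀ n a f → sumSubsets n (λ S → a * f S) ≡ a * sumSubsets n f
sumSubsets-* zero    a f = refl
sumSubsets-* (suc n) a f = trans (sumSubsets-cong n λ S _ → sym (*-distribˡ-+ a _ _)) (sumSubsets-* n a _)

sumSubsets-0 : ∀ n → sumSubsets n (λ _ → 0) ≡ 0
sumSubsets-0 zero    = refl
sumSubsets-0 (suc n) = sumSubsets-0 n

sumSubsets-sumBelow : ∀ n r (f : ℕ → Word → ℕ) →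
  sumBelow r (λ j → sumSubsets n (f j)) ≡ sumSubsets n (λ S → sumBelow r (λ j → f j S))
sumSubsets-sumBelow n zero    f = sym (sumSubsets-0 n)
sumSubsets-sumBelow n (suc r) f rewrite sumSubsets-sumBelow n r f = sym (sumSubsets-+ n (f r) _)

sumSubsets-≤ : ∀ n f → (∀ S → f S ≤ 1) → sumSubsets n f ≤ 2 ^ n
sumSubsets-≤ n f le = ≤-trans (go n f 1 le) (≤-reflexive (*-identityʳ (2 ^ n)))
  where
  -- Splitting off a letter doubles the bound on the summand, so the bound must vary.
  go : ∀ n f a → (∀ S → f S ≤ a) → sumSubsets n f ≤ 2 ^ n * a
  go zero    f a le = ≤-trans (le []) (m≤m+n a 0)
  go (suc n) f a le = ≤-trans (go n _ (2 * a) λ S → +-mono-≤ (le _) (≤-trans (le _) (m≤m+n a 0)))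
    (≤-reflexive (solve 2 (λ p a → p :* (con 2 :* a) := con 2 :* p :* a) refl (2 ^ n) a))

weight : Word → ℕ
weight []      = 0
weight (b ∷ S) = bit→ℕ b + weight S

weight-snoc : ∀ S b → weight (S ++ b ∷ []) ≡ bit→ℕ b + weight S
weight-snoc []      b = refl
weight-snoc (c ∷ S) b rewrite weight-snoc S b = solve 3 (λ a b c → a :+ (b :+ c) := b :+ (a :+ c)) refl
  (bit→ℕ c) (bit→ℕ b) (weight S)

weight≤length : ∀ S → weight S ≤ length S
weight≤length []          = z≤n
weight≤length (false ∷ S) = m≤n⇒m≤1+n (weight≤length S)
weight≤length (true ∷ S)  = s≤s (weight≤length S)

sumBelow-suc : ∀ n t → sumBelow (suc n) t ≡ t 0 + sumBelow n (t ∘ suc)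
sumBelow-suc n t = trans (sumBelow-split 1 n t) (cong (_+ sumBelow n (t ∘ suc)) (+-identityʳ (t 0)))

weight-countBelow : ∀ S → weight S ≡ countBelow (length S) (bit S)
weight-countBelow []      = refl
weight-countBelow (b ∷ S) = trans (cong (bit→ℕ b +_) (weight-countBelow S)) (sym (sumBelow-suc (length S) _))

-- The r lowest digits of s in base 2^d, read in base 2^D (in particular, their
-- sum if D = 0).
respace : (d D r s : ℕ) → ℕ
respace d D r s = sumBelow r λ j → 2 ^ (D * j) * digits (d * j) d s

module _ (d : ℕ) (x : ℕ → ℕ) (x< : ∀ i → x i < 2 ^ d) where

  series : ℕ → ℕ
  series m = sumBelow m λ i → 2 ^ (d * i) * x i

  series< : ∀ m → series m < 2 ^ (d * m)
  series< zero    rewrite *-zeroʳ d = s≤s z≤n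
  series< (suc m) = begin-strict
    2 ^ (d * m) * x m + series m          <⟨ +-monoʳ-< (2 ^ (d * m) * x m) (series< m) ⟩
    2 ^ (d * m) * x m + 2 ^ (d * m)       ≡⟨ +-comm _ (2 ^ (d * m)) ⟩
    2 ^ (d * m) + 2 ^ (d * m) * x m       ≡⟨ *-suc (2 ^ (d * m)) (x m) ⟨
    2 ^ (d * m) * suc (x m)               ≤⟨ *-monoʳ-≤ (2 ^ (d * m)) (x< m) ⟩
    2 ^ (d * m) * 2 ^ d                   ≡⟨ ^-distribˡ-+-* 2 (d * m) d ⟨
    2 ^ (d * m + d)                       ≡⟨ cong (2 ^_) (trans (+-comm (d * m) d) (sym (*-suc d m))) ⟩
    2 ^ (d * suc m)                       ∎
    where open ≤-Reasoning

  -- Brings the expansion into the form that `digits-unique` expects at digit `j`, with the higher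
  -- digits collected in `R`.
  series-from : ∀ j r → ∃ λ R → series (j + suc r) ≡ series j + 2 ^ (d * j) * (x j + 2 ^ d * R)
  series-from j zero    = 0 , (begin
    series (j + 1)                               ≡⟨ cong series (+-comm j 1) ⟩
    2 ^ (d * j) * x j + series j                 ≡⟨ solve 4 (λ p x s q → p :* x :+ s := s :+ p :* (x :+ q :* con 0))
                                                      refl (2 ^ (d * j)) (x j) (series j) (2 ^ d) ⟩
    series j + 2 ^ (d * j) * (x j + 2 ^ d * 0)   ∎)
    where open ≡-Reasoning
  series-from j (suc r) with series-from j r
  ... | R , eq = R + 2 ^ (d * r) * x (j + suc r) , (begin
    series (j + suc (suc r))                                     ≡⟨ cong series (+-suc j (suc r)) ⟩
    2 ^ (d * (j + suc r)) * y + series (j + suc r)               ≡⟨ cong₂ (λ a b → a * y + b) power eq ⟩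
    P * (2 ^ d * Q) * y + (series j + P * (x j + 2 ^ d * R))     ≡⟨ solve 7 (λ p q r y s x t →
                                                                      p :* (q :* r) :* y :+ (s :+ p :* (x :+ q :* t)) :=
                                                                      s :+ p :* (x :+ q :* (t :+ r :* y))) refl
                                                                      P (2 ^ d) Q y (series j) (x j) R ⟩
    series j + P * (x j + 2 ^ d * (R + Q * y))                   ∎)
    where
    open ≡-Reasoning
    P = 2 ^ (d * j)
    Q = 2 ^ (d * r)
    y = x (j + suc r)
    power : 2 ^ (d * (j + suc r)) ≡ P * (2 ^ d * Q)
    power = begin
      2 ^ (d * (j + suc r))       ≡⟨ cong (2 ^_) (trans (*-distribˡ-+ d j (suc r)) (cong (d * j +_) (*-suc d r))) ⟩
      2 ^ (d * j + (d + d * r))   ≡⟨ ^-distribˡ-+-* 2 (d * j) _ ⟩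
      P * 2 ^ (d + d * r)         ≡⟨ cong (P *_) (^-distribˡ-+-* 2 d (d * r)) ⟩
      P * (2 ^ d * Q)             ∎

  digits-series : ∀ j r → digits (d * j) d (series (j + suc r)) ≡ x j
  digits-series j r with series-from j r
  ... | R , eq = trans (cong (digits (d * j) d) eq) (digits-unique (d * j) d R (series< j) (x< j))

sumBelow-δ : ∀ r w (a : ℕ → ℕ) → sumBelow r (λ j → a j * bit→ℕ (w ≡ᵇ j)) ≡ (if w <ᵇ r then a w else 0)
sumBelow-δ zero    w a = refl
sumBelow-δ (suc r) zero a = trans (sumBelow-suc r _) (trans (cong (a 0 * 1 +_)
  (trans (sumBelow-cong r λ i _ → *-zeroʳ (a (suc i))) (sumBelow-0 r))) (trans (+-identityʳ _) (*-identityʳ _)))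
sumBelow-δ (suc r) (suc w) a = trans (sumBelow-suc r _) (trans (cong (_+ sumBelow r (λ j → a (suc j) * bit→ℕ (w ≡ᵇ j))) (*-zeroʳ (a 0))) (sumBelow-δ r w (a ∘ suc)))

if-< : ∀ {w r} {a b : ℕ} → w < r → (if w <ᵇ r then a else b) ≡ a
if-< {w} {r} lt with w <ᵇ r | <⇒<ᵇ lt
... | true | _ = refl

module _ (n : ℕ) (f : Word → ℕ) where

  -- Once the two sums are exchanged, each `S` meets only the index `j = weight S`, and only if this
  -- is below `r`.
  sizeSeries : (a : ℕ → ℕ) (r : ℕ) →
    sumBelow r (λ j → a j * sumSubsets n (λ S → f S * bit→ℕ (weight S ≡ᵇ j))) ≡
    sumSubsets n (λ S → f S * (if weight S <ᵇ r then a (weight S) else 0))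
  sizeSeries a r = begin
    sumBelow r (λ j → a j * sumSubsets n (λ S → f S * bit→ℕ (weight S ≡ᵇ j)))
      ≡⟨ sumBelow-cong r (λ j _ → sumSubsets-* n (a j) _) ⟨
    sumBelow r (λ j → sumSubsets n (λ S → a j * (f S * bit→ℕ (weight S ≡ᵇ j))))
      ≡⟨ sumSubsets-sumBelow n r _ ⟩
    sumSubsets n (λ S → sumBelow r (λ j → a j * (f S * bit→ℕ (weight S ≡ᵇ j))))
      ≡⟨ sumSubsets-cong n (λ S _ → trans (sumBelow-cong r λ j _ → solve 3 (λ a f b → a :* (f :* b) := a :* b :* f) refl
           (a j) (f S) (bit→ℕ (weight S ≡ᵇ j))) (trans (sumBelow-* r (f S) _) (trans (*-comm _ (f S)) (cong (f S *_) (sumBelow-δ r (weight S) a))))) ⟩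
    sumSubsets n (λ S → f S * (if weight S <ᵇ r then a (weight S) else 0)) ∎
    where open ≡-Reasoning

  -- The number of subsets of each size is less than 2 ^ d, so it is a digit.
  respace-sizes : (∀ S → f S ≤ 1) → ∀ d D r → n < d →
    respace d D r (sumSubsets n (λ S → f S * 2 ^ (d * weight S))) ≡
    sumSubsets n (λ S → f S * (if weight S <ᵇ r then 2 ^ (D * weight S) else 0))
  respace-sizes f≤1 d D r n<d =
    trans (sumBelow-cong r λ j _ → cong (2 ^ (D * j) *_) (trans (cong (digits (d * j) d) (asSeries j)) (digits-series d x x< j n)))
      (sizeSeries (λ j → 2 ^ (D * j)) r)
    where
    x : ℕ → ℕ
    x j = sumSubsets n (λ S → f S * bit→ℕ (weight S ≡ᵇ j))
    x< : ∀ j → x j < 2 ^ d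
    x< j = ≤-<-trans (sumSubsets-≤ n _ λ S → *-mono-≤ (f≤1 S) (bit≤1 (weight S ≡ᵇ j))) (^-monoʳ-< 2 (s≤s (s≤s z≤n)) n<d)
    -- The digit `j` may lie beyond the size `n`, so the expansion is continued with digits that
    -- vanish until it contains digit `j`.
    asSeries : ∀ j → sumSubsets n (λ S → f S * 2 ^ (d * weight S)) ≡ series d x x< (j + suc n)
    asSeries j = sym (trans (sizeSeries (λ i → 2 ^ (d * i)) (j + suc n)) (sumSubsets-cong n λ S len →
      cong (f S *_) (if-< (≤-trans (s≤s (subst (weight S ≤_) len (weight≤length S))) (m≤n+m (suc n) j)))))

-- Vertex covers

allBelow : ℕ → (ℕ → Bool) → Bool
allBelow zero    P = true
allBelow (suc n) P = allBelow n P ∧ P n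

allBelow-cong : ∀ n {P Q} → (∀ i → i < n → P i ≡ Q i) → allBelow n P ≡ allBelow n Q
allBelow-cong zero    eq = refl
allBelow-cong (suc n) eq = cong₂ _∧_ (allBelow-cong n λ i lt → eq i (m≤n⇒m≤1+n lt)) (eq n ≤-refl)

allBelow-elim : ∀ n {P} → T (allBelow n P) → ∀ i → i < n → T (P i)
allBelow-elim (suc n) {P} h i (s≤s le) with allBelow n P in eq | P n in eq′
... | true | true with m≤n⇒m<n∨m≡n le
...   | inj₁ lt   = allBelow-elim n (subst T (sym eq) tt) i lt
...   | inj₂ refl = subst T (sym eq′) tt

allBelow-intro : ∀ n {P} → (∀ i → i < n → T (P i)) → T (allBelow n P)
allBelow-intro zero    h = tt
allBelow-intro (suc n) {P} h with allBelow n P | allBelow-intro n {P} (λ i lt → h i (m≤n⇒m≤1+n lt)) | P n | h n ≤-refl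
... | true | _ | true | _ = tt

T-iff : ∀ {a b} → (T a → T b) → (T b → T a) → a ≡ b
T-iff {false} {false} f g = refl
T-iff {false} {true}  f g = ⊥-elim (g tt)
T-iff {true}  {false} f g = ⊥-elim (f tt)
T-iff {true}  {true}  f g = refl

bit-++ˡ : ∀ u v {i} → i < length u → bit (u ++ v) i ≡ bit u i
bit-++ˡ (b ∷ u) v {zero}  _        = refl
bit-++ˡ (b ∷ u) v {suc i} (s≤s lt) = bit-++ˡ u v lt

bit-++ʳ : ∀ u v {i} → bit (u ++ v) (length u + i) ≡ bit v i
bit-++ʳ []      v = refl
bit-++ʳ (b ∷ u) v = bit-++ʳ u v

bit-last : ∀ u {b n} → length u ≡ n → bit (u ++ b ∷ []) n ≡ b
bit-last u {b} refl = trans (cong (bit (u ++ b ∷ [])) (sym (+-identityʳ _))) (bit-++ʳ u (b ∷ []))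

bit-init : ∀ u {b n i} → length u ≡ n → i < n → bit (u ++ b ∷ []) i ≡ bit u i
bit-init u {b} refl lt = bit-++ˡ u (b ∷ []) lt

coversRow : ℕ → (ℕ → Bool) → Word → Bool
coversRow u A S = allBelow u λ v → not (A v) ∨ (bit S u ∨ bit S v)

covers : ℕ → (ℕ → ℕ → Bool) → Word → Bool
covers n A S = allBelow n λ u → coversRow u (A u) S

covers-cong : ∀ n {A B} S → (∀ u v → u < n → v < u → A u v ≡ B u v) → covers n A S ≡ covers n B S
covers-cong n S eq = allBelow-cong n λ u u<n → allBelow-cong u λ v v<u →
  cong (λ a → not a ∨ (bit S u ∨ bit S v)) (eq u v u<n v<u)

covers-snoc : ∀ n A S {b} → length S ≡ n → covers n A (S ++ b ∷ []) ≡ covers n A S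
covers-snoc n A S len = allBelow-cong n λ u u<n → allBelow-cong u λ v v<u →
  cong₂ (λ s t → not (A u v) ∨ (s ∨ t)) (bit-init S len u<n) (bit-init S len (<-trans v<u u<n))

lowerEntry : Word → ℕ → ℕ → Bool
lowerEntry w u v = bit w (triangle u + v)

triangle-mono : ∀ {m n} → m ≤ n → triangle m ≤ triangle n
triangle-mono z≤n     = z≤n
triangle-mono (s≤s h) = +-mono-≤ (triangle-mono h) h

lowerEntry< : ∀ {n u v} → u < n → v < u → triangle u + v < triangle n
lowerEntry< {u = u} u<n v<u = <-≤-trans (+-monoʳ-< (triangle u) v<u) (triangle-mono u<n)

covers-addRow : ∀ n w r S → length w ≡ triangle n →
  covers (suc n) (lowerEntry (w ++ r)) S ≡ (covers n (lowerEntry w) S ∧ coversRow n (bit r) S)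
covers-addRow n w r S len = cong₂ _∧_
  (covers-cong n S λ u v u<n v<u → bit-++ˡ w r (subst (_ <_) (sym len) (lowerEntry< u<n v<u)))
  (allBelow-cong n λ v _ → cong (λ b → not b ∨ (bit S n ∨ bit S v))
    (trans (cong (λ l → bit (w ++ r) (l + v)) (sym len)) (bit-++ʳ w r)))

-- The row that a new vertex `n` with the single neighbour `a` adds to the triangle.
unit : ℕ → ℕ → Word
unit n a = replicate a false ++ true ∷ replicate (n ∸ suc a) false

length-unit : ∀ n a → a < n → length (unit n a) ≡ n
length-unit n a a<n = trans (length-++ (replicate a false)) (trans
  (cong₂ (λ x y → x + suc y) (length-replicate a) (length-replicate (n ∸ suc a)))
  (trans (+-suc a _) (m+[n∸m]≡n a<n)))

bit-zeros : ∀ n i → bit (replicate n false) i ≡ false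
bit-zeros zero    i       = refl
bit-zeros (suc n) zero    = refl
bit-zeros (suc n) (suc i) = bit-zeros n i

bit-unit : ∀ n a i → bit (unit n a) i ≡ (i ≡ᵇ a)
bit-unit n zero    zero    = refl
bit-unit n zero    (suc i) = bit-zeros (n ∸ 1) i
bit-unit n (suc a) zero    = refl
bit-unit n (suc a) (suc i) = bit-unit′ a (n ∸ suc (suc a)) i
  where
  bit-unit′ : ∀ a m i → bit (replicate a false ++ true ∷ replicate m false) i ≡ (i ≡ᵇ a)
  bit-unit′ zero    m zero    = refl
  bit-unit′ zero    m (suc i) = bit-zeros m i
  bit-unit′ (suc a) m zero    = refl
  bit-unit′ (suc a) m (suc i) = bit-unit′ a m i

coversRow-unit : ∀ n a S → a < n → coversRow n (bit (unit n a)) S ≡ (bit S n ∨ bit S a)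
coversRow-unit n a S a<n = T-iff
  (λ h → subst (λ b → T (not b ∨ (bit S n ∨ bit S a))) (trans (bit-unit n a a) (≡ᵇ-refl a)) (allBelow-elim n h a a<n))
  (λ h → allBelow-intro n λ v _ → only v (bit-unit n a v) h)
  where
  only : ∀ v {b} → b ≡ (v ≡ᵇ a) → T (bit S n ∨ bit S a) → T (not b ∨ (bit S n ∨ bit S v))
  only v refl h with v ≡ᵇ a in eq
  ... | false = tt
  ... | true  rewrite ≡ᵇ⇒≡ v a (subst T (sym eq) tt) = h

weightedCovers : ℕ → Word → (Word → ℕ) → ℕ
weightedCovers n w g = sumSubsets n λ S → bit→ℕ (covers n (lowerEntry w) S) * g S

take-snoc : ∀ c S {b : Bool} → c ≤ length S → take c (S ++ b ∷ []) ≡ take c S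
take-snoc zero    S       _       = refl
take-snoc (suc c) (x ∷ S) (s≤s h) = cong (x ∷_) (take-snoc c S h)

bit-take : ∀ c S {i} → i < c → bit (take c S) i ≡ bit S i
bit-take (suc c) []      lt       = refl
bit-take (suc c) (b ∷ S) {zero}  lt = refl
bit-take (suc c) (b ∷ S) {suc i} (s≤s lt) = bit-take c S lt

-- The new vertex is unconstrained if a is in the cover, and forced otherwise.
addPendant : ∀ n w a c g → length w ≡ triangle n → a < c → c ≤ n →
  weightedCovers (suc n) (w ++ unit n a) (g ∘ take c) ≡
  weightedCovers n w (λ S → g (take c S) * 2 ^ bit→ℕ (bit (take c S) a))
addPendant n w a c g len a<c c≤n = sumSubsets-cong n λ S lenS → trans
  (cong₂ _+_ (term S false lenS) (term S true lenS))
  (combine (covers n (lowerEntry w) S) (bit S a) (bit (take c S) a) (bit-take c S a<c) (g (take c S)))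
  where
  term : ∀ S b → length S ≡ n →
    bit→ℕ (covers (suc n) (lowerEntry (w ++ unit n a)) (S ++ b ∷ [])) * g (take c (S ++ b ∷ [])) ≡
    bit→ℕ (covers n (lowerEntry w) S ∧ (b ∨ bit S a)) * g (take c S)
  term S b lenS = cong₂ (λ x y → bit→ℕ x * g y)
    (trans (covers-addRow n w (unit n a) (S ++ b ∷ []) len) (cong₂ _∧_ (covers-snoc n (lowerEntry w) S lenS)
      (trans (coversRow-unit n a (S ++ b ∷ []) (<-≤-trans a<c c≤n))
        (cong₂ _∨_ (bit-last S lenS) (bit-init S lenS (<-≤-trans a<c c≤n))))))
    (take-snoc c S (≤-trans c≤n (≤-reflexive (sym lenS))))
  combine : ∀ x y z → z ≡ y → ∀ m → bit→ℕ (x ∧ (false ∨ y)) * m + bit→ℕ (x ∧ (true ∨ y)) * m ≡ bit→ℕ x * (m * 2 ^ bit→ℕ z)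
  combine false y     z refl m = refl
  combine true  false z refl m = cong (_+ 0) (sym (*-identityʳ m))
  combine true  true  z refl m = solve 1 (λ m → (m :+ con 0) :+ (m :+ con 0) := m :* con 2 :+ con 0) refl m

pendants : ℕ → ℕ → ℕ → Word
pendants n a d = catenate d λ t → unit (n + t) a

length-pendants : ∀ n w a d → length w ≡ triangle n → a < n → length (w ++ pendants n a d) ≡ triangle (n + d)
length-pendants n w a zero    len a<n = trans (cong length (++-identityʳ w)) (trans len (cong triangle (sym (+-identityʳ n))))
length-pendants n w a (suc d) len a<n = begin
  length (w ++ (pendants n a d ++ unit (n + d) a))           ≡⟨ cong length (++-assoc w _ _) ⟨
  length ((w ++ pendants n a d) ++ unit (n + d) a)           ≡⟨ length-++ (w ++ pendants n a d) ⟩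
  length (w ++ pendants n a d) + length (unit (n + d) a)     ≡⟨ cong₂ _+_ (length-pendants n w a d len a<n)
                                                                  (length-unit (n + d) a (<-≤-trans a<n (m≤m+n n d))) ⟩
  triangle (suc (n + d))                                     ≡⟨ cong triangle (+-suc n d) ⟨
  triangle (n + suc d)                                       ∎
  where open ≡-Reasoning

-- Since the weight looks at the first `c` vertices only, summing out a pendant vertex turns it into
-- another weight of this kind, and the induction hypothesis applies to that one.
addPendants : ∀ n w a c d g → length w ≡ triangle n → a < c → c ≤ n →
  weightedCovers (n + d) (w ++ pendants n a d) (g ∘ take c) ≡
  weightedCovers n w (λ S → g (take c S) * 2 ^ (d * bit→ℕ (bit (take c S) a)))
addPendants n w a c zero g len a<c c≤n rewrite ++-identityʳ w | +-identityʳ n =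
  sumSubsets-cong n λ S _ → cong (bit→ℕ (covers n (lowerEntry w) S) *_) (sym (*-identityʳ _))
addPendants n w a c (suc d) g len a<c c≤n
  rewrite sym (++-assoc w (pendants n a d) (unit (n + d) a)) | +-suc n d = begin
  weightedCovers (suc (n + d)) ((w ++ pendants n a d) ++ unit (n + d) a) (g ∘ take c)
    ≡⟨ addPendant (n + d) (w ++ pendants n a d) a c g (length-pendants n w a d len (<-≤-trans a<c c≤n)) a<c
         (≤-trans c≤n (m≤m+n n d)) ⟩
  weightedCovers (n + d) (w ++ pendants n a d) (λ S → g (take c S) * 2 ^ β S)
    ≡⟨ addPendants n w a c d (λ U → g U * 2 ^ bit→ℕ (bit U a)) len a<c c≤n ⟩
  weightedCovers n w (λ S → g (take c S) * 2 ^ β S * 2 ^ (d * β S))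
    ≡⟨ sumSubsets-cong n (λ S _ → cong (bit→ℕ (covers n (lowerEntry w) S) *_)
         (trans (*-assoc (g (take c S)) _ _) (cong (g (take c S) *_) (sym (^-distribˡ-+-* 2 (β S) (d * β S)))))) ⟩
  weightedCovers n w (λ S → g (take c S) * 2 ^ (suc d * β S)) ∎
  where
  open ≡-Reasoning
  β : Word → ℕ
  β S = bit→ℕ (bit (take c S) a)

-- d pendant vertices at each of the vertices 0, ..., a - 1 of a graph with c vertices.
gadget : ℕ → ℕ → ℕ → Word
gadget c d a = catenate a λ b → pendants (c + b * d) b d

length-gadget : ∀ c w d a → length w ≡ triangle c → a ≤ c → length (w ++ gadget c d a) ≡ triangle (c + a * d)
length-gadget c w d zero    len a≤c = trans (cong length (++-identityʳ w)) (trans len (cong triangle (sym (+-identityʳ c))))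
length-gadget c w d (suc a) len a<c = begin
  length (w ++ (gadget c d a ++ pendants (c + a * d) a d))   ≡⟨ cong length (++-assoc w _ _) ⟨
  length ((w ++ gadget c d a) ++ pendants (c + a * d) a d)   ≡⟨ length-pendants (c + a * d) (w ++ gadget c d a) a d
                                                                  (length-gadget c w d a len (≤-trans (n≤1+n a) a<c))
                                                                  (<-≤-trans a<c (m≤m+n c (a * d))) ⟩
  triangle (c + a * d + d)                                   ≡⟨ cong triangle (trans (+-assoc c _ d) (cong (c +_) (+-comm _ d))) ⟩
  triangle (c + suc a * d)                                   ∎
  where open ≡-Reasoning

addGadget : ∀ c w d a g → length w ≡ triangle c → a ≤ c →
  weightedCovers (c + a * d) (w ++ gadget c d a) (g ∘ take c) ≡
  weightedCovers c w (λ S → g (take c S) * 2 ^ (d * countBelow a (bit (take c S))))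
addGadget c w d zero g len a≤c rewrite ++-identityʳ w | +-identityʳ c | *-zeroʳ d =
  sumSubsets-cong c λ S _ → cong (bit→ℕ (covers c (lowerEntry w) S) *_) (sym (*-identityʳ _))
addGadget c w d (suc a) g len a<c
  rewrite sym (++-assoc w (gadget c d a) (pendants (c + a * d) a d)) | +-comm d (a * d) | sym (+-assoc c (a * d) d) = begin
  weightedCovers (c + a * d + d) ((w ++ gadget c d a) ++ pendants (c + a * d) a d) (g ∘ take c)
    ≡⟨ addPendants (c + a * d) (w ++ gadget c d a) a c d g (length-gadget c w d a len (≤-trans (n≤1+n a) a<c)) a<c (m≤m+n c _) ⟩
  weightedCovers (c + a * d) (w ++ gadget c d a) (λ S → g (take c S) * 2 ^ (d * bit→ℕ (bit (take c S) a)))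
    ≡⟨ addGadget c w d a (λ U → g U * 2 ^ (d * bit→ℕ (bit U a))) len (≤-trans (n≤1+n a) a<c) ⟩
  weightedCovers c w (λ S → g (take c S) * 2 ^ (d * bit→ℕ (bit (take c S) a)) * 2 ^ (d * countBelow a (bit (take c S))))
    ≡⟨ sumSubsets-cong c (λ S _ → cong (bit→ℕ (covers c (lowerEntry w) S) *_) (trans (*-assoc (g (take c S)) _ _)
         (cong (g (take c S) *_) (trans (sym (^-distribˡ-+-* 2 (d * bit→ℕ (bit (take c S) a)) _))
           (cong (2 ^_) (sym (*-distribˡ-+ d (bit→ℕ (bit (take c S) a)) _))))))) ⟩
  weightedCovers c w (λ S → g (take c S) * 2 ^ (d * countBelow (suc a) (bit (take c S)))) ∎
  where open ≡-Reasoning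

take-all : ∀ c (S : Word) → length S ≡ c → take c S ≡ S
take-all .0 []      refl = refl
take-all ._ (b ∷ S) refl = cong (b ∷_) (take-all (length S) S refl)

gadget-covers : ∀ c w d → length w ≡ triangle c →
  weightedCovers (c + c * d) (w ++ gadget c d c) (λ _ → 1) ≡ weightedCovers c w (λ S → 2 ^ (d * weight S))
gadget-covers c w d len = trans (addGadget c w d c (λ _ → 1) len ≤-refl)
  (sumSubsets-cong c λ S lenS → cong (bit→ℕ (covers c (lowerEntry w) S) *_) (trans (+-identityʳ _)
    (cong (λ m → 2 ^ (d * m)) (trans (cong (countBelow c ∘ bit) (take-all c S lenS))
      (trans (cong (λ l → countBelow l (bit S)) (sym lenS)) (sym (weight-countBelow S)))))))

-- Restriction of a graph and of its covers to a set of vertices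

module _ (core : ℕ → Bool) where

  -- The restriction of `F` to the core, whose vertices are renumbered in increasing order. It is
  -- applied both to vertex sets and to rows of the adjacency matrix.
  pick : ℕ → (ℕ → Bool) → Word
  pick n F = catenate n λ u → if core u then F u ∷ [] else []

  length-pick : ∀ n F → length (pick n F) ≡ countBelow n core
  length-pick zero    F = refl
  length-pick (suc n) F with core n
  ... | true  = length-snoc (pick n F) (F n) (length-pick n F)
  ... | false = trans (cong length (++-identityʳ (pick n F))) (length-pick n F)

  pick-snoc : ∀ n S {b} → length S ≡ n → pick n (bit (S ++ b ∷ [])) ≡ pick n (bit S)
  pick-snoc n S {b} len = go n (≤-reflexive (sym len))
    where
    go : ∀ m → m ≤ length S → pick m (bit (S ++ b ∷ [])) ≡ pick m (bit S)
    go zero    _ = refl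
    go (suc m) h = cong₂ (λ u c → u ++ (if core m then c ∷ [] else [])) (go m (≤-trans (n≤1+n m) h)) (bit-++ˡ S (b ∷ []) h)

  -- Quantifying over the new numbers amounts to quantifying over core vertices. Two predicates are
  -- read at each place, because covering an edge involves the row of the matrix and the set.
  allBelow-pick : ∀ n (φ : Bool → Bool → Bool) F G →
    allBelow (countBelow n core) (λ j → φ (bit (pick n F) j) (bit (pick n G) j)) ≡
    allBelow n (λ v → not (core v) ∨ φ (F v) (G v))
  allBelow-pick zero    φ F G = refl
  allBelow-pick (suc n) φ F G with core n
  ... | true  = cong₂ _∧_
    (trans (allBelow-cong (countBelow n core) λ j lt →
        cong₂ φ (bit-init (pick n F) (length-pick n F) lt) (bit-init (pick n G) (length-pick n G) lt))
      (allBelow-pick n φ F G))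
    (cong₂ φ (bit-last (pick n F) (length-pick n F)) (bit-last (pick n G) (length-pick n G)))
  ... | false rewrite ++-identityʳ (pick n F) | ++-identityʳ (pick n G) =
    trans (allBelow-pick n φ F G) (sym (∧-identityʳ _))

  module _ (A : ℕ → ℕ → Bool) where

    induced : ℕ → Word
    induced n = catenate n λ u → if core u then pick u (A u) else []

    length-induced : ∀ n → length (induced n) ≡ triangle (countBelow n core)
    length-induced zero    = refl
    length-induced (suc n) with core n
    ... | true  = trans (length-++ (induced n)) (cong₂ _+_ (length-induced n) (length-pick n (A n)))
    ... | false = trans (cong length (++-identityʳ (induced n))) (length-induced n)

    covers-induced : ∀ n (F : ℕ → Bool) →
      covers (countBelow n core) (lowerEntry (induced n)) (pick n F) ≡
      allBelow n (λ u → not (core u) ∨ allBelow u λ v → not (core v) ∨ (not (A u v) ∨ (F u ∨ F v)))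
    covers-induced zero    F = refl
    covers-induced (suc n) F with core n
    ... | true  = trans (covers-addRow c (induced n) (pick n (A n)) (pick n F ++ F n ∷ []) (length-induced n)) (cong₂ _∧_
      (trans (covers-snoc c (lowerEntry (induced n)) (pick n F) (length-pick n F)) (covers-induced n F))
      (trans (allBelow-cong c λ j lt → cong₂ (λ s t → not (bit (pick n (A n)) j) ∨ (s ∨ t))
          (bit-last (pick n F) (length-pick n F)) (bit-init (pick n F) (length-pick n F) lt))
        (allBelow-pick n (λ a t → not a ∨ (F n ∨ t)) (A n) F)))
      where c = countBelow n core
    ... | false rewrite ++-identityʳ (induced n) | ++-identityʳ (pick n F) =
      trans (covers-induced n F) (sym (∧-identityʳ _))

module _ (light busy : ℕ → Bool) where

  core free : ℕ → Bool
  core u = light u ∧ busy u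
  free u = light u ∧ not (busy u)

  heavyIn : ℕ → Word → Bool
  heavyIn n S = allBelow n λ u → light u ∨ bit S u

  heavyIn-snoc : ∀ n S {b} → length S ≡ n → heavyIn n (S ++ b ∷ []) ≡ heavyIn n S
  heavyIn-snoc n S len = allBelow-cong n λ u lt → cong (light u ∨_) (bit-init S len lt)

  -- Heavy vertices are forced into S, free vertices are unconstrained, and
  -- the core is subject to g.
  sum-classes : ∀ B n (g : Word → ℕ) →
    sumSubsets n (λ S → bit→ℕ (heavyIn n S) * (g (pick core n (bit S)) * B ^ weight S)) ≡
    B ^ countBelow n (not ∘ light) * ((1 + B) ^ countBelow n free *
      sumSubsets (countBelow n core) (λ U → g U * B ^ weight U))
  sum-classes B zero    g = solve 1 (λ m → m :+ con 0 := con 1 :* (con 1 :* m)) refl (g [] * 1)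
  sum-classes B (suc n) g = trans (sumSubsets-cong n λ S len →
      cong₂ _+_ (term false S len) (term true S len)) (go (light n) refl (busy n) refl)
    where
    letters : Bool → Word
    letters b = if core n then b ∷ [] else []

    h i c : ℕ
    h = countBelow n (not ∘ light)
    i = countBelow n free
    c = countBelow n core

    val : Bool → Word → ℕ
    val b S = bit→ℕ (heavyIn n S ∧ (light n ∨ b)) * (g (pick core n (bit S) ++ letters b) * B ^ (bit→ℕ b + weight S))

    term : ∀ b S → length S ≡ n →
      bit→ℕ (heavyIn (suc n) (S ++ b ∷ [])) *
        (g (pick core (suc n) (bit (S ++ b ∷ []))) * B ^ weight (S ++ b ∷ [])) ≡ val b S
    term b S len = cong₂ _*_ (cong bit→ℕ (cong₂ (λ x y → x ∧ (light n ∨ y)) (heavyIn-snoc n S len) (bit-last S len)))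
      (cong₂ _*_ (cong g (cong₂ (λ u y → u ++ (if core n then y ∷ [] else [])) (pick-snoc core n S len) (bit-last S len)))
        (cong (B ^_) (weight-snoc S b)))

    H : Word → Bool
    H = heavyIn n
    P : Word → Word
    P S = pick core n (bit S)

    go : ∀ l → light n ≡ l → ∀ y → busy n ≡ y →
      sumSubsets n (λ S → val false S + val true S) ≡
      B ^ countBelow (suc n) (not ∘ light) * ((1 + B) ^ countBelow (suc n) free *
        sumSubsets (countBelow (suc n) core) (λ U → g U * B ^ weight U))
    go false eq y _ rewrite eq = begin
      sumSubsets n (λ S → bit→ℕ (H S ∧ false) * (g (P S ++ []) * (B ^ weight S)) + bit→ℕ (H S ∧ true) * (g (P S ++ []) * (B * B ^ weight S)))
        ≡⟨ sumSubsets-cong n (λ S _ → forced (H S) (g (P S ++ [])) (g (P S)) (B ^ weight S) (cong g (++-identityʳ (P S)))) ⟩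
      sumSubsets n (λ S → B * (bit→ℕ (H S) * (g (P S) * B ^ weight S)))
        ≡⟨ sumSubsets-* n B _ ⟩
      B * sumSubsets n (λ S → bit→ℕ (H S) * (g (P S) * B ^ weight S))
        ≡⟨ cong (B *_) (sum-classes B n g) ⟩
      B * (B ^ h * ((1 + B) ^ i * sumSubsets c (λ U → g U * B ^ weight U)))
        ≡⟨ *-assoc B _ _ ⟨
      B * B ^ h * ((1 + B) ^ i * sumSubsets c (λ U → g U * B ^ weight U)) ∎
      where
      open ≡-Reasoning
      forced : ∀ x m m′ p → m ≡ m′ → bit→ℕ (x ∧ false) * (m * p) + bit→ℕ (x ∧ true) * (m * (B * p)) ≡ B * (bit→ℕ x * (m′ * p))
      forced false m m′ p refl = sym (*-zeroʳ B)
      forced true  m m′ p refl = solve 3 (λ m b p → m :* (b :* p) :+ con 0 := b :* (m :* p :+ con 0)) refl m B p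
    go true eq false eq′ rewrite eq | eq′ = begin
      sumSubsets n (λ S → bit→ℕ (H S ∧ true) * (g (P S ++ []) * (B ^ weight S)) + bit→ℕ (H S ∧ true) * (g (P S ++ []) * (B * B ^ weight S)))
        ≡⟨ sumSubsets-cong n (λ S _ → both (H S) (g (P S ++ [])) (g (P S)) (B ^ weight S) (cong g (++-identityʳ (P S)))) ⟩
      sumSubsets n (λ S → (1 + B) * (bit→ℕ (H S) * (g (P S) * B ^ weight S)))
        ≡⟨ sumSubsets-* n (1 + B) _ ⟩
      (1 + B) * sumSubsets n (λ S → bit→ℕ (H S) * (g (P S) * B ^ weight S))
        ≡⟨ cong ((1 + B) *_) (sum-classes B n g) ⟩
      (1 + B) * (B ^ h * ((1 + B) ^ i * sumSubsets c (λ U → g U * B ^ weight U)))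
        ≡⟨ solve 4 (λ a h i s → a :* (h :* (i :* s)) := h :* (a :* i :* s)) refl (1 + B) (B ^ h) ((1 + B) ^ i) _ ⟩
      B ^ h * ((1 + B) * (1 + B) ^ i * sumSubsets c (λ U → g U * B ^ weight U)) ∎
      where
      open ≡-Reasoning
      both : ∀ x m m′ p → m ≡ m′ → bit→ℕ (x ∧ true) * (m * p) + bit→ℕ (x ∧ true) * (m * (B * p)) ≡ (1 + B) * (bit→ℕ x * (m′ * p))
      both false m m′ p refl = sym (*-zeroʳ (1 + B))
      both true  m m′ p refl = solve 3 (λ m b p → m :* p :+ con 0 :+ (m :* (b :* p) :+ con 0) := (con 1 :+ b) :* (m :* p :+ con 0)) refl m B p
    -- A core vertex survives on the right. Its two choices are merged into a weight on the smaller
    -- core, which is why the induction is over arbitrary `g`.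
    go true eq true eq′ rewrite eq | eq′ = begin
      sumSubsets n (λ S → bit→ℕ (H S ∧ true) * (g (P S ++ false ∷ []) * (B ^ weight S)) + bit→ℕ (H S ∧ true) * (g (P S ++ true ∷ []) * (B * B ^ weight S)))
        ≡⟨ sumSubsets-cong n (λ S _ → merge (H S) (g (P S ++ false ∷ [])) (g (P S ++ true ∷ [])) (B ^ weight S)) ⟩
      sumSubsets n (λ S → bit→ℕ (H S) * ((g (P S ++ false ∷ []) + g (P S ++ true ∷ []) * B) * B ^ weight S))
        ≡⟨ sum-classes B n (λ U → g (U ++ false ∷ []) + g (U ++ true ∷ []) * B) ⟩
      B ^ h * ((1 + B) ^ i * sumSubsets c (λ U → (g (U ++ false ∷ []) + g (U ++ true ∷ []) * B) * B ^ weight U))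
        ≡⟨ cong (λ s → B ^ h * ((1 + B) ^ i * s)) (sumSubsets-cong c λ U _ → trans
             (solve 4 (λ x y b p → (x :+ y :* b) :* p := x :* p :+ y :* (b :* p)) refl (g (U ++ false ∷ [])) (g (U ++ true ∷ [])) B (B ^ weight U))
             (sym (cong₂ (λ v w → g (U ++ false ∷ []) * B ^ v + g (U ++ true ∷ []) * B ^ w) (weight-snoc U false) (weight-snoc U true)))) ⟩
      B ^ h * ((1 + B) ^ i * sumSubsets (suc c) (λ U → g U * B ^ weight U)) ∎
      where
      open ≡-Reasoning
      merge : ∀ x m m′ p → bit→ℕ (x ∧ true) * (m * p) + bit→ℕ (x ∧ true) * (m′ * (B * p)) ≡ bit→ℕ x * ((m + m′ * B) * p)
      merge false m m′ p = refl
      merge true  m m′ p = solve 4 (λ m m′ b p → m :* p :+ con 0 :+ (m′ :* (b :* p) :+ con 0) := (m :+ m′ :* b) :* p :+ con 0) refl m m′ B p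

∧-intro : ∀ {a b} → T a → T b → T (a ∧ b)
∧-intro {true} {true} _ _ = tt

∧-left : ∀ {a b} → T (a ∧ b) → T a
∧-left {true} _ = tt

∧-right : ∀ {a b} → T (a ∧ b) → T b
∧-right {true} h = h

∨-resolve : ∀ {a b} → T (a ∨ b) → ¬ T a → T b
∨-resolve {true}  _ h = ⊥-elim (h tt)
∨-resolve {false} h _ = h

⇒-intro : ∀ {a b} → (T a → T b) → T (not a ∨ b)
⇒-intro {true}  h = h tt
⇒-intro {false} h = tt

⇒-elim : ∀ {a b} → T (not a ∨ b) → T a → T b
⇒-elim {true} h _ = h

∨-introˡ : ∀ {a b} → T a → T (a ∨ b)
∨-introˡ {true} _ = tt

∨-introʳ : ∀ a {b} → T b → T (a ∨ b)
∨-introʳ true  _ = tt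
∨-introʳ false h = h

bit→ℕ-≤ : ∀ {a b} → (T a → T b) → bit→ℕ a ≤ bit→ℕ b
bit→ℕ-≤ {false}         h = z≤n
bit→ℕ-≤ {true}  {true}  h = ≤-refl
bit→ℕ-≤ {true}  {false} h = ⊥-elim (h tt)

-- Heavy, light and core vertices

module Degrees (n k : ℕ) (A : ℕ → ℕ → Bool) where

  degree : ℕ → ℕ
  degree u = countBelow n (A u)

  light busy : ℕ → Bool
  light u = degree u ≤ᵇ k
  busy u  = 1 ≤ᵇ countBelow n (λ v → A u v ∧ light v)

module Classify (n k : ℕ) (A : ℕ → ℕ → Bool) (A-sym : ∀ u v → A u v ≡ A v u) where

  open Degrees n k A

  busy-intro : ∀ {u v} → v < n → T (A u v) → T (light v) → T (busy u)
  busy-intro {u} {v} v<n a l = ≤⇒≤ᵇ (positive n v<n (∧-intro a l))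
    where
    positive : ∀ m {P} {v} → v < m → T (P v) → 1 ≤ countBelow m P
    positive (suc m) {P} {v} (s≤s le) t with m≤n⇒m<n∨m≡n le
    ... | inj₁ lt   = ≤-trans (positive m lt t) (m≤n+m _ _)
    ... | inj₂ refl = ≤-trans (bit→ℕ-≤ {true} λ _ → t) (m≤m+n _ _)

  busy-elim : ∀ {u} → T (busy u) → 1 ≤ countBelow n (λ v → A u v ∧ light v)
  busy-elim {u} = ≤ᵇ⇒≤ 1 (countBelow n (λ v → A u v ∧ light v))

  covers-elim : ∀ {S} → T (covers n A S) → ∀ u v → u < n → v < n → u ≢ v → T (A u v) → ¬ T (bit S u) → T (bit S v)
  covers-elim {S} h u v u<n v<n ne a nu with <-cmp u v
  ... | tri≈ _ eq _ = ⊥-elim (ne eq)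
  ... | tri> _ _ v<u = ∨-resolve (⇒-elim (allBelow-elim u (allBelow-elim n h u u<n) v v<u) a) nu
  ... | tri< u<v _ _ with bit S v in eq
  ...   | true  = tt
  ...   | false = nu (subst (λ b → T (b ∨ bit S u)) eq
      (⇒-elim (allBelow-elim v (allBelow-elim n h v v<n) u u<v) (subst T (A-sym u v) a)))

  coreCovers : Word → Bool
  coreCovers S = covers (countBelow n (core light busy)) (lowerEntry (induced (core light busy) A n)) (pick (core light busy) n (bit S))

  module _ (A-irrefl : ∀ u → ¬ T (A u u)) {S : Word} (len : length S ≡ n) (small : weight S ≤ k) where

    weight≡ : weight S ≡ countBelow n (bit S)
    weight≡ = trans (weight-countBelow S) (cong (λ l → countBelow l (bit S)) len)

    no-loop : ∀ {u v} → T (A u v) → u ≢ v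
    no-loop {u} a refl = A-irrefl u a

    -- A vertex outside a cover has all its neighbours in the cover, so its degree is at most
    -- `weight S` and hence at most `k`: heavy vertices lie in `S`. Conversely, an edge at a heavy
    -- vertex is covered by that vertex, and the ends of an edge between light vertices are both in
    -- the core.
    covers-classes : covers n A S ≡ heavyIn light busy n S ∧ coreCovers S
    covers-classes = T-iff
      (λ h → ∧-intro
        (allBelow-intro n λ u u<n → heavy-in h u<n)
        (subst T (sym (covers-induced K A n (bit S))) (allBelow-intro n λ u u<n → ⇒-intro λ _ →
          allBelow-intro u λ v v<u → ⇒-intro {K v} λ _ → allBelow-elim u (allBelow-elim n h u u<n) v v<u)))
      (λ h → allBelow-intro n λ u u<n → allBelow-intro u λ v v<u → ⇒-intro λ a →
        edge-covered (∧-left h) (subst T (covers-induced K A n (bit S)) (∧-right {heavyIn light busy n S} h)) u<n v<u a)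
      where
      K : ℕ → Bool
      K = core light busy

      heavy-in : T (covers n A S) → ∀ {u} → u < n → T (light u ∨ bit S u)
      heavy-in h {u} u<n with bit S u in eq
      ... | true  = ∨-introʳ (light u) tt
      ... | false = ∨-introˡ (≤⇒≤ᵇ (≤-trans (sumBelow-≤ n λ v v<n → bit→ℕ-≤ λ a →
          covers-elim {S} h u v u<n v<n (no-loop a) a (subst T eq)) (≤-trans (≤-reflexive (sym weight≡)) small)))

      edge-covered : T (heavyIn light busy n S) →
        T (allBelow n (λ u → not (K u) ∨ allBelow u λ v → not (K v) ∨ (not (A u v) ∨ (bit S u ∨ bit S v)))) →
        ∀ {u v} → u < n → v < u → T (A u v) → T (bit S u ∨ bit S v)
      edge-covered hv hc {u} {v} u<n v<u a with T? (light u) | T? (light v)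
      ... | no nl | _     = ∨-introˡ (∨-resolve (allBelow-elim n hv u u<n) nl)
      ... | yes _ | no nl = ∨-introʳ (bit S u) (∨-resolve (allBelow-elim n hv v (<-trans v<u u<n)) nl)
      ... | yes l | yes l′ =
        ⇒-elim (⇒-elim {K v} (allBelow-elim u (⇒-elim {K u} (allBelow-elim n hc u u<n)
            (∧-intro l (busy-intro (<-trans v<u u<n) a l′))) v v<u)
          (∧-intro l′ (busy-intro u<n (subst T (A-sym u v) a) l))) a

    -- A core vertex is in `S`, or else its light neighbour is. Thus all core vertices are among at
    -- most `k` vertices of `S` and the neighbours of light vertices of `S`, of which each has at
    -- most `k`.
    core-small : T (covers n A S) → countBelow n (core light busy) ≤ k + k * k
    core-small h = begin
      countBelow n (core light busy)
        ≤⟨ sumBelow-≤ n touched ⟩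
      sumBelow n (λ u → bit→ℕ (bit S u) + sumBelow n (λ v → bit→ℕ (A v u) * x v))
        ≡⟨ sumBelow-+ n _ _ ⟩
      countBelow n (bit S) + sumBelow n (λ u → sumBelow n (λ v → bit→ℕ (A v u) * x v))
        -- Double counting: the pairs are now grouped by the light vertex `v` of `S`.
        ≡⟨ cong (countBelow n (bit S) +_) (trans (sumBelow-swap n n _) (sumBelow-cong n λ v _ → sumBelow-* n (x v) _)) ⟩
      countBelow n (bit S) + sumBelow n (λ v → degree v * x v)
        ≤⟨ +-monoʳ-≤ (countBelow n (bit S)) (sumBelow-≤ n λ v _ → light-degree v) ⟩
      countBelow n (bit S) + sumBelow n (λ v → bit→ℕ (bit S v) * k)
        ≡⟨ cong (countBelow n (bit S) +_) (sumBelow-* n k _) ⟩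
      countBelow n (bit S) + countBelow n (bit S) * k
        ≤⟨ +-mono-≤ size≤k (*-monoˡ-≤ k size≤k) ⟩
      k + k * k ∎
      where
      open ≤-Reasoning
      x : ℕ → ℕ
      x v = bit→ℕ (bit S v ∧ light v)

      size≤k : countBelow n (bit S) ≤ k
      size≤k = ≤-trans (≤-reflexive (sym weight≡)) small

      light-degree : ∀ v → degree v * x v ≤ bit→ℕ (bit S v) * k
      light-degree v with bit S v | light v in eq
      ... | false | _     = ≤-reflexive (*-zeroʳ (degree v))
      ... | true  | false = ≤-trans (≤-reflexive (*-zeroʳ (degree v))) z≤n
      ... | true  | true  = ≤-trans (≤-reflexive (*-identityʳ (degree v)))
        (≤-trans (≤ᵇ⇒≤ (degree v) k (subst T (sym eq) tt)) (≤-reflexive (sym (+-identityʳ k))))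

      touched : ∀ u → u < n → bit→ℕ (core light busy u) ≤ bit→ℕ (bit S u) + sumBelow n (λ v → bit→ℕ (A v u) * x v)
      touched u u<n with T? (core light busy u) | T? (bit S u)
      ... | no nc | _      = ≤-trans (bit→ℕ-≤ {b = false} nc) z≤n
      ... | yes _ | yes s  = ≤-trans (bit→ℕ-≤ λ _ → s) (m≤m+n _ _)
      ... | yes c | no ns  = ≤-trans (≤-trans (bit→ℕ-≤ {b = true} _)
        (≤-trans (busy-elim (∧-right {light u} c)) (sumBelow-≤ n λ v v<n → neighbour v v<n))) (m≤n+m _ _)
        where
        product : ∀ a b {c d} → (T (a ∧ b) → T c × T d) → bit→ℕ (a ∧ b) ≤ bit→ℕ c * bit→ℕ d
        product a b {c} {d} h with a ∧ b
        ... | false = z≤n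
        product _ _ {c = true}  {true}  h | true = ≤-refl
        product _ _ {c = false} {d}     h | true = ⊥-elim (proj₁ (h tt))
        product _ _ {c = true}  {false} h | true = ⊥-elim (proj₂ (h tt))
        neighbour : ∀ v → v < n → bit→ℕ (A u v ∧ light v) ≤ bit→ℕ (A v u) * x v
        neighbour v v<n = product (A u v) (light v) λ t → subst T (A-sym u v) (∧-left {A u v} t) ,
          ∧-intro (covers-elim {S} h u v u<n v<n (no-loop (∧-left {A u v} t)) (∧-left {A u v} t) ns) (∧-right {A u v} t)

-- The number of vertex covers as a sum over words

sumVec : ∀ n → (Vec Bool n → ℕ) → ℕ
sumVec zero    f = f []
sumVec (suc n) f = sumVec n (f ∘ (false ∷_)) + sumVec n (f ∘ (true ∷_))

length-filter-map : ∀ {A B : Set} {P : B → Set} (P? : ∀ b → Dec (P b)) (g : A → B) xs →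
                    length (filter P? (List.map g xs)) ≡ length (filter (P? ∘ g) xs)
length-filter-map P? g []       = refl
length-filter-map P? g (x ∷ xs) with does (P? (g x))
... | true  = cong suc (length-filter-map P? g xs)
... | false = length-filter-map P? g xs

length-filter-subsets : ∀ n {P : Subset n → Set} (P? : ∀ S → Dec (P S)) →
                        length (filter P? (subsets n)) ≡ sumVec n (λ S → bit→ℕ (does (P? S)))
length-filter-subsets zero P? with does (P? [])
... | true  = refl
... | false = refl
length-filter-subsets (suc n) P? =
  trans (cong length (filter-++ P? (List.map (outside ∷_) (subsets n)) _))
    (trans (length-++ (filter P? (List.map (outside ∷_) (subsets n))))
      (cong₂ _+_ (trans (length-filter-map P? _ (subsets n)) (length-filter-subsets n (P? ∘ (outside ∷_))))
                 (trans (length-filter-map P? _ (subsets n)) (length-filter-subsets n (P? ∘ (inside ∷_))))))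

sumVec-sumSubsets : ∀ n {f g} → (∀ S → f S ≡ g (Vec.toList S)) → sumVec n f ≡ sumSubsets n g
sumVec-sumSubsets zero    eq = eq []
sumVec-sumSubsets (suc n) {g = g} eq = trans
  (cong₂ _+_ (sumVec-sumSubsets n (eq ∘ (false ∷_))) (sumVec-sumSubsets n (eq ∘ (true ∷_))))
  (sym (sumSubsets-cons n g))

weight-toList : ∀ {n} (S : Subset n) → weight (Vec.toList S) ≡ ∣ S ∣
weight-toList []          = refl
weight-toList (true ∷ S)  = cong suc (weight-toList S)
weight-toList (false ∷ S) = weight-toList S

bit-toList : ∀ {n} (S : Subset n) u → bit (Vec.toList S) (toℕ u) ≡ lookup S u
bit-toList (b ∷ S) Fin.zero    = refl
bit-toList (b ∷ S) (Fin.suc u) = bit-toList S u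

-- The adjacency of `fromTriangle`, which is local to that definition, repeated for vertices given
-- as numbers; the two agree definitionally.
edge : Word → ℕ → ℕ → Bool
edge w u v = not (u ≡ᵇ v) ∧ bit w (triangle (u ⊔ v) + (u ⊓ v))

≡ᵇ-comm : ∀ i j → (i ≡ᵇ j) ≡ (j ≡ᵇ i)
≡ᵇ-comm zero    zero    = refl
≡ᵇ-comm zero    (suc _) = refl
≡ᵇ-comm (suc _) zero    = refl
≡ᵇ-comm (suc i) (suc j) = ≡ᵇ-comm i j

edge-sym : ∀ w u v → edge w u v ≡ edge w v u
edge-sym w u v rewrite ≡ᵇ-comm u v | ⊔-comm u v | ⊓-comm u v = refl

edge-irrefl : ∀ w u → ¬ T (edge w u u)
edge-irrefl w u h rewrite ≡ᵇ-refl u = h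

edge-below : ∀ w u v → v < u → edge w u v ≡ lowerEntry w u v
edge-below w u v v<u with u ≡ᵇ v in eq
... | true  = contradiction (≡ᵇ⇒≡ u v (subst T (sym eq) tt)) (>⇒≢ v<u)
... | false rewrite m≥n⇒m⊔n≡m (<⇒≤ v<u) | m≥n⇒m⊓n≡n (<⇒≤ v<u) = refl

does-≡ : ∀ {P : Set} {b} (d : Dec P) → (P → T b) → (T b → P) → does d ≡ b
does-≡ (yes p) f g = T-iff (λ _ → f p) (λ _ → tt)
does-≡ (no ¬p) f g = T-iff (λ ()) (λ t → ¬p (g t))

∈⇒bit : ∀ {n} {S : Subset n} {u} → u ∈ S → T (bit (Vec.toList S) (toℕ u))
∈⇒bit {S = S} {u} i = subst T (sym (trans (bit-toList S u) ([]=⇒lookup i))) tt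

bit⇒∈ : ∀ {n} {S : Subset n} {u} → T (bit (Vec.toList S) (toℕ u)) → u ∈ S
bit⇒∈ {S = S} {u} t = lookup⇒[]= u S (T-iff (λ _ → tt) (λ _ → subst T (bit-toList S u) t))

does-isVertexCover : ∀ n w S → does (isVertexCover? (fromTriangle n w) S) ≡ covers n (edge w) (Vec.toList S)
does-isVertexCover n w S = does-≡ (isVertexCover? (fromTriangle n w) S)
  (λ c → allBelow-intro n λ u u<n → allBelow-intro u λ v v<u → ⇒-intro λ a →
    covered c (toℕ-fromℕ< u<n) (toℕ-fromℕ< (<-trans v<u u<n)) a)
  covering
  where
  covered : IsVertexCover (fromTriangle n w) S → ∀ {i j : Fin n} {u v} → toℕ i ≡ u → toℕ j ≡ v →
            T (edge w u v) → T (bit (Vec.toList S) u ∨ bit (Vec.toList S) v)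
  covered c {i} {j} refl refl a with c i j a
  ... | inj₁ h = ∨-introˡ (∈⇒bit h)
  ... | inj₂ h = ∨-introʳ (bit (Vec.toList S) (toℕ i)) (∈⇒bit h)
  covering : T (covers n (edge w) (Vec.toList S)) → IsVertexCover (fromTriangle n w) S
  covering h u v a with T? (bit (Vec.toList S) (toℕ u))
  ... | yes t = inj₁ (bit⇒∈ t)
  ... | no nt = inj₂ (bit⇒∈ (Classify.covers-elim n 0 (edge w) (edge-sym w) {Vec.toList S} h
      (toℕ u) (toℕ v) (toℕ<n u) (toℕ<n v)
      (λ eq → edge-irrefl w (toℕ v) (subst (λ i → T (edge w i (toℕ v))) eq a)) a nt))

count-covers : ∀ n w k → countVertexCovers (fromTriangle n w) k ≡
               sumSubsets n (λ S → bit→ℕ (covers n (edge w) S ∧ (weight S ≤ᵇ k)))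
count-covers n w k = trans
  (length-filter-subsets n (λ S → isVertexCover? (fromTriangle n w) S ×-dec (∣ S ∣ ≤? k)))
  (sumVec-sumSubsets n λ S → cong bit→ℕ (cong₂ _∧_ (does-isVertexCover n w S) (cong (_≤ᵇ k) (sym (weight-toList S)))))

-- The kernelization

ones : Word → ℕ
ones []          = 0
ones (false ∷ w) = 0
ones (true ∷ w)  = suc (ones w)

rest : Word → Word
rest x = drop (suc (ones x)) x

-- A word of ones without the separating zero fails this test as well, since it is too short.
valid : Word → Bool
valid x = length x ≡ᵇ suc (ones x + triangle (ones x))

data Split (x : Word) : Set where
  found   : splitUnary x ≡ just (ones x , rest x) → length x ≡ suc (ones x + length (rest x)) → Split x
  missing : splitUnary x ≡ nothing → length x ≡ ones x → Split x

split : ∀ x → Split x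
split []          = missing refl refl
split (false ∷ x) = found refl refl
split (true ∷ x)  with split x
... | found eq len   = found (cong (Maybe.map λ (n , w) → suc n , w) eq) (cong suc len)
... | missing eq len = missing (cong (Maybe.map λ (n , w) → suc n , w) eq) (cong suc len)

toGraph-just : ∀ n w → length w ≡ triangle n → toGraph (n , w) ≡ just (n , fromTriangle n w)
toGraph-just n w eq with length w ≟ triangle n
... | yes _ = refl
... | no ne = contradiction eq ne

toGraph-nothing : ∀ n w → length w ≢ triangle n → toGraph (n , w) ≡ nothing
toGraph-nothing n w ne with length w ≟ triangle n
... | yes eq = contradiction eq ne
... | no _   = refl

decode-valid : ∀ x → T (valid x) → decode x ≡ just (ones x , fromTriangle (ones x) (rest x))
decode-valid x v with split x | ≡ᵇ⇒≡ (length x) _ v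
... | found eq len   | eq′ rewrite eq =
  toGraph-just (ones x) (rest x) (+-cancelˡ-≡ (ones x) _ _ (suc-injective (trans (sym len) eq′)))
... | missing eq len | eq′ = contradiction (trans (sym len) eq′) (<⇒≢ (s≤s (m≤m+n _ _)))

decode-invalid : ∀ x → ¬ T (valid x) → decode x ≡ nothing
decode-invalid x nv with split x
... | found eq len   rewrite eq = toGraph-nothing (ones x) (rest x) λ e →
  nv (≡⇒≡ᵇ (length x) _ (trans len (cong (suc ∘ (ones x +_)) e)))
... | missing eq len rewrite eq = refl

module Kernelize (n k : ℕ) (w : Word) where

  open Degrees n k (edge w) public

  isCore isFree : ℕ → Bool
  isCore = core light busy
  isFree = free light busy

  #core #heavy #free order : ℕ
  #core  = countBelow n isCore
  #heavy = countBelow n (not ∘ light)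
  #free  = countBelow n isFree
  order  = #core + #core * suc #core

  kernelTriangle : Word
  kernelTriangle = induced isCore (edge w) n ++ gadget #core (suc #core) #core

  length-kernelTriangle : length kernelTriangle ≡ triangle order
  length-kernelTriangle = length-gadget #core (induced isCore (edge w) n) (suc #core) #core
    (length-induced isCore (edge w) n) ≤-refl

  small : Bool
  small = #core ≤ᵇ k + k * k

  lifted : ℕ → ℕ
  lifted s = respace (suc n) 0 (suc k) (2 ^ (suc n * #heavy) *
    ((1 + 2 ^ suc n) ^ #free * respace (suc #core) (suc n) (suc #core) s))

  coverWeights : ℕ → ℕ
  coverWeights D = sumSubsets #core λ U → bit→ℕ (covers #core (lowerEntry (induced isCore (edge w) n)) U) * 2 ^ (D * weight U)

  count-kernel : countVertexCovers (fromTriangle order kernelTriangle) order ≡ coverWeights (suc #core)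
  count-kernel = trans (count-covers order kernelTriangle order) (trans
    (sumSubsets-cong order λ S len → trans
      (cong bit→ℕ (cong₂ _∧_ (covers-cong order S λ u v _ v<u → edge-below kernelTriangle u v v<u)
        (T-iff {b = true} (λ _ → tt) λ _ → ≤⇒≤ᵇ (subst (weight S ≤_) len (weight≤length S)))))
      (trans (cong bit→ℕ (∧-identityʳ _)) (sym (*-identityʳ _))))
    (gadget-covers #core (induced isCore (edge w) n) (suc #core) (length-induced isCore (edge w) n)))

  forcedCovers : Word → Bool
  forcedCovers S = heavyIn light busy n S ∧ Classify.coreCovers n k (edge w) (edge-sym w) S

  -- The digits count sets that contain the heavy vertices and cover the core. A vertex cover with
  -- more than `k` vertices may omit a heavy vertex, so only the digits up to `k` are meaningful,
  -- and the outer `respace` keeps exactly those.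
  lifted-kernel : lifted (coverWeights (suc #core)) ≡ sumSubsets n (λ S → bit→ℕ (forcedCovers S) * (if weight S <ᵇ suc k then 1 else 0))
  lifted-kernel = begin
    respace D 0 (suc k) (2 ^ (D * #heavy) * ((1 + B) ^ #free * respace (suc #core) D (suc #core) (coverWeights (suc #core))))
      ≡⟨ cong (λ s → respace D 0 (suc k) (2 ^ (D * #heavy) * ((1 + B) ^ #free * s)))
           (trans (respace-sizes #core f (λ U → bit≤1 _) (suc #core) D (suc #core) ≤-refl)
             (sumSubsets-cong #core λ U len → cong (f U *_)
               (trans (if-< (s≤s (subst (weight U ≤_) len (weight≤length U)))) (sym (^-*-assoc 2 D (weight U)))))) ⟩
    respace D 0 (suc k) (2 ^ (D * #heavy) * ((1 + B) ^ #free * sumSubsets #core (λ U → f U * B ^ weight U)))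
      ≡⟨ cong (λ p → respace D 0 (suc k) (p * ((1 + B) ^ #free * sumSubsets #core (λ U → f U * B ^ weight U)))) (^-*-assoc 2 D #heavy) ⟨
    respace D 0 (suc k) (B ^ #heavy * ((1 + B) ^ #free * sumSubsets #core (λ U → f U * B ^ weight U)))
      ≡⟨ cong (respace D 0 (suc k)) (sum-classes light busy B n f) ⟨
    respace D 0 (suc k) (sumSubsets n (λ S → bit→ℕ (heavyIn light busy n S) * (f (pick isCore n (bit S)) * B ^ weight S)))
      ≡⟨ cong (respace D 0 (suc k)) (sumSubsets-cong n λ S _ → trans (sym (*-assoc (bit→ℕ (heavyIn light busy n S)) _ _))
           (cong₂ _*_ (sym (bit-∧ (heavyIn light busy n S) _)) (^-*-assoc 2 D (weight S)))) ⟩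
    respace D 0 (suc k) (sumSubsets n (λ S → bit→ℕ (forcedCovers S) * 2 ^ (D * weight S)))
      ≡⟨ respace-sizes n (bit→ℕ ∘ forcedCovers) (λ S → bit≤1 _) D 0 (suc k) ≤-refl ⟩
    sumSubsets n (λ S → bit→ℕ (forcedCovers S) * (if weight S <ᵇ suc k then 1 else 0)) ∎
    where
    open ≡-Reasoning
    D B : ℕ
    D = suc n
    B = 2 ^ D
    f : Word → ℕ
    f U = bit→ℕ (covers #core (lowerEntry (induced isCore (edge w) n)) U)
    bit-∧ : ∀ a b → bit→ℕ (a ∧ b) ≡ bit→ℕ a * bit→ℕ b
    bit-∧ false b = refl
    bit-∧ true  b = sym (+-identityʳ _)

  lifted-correct : lifted (countVertexCovers (fromTriangle order kernelTriangle) order) ≡ countVertexCovers (fromTriangle n w) k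
  lifted-correct = trans (cong lifted count-kernel) (trans lifted-kernel
    (sym (trans (count-covers n w k) (sumSubsets-cong n same))))
    where
    same : ∀ S → length S ≡ n → bit→ℕ (covers n (edge w) S ∧ (weight S ≤ᵇ k)) ≡
           bit→ℕ (forcedCovers S) * (if weight S <ᵇ suc k then 1 else 0)
    same S len with weight S ≤? k
    ... | yes le rewrite Classify.covers-classes n k (edge w) (edge-sym w) (edge-irrefl w) {S} len le =
      trans (cong (λ b → bit→ℕ (forcedCovers S ∧ b)) (T-iff {b = true} (λ _ → tt) λ _ → ≤⇒≤ᵇ le))
        (trans (∧-true (forcedCovers S)) (cong (bit→ℕ (forcedCovers S) *_) (sym (if-< {b = 0} (s≤s le)))))
      where
      ∧-true : ∀ b → bit→ℕ (b ∧ true) ≡ bit→ℕ b * 1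
      ∧-true false = refl
      ∧-true true  = refl
    ... | no nle = trans (zeroˡ (covers n (edge w) S)) (sym (trans (cong (bit→ℕ (forcedCovers S) *_) zeroʳ) (*-zeroʳ (bit→ℕ (forcedCovers S)))))
      where
      zeroˡ : ∀ b → bit→ℕ (b ∧ (weight S ≤ᵇ k)) ≡ 0
      zeroˡ b with weight S ≤ᵇ k in eq
      zeroˡ b     | true = contradiction (≤ᵇ⇒≤ (weight S) k (subst T (sym eq) tt)) nle
      zeroˡ false | false = refl
      zeroˡ true  | false = refl
      zeroʳ : (if weight S <ᵇ suc k then 1 else 0) ≡ 0
      zeroʳ with weight S <ᵇ suc k in eq
      ... | true  = contradiction (≤-pred (<ᵇ⇒< (weight S) (suc k) (subst T (sym eq) tt))) nle
      ... | false = refl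

  no-covers : ¬ T small → countVertexCovers (fromTriangle n w) k ≡ 0
  no-covers ns = trans (count-covers n w k) (trans (sumSubsets-cong n none) (sumSubsets-0 n))
    where
    none : ∀ S → length S ≡ n → bit→ℕ (covers n (edge w) S ∧ (weight S ≤ᵇ k)) ≡ 0
    none S len with covers n (edge w) S in eq | weight S ≤ᵇ k in eq′
    ... | false | _     = refl
    ... | true  | false = refl
    ... | true  | true  = contradiction (≤⇒≤ᵇ (Classify.core-small n k (edge w) (edge-sym w) (edge-irrefl w) {S} len
      (≤ᵇ⇒≤ (weight S) k (subst T (sym eq′) tt)) (subst T (sym eq) tt))) ns

  respace-0 : ∀ d D r → respace d D r 0 ≡ 0
  respace-0 d D r = trans (sumBelow-cong r λ j _ →
    trans (cong (2 ^ (D * j) *_) (value-low-[] d)) (*-zeroʳ (2 ^ (D * j)))) (sumBelow-0 r)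

  lifted-0 : lifted 0 ≡ 0
  lifted-0 = trans (cong (λ s → respace (suc n) 0 (suc k) (2 ^ (suc n * #heavy) * ((1 + 2 ^ suc n) ^ #free * s)))
      (respace-0 (suc #core) (suc n) (suc #core)))
    (trans (cong (λ s → respace (suc n) 0 (suc k) (2 ^ (suc n * #heavy) * s)) (*-zeroʳ ((1 + 2 ^ suc n) ^ #free)))
      (trans (cong (respace (suc n) 0 (suc k)) (*-zeroʳ (2 ^ (suc n * #heavy)))) (respace-0 (suc n) 0 (suc k))))

reducible : Instance → Bool
reducible (x , k) = valid x ∧ Kernelize.small (ones x) k (rest x)

kernelWord : Instance → Word
kernelWord (x , k) = let open Kernelize (ones x) k (rest x) in unary order ++ false ∷ kernelTriangle

kernelParameter : Instance → ℕ
kernelParameter (x , k) = Kernelize.order (ones x) k (rest x)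

reduceI : Instance → Instance
-- The empty word lacks the separator and so encodes no graph. The test occurs twice because each
-- output tape is filled by an algorithm of its own.
reduceI I = (if reducible I then kernelWord I else []) , (if reducible I then kernelParameter I else 0)

liftI : Instance × Instance × ℕ → ℕ
liftI ((x , k) , _ , s) = Kernelize.lifted (ones x) k (rest x) s

splitUnary-unary : ∀ n w → splitUnary (unary n ++ false ∷ w) ≡ just (n , w)
splitUnary-unary zero    w = refl
splitUnary-unary (suc n) w rewrite splitUnary-unary n w = refl

liftI-correct : ∀ I → liftI (I , reduceI I , #VertexCover (reduceI I)) ≡ #VertexCover I
liftI-correct (x , k) = go (T? (valid x)) (T? small)
  where
  open Kernelize (ones x) k (rest x)

  reject : reducible (x , k) ≡ false → liftI ((x , k) , reduceI (x , k) , #VertexCover (reduceI (x , k))) ≡ 0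
  reject eq rewrite eq = lifted-0

  go : Dec (T (valid x)) → Dec (T small) →
       liftI ((x , k) , reduceI (x , k) , #VertexCover (reduceI (x , k))) ≡ #VertexCover (x , k)
  go (no nv) _ = trans (reject (T-iff (λ h → nv (∧-left h)) λ ()))
    (sym (cong (maybe (λ (_ , G) → countVertexCovers G k) 0) (decode-invalid x nv)))
  go (yes v) (no ns) = trans (reject (T-iff (λ h → ns (∧-right {valid x} h)) λ ()))
    (sym (trans (cong (maybe (λ (_ , G) → countVertexCovers G k) 0) (decode-valid x v)) (no-covers ns)))
  go (yes v) (yes s) = trans (cong lifted accept) (trans lifted-correct
    (sym (cong (maybe (λ (_ , G) → countVertexCovers G k) 0) (decode-valid x v))))
    where
    decode-kernel : decode (kernelWord (x , k)) ≡ just (order , fromTriangle order kernelTriangle)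
    decode-kernel rewrite splitUnary-unary order kernelTriangle = toGraph-just order kernelTriangle length-kernelTriangle
    accept : #VertexCover (reduceI (x , k)) ≡ countVertexCovers (fromTriangle order kernelTriangle) order
    accept rewrite T-iff {reducible (x , k)} {true} (λ _ → tt) (λ _ → ∧-intro v s) =
      cong (maybe (λ (_ , G) → countVertexCovers G order) 0) decode-kernel

triangle≤square : ∀ n → triangle n ≤ n * n
triangle≤square zero    = z≤n
triangle≤square (suc n) = begin
  triangle n + n   ≤⟨ +-monoˡ-≤ n (triangle≤square n) ⟩
  n * n + n        ≤⟨ m≤n+m _ (suc n) ⟩
  suc n + (n * n + n)  ≡⟨ solve 1 (λ n → con 1 :+ n :+ (n :* n :+ n) := (con 1 :+ n) :* (con 1 :+ n)) refl n ⟩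
  suc n * suc n    ∎
  where open ≤-Reasoning

if-≤ : ∀ {A : Set} b {u v : A} (f : A → ℕ) {m} → (T b → f u ≤ m) → f v ≤ m → f (if b then u else v) ≤ m
if-≤ true  f hu hv = hu tt
if-≤ false f hu hv = hv

order-bound : ∀ c Y → suc c ≤ Y → 2 ≤ Y → suc (c + c * suc c) ≤ Y ^ 4
order-bound c Y h h₂ = begin
  suc (c + c * suc c)           ≤⟨ s≤s (+-monoˡ-≤ _ (n≤1+n c)) ⟩
  suc (suc c * suc c)           ≤⟨ s≤s (*-mono-≤ h h) ⟩
  1 + Y * Y                     ≤⟨ +-monoˡ-≤ (Y * Y) (*-mono-≤ 1≤Y 1≤Y) ⟩
  Y * Y + Y * Y                 ≡⟨ cong (Y * Y +_) (+-identityʳ (Y * Y)) ⟨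
  2 * (Y * Y)                   ≤⟨ *-monoˡ-≤ (Y * Y) (*-mono-≤ h₂ 1≤Y) ⟩
  Y * Y * (Y * Y)               ≡⟨ solve 1 (λ y → y :* y :* (y :* y) := y :* (y :* (y :* (y :* con 1)))) refl Y ⟩
  Y ^ 4                         ∎
  where
  open ≤-Reasoning
  1≤Y : 1 ≤ Y
  1≤Y = ≤-trans (n≤1+n 1) h₂

length-bound : ∀ {n m} → suc n ≤ m → n + suc (triangle n) ≤ m ^ 2
length-bound {n} {m} h = begin
  n + suc (triangle n)    ≤⟨ +-monoʳ-≤ n (s≤s (triangle≤square n)) ⟩
  n + suc (n * n)         ≤⟨ m≤m+n _ n ⟩
  n + suc (n * n) + n     ≡⟨ solve 1 (λ n → n :+ (con 1 :+ n :* n) :+ n := (con 1 :+ n) :* (con 1 :+ n)) refl n ⟩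
  suc n * suc n           ≤⟨ *-mono-≤ h h ⟩
  m * m                   ≡⟨ cong (m *_) (*-identityʳ m) ⟨
  m ^ 2                   ∎
  where open ≤-Reasoning

-- The three powers bound in turn `suc #core`, `suc order` and the length of the encoding, whose
-- triangle is at most quadratic in the order. The exponents multiply to 16.
bound : ℕ → ℕ
bound k = (((2 + k) ^ 2) ^ 4) ^ 2

square-bound : ∀ {c} k → c ≤ k + k * k → suc c ≤ (2 + k) ^ 2
square-bound {c} k h = begin
  suc c                       ≤⟨ s≤s h ⟩
  suc (k + k * k)             ≤⟨ +-mono-≤ (s≤s (z≤n {3})) (m≤n+m _ (3 * k)) ⟩
  4 + (3 * k + (k + k * k))   ≡⟨ solve 1 (λ k → (con 2 :+ k) :* ((con 2 :+ k) :* con 1) := con 4 :+ (con 3 :* k :+ (k :+ k :* k))) refl k ⟨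
  (2 + k) ^ 2                 ∎
  where open ≤-Reasoning

reduceI-bounded : ∀ x k → length (proj₁ (reduceI (x , k))) ≤ bound k × proj₂ (reduceI (x , k)) ≤ bound k
reduceI-bounded x k =
  if-≤ (reducible (x , k)) length (λ r → ≤-trans (≤-reflexive (trans (length-++ (unary order))
      (cong₂ (λ a b → a + suc b) (length-replicate order) length-kernelTriangle)))
    (length-bound (order< r))) z≤n ,
  if-≤ (reducible (x , k)) id (λ r → ≤-trans (≤-trans (n≤1+n order) (order< r)) square≥) z≤n
  where
  open Kernelize (ones x) k (rest x)
  2≤Y : 2 ≤ (2 + k) ^ 2
  2≤Y = ≤-trans (m≤m+n 2 k) (≤-trans (≤-reflexive (sym (*-identityʳ (2 + k)))) (^-monoʳ-≤ (2 + k) (s≤s (z≤n {1}))))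
  order< : T (reducible (x , k)) → suc order ≤ ((2 + k) ^ 2) ^ 4
  order< r = order-bound #core ((2 + k) ^ 2) (square-bound k (≤ᵇ⇒≤ #core (k + k * k) (∧-right {valid x} r))) 2≤Y
  square≥ : ((2 + k) ^ 2) ^ 4 ≤ bound k
  square≥ = ≤-trans (m≤m*n Z Z ⦃ m^n≢0 ((2 + k) ^ 2) 4 ⦃ m^n≢0 (2 + k) 2 ⦄ ⦄) (≤-reflexive (cong (Z *_) (sym (*-identityʳ Z))))
    where
    Z : ℕ
    Z = ((2 + k) ^ 2) ^ 4

bound-polynomial : IsPolynomial bound
bound-polynomial = twoPlusX^ 16 , λ k → sym (trans (eval-twoPlusX^ 16 k)
  (sym (trans (^-*-assoc ((2 + k) ^ 2) 4 2) (^-*-assoc (2 + k) 2 8))))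

-- Algorithms for the reduction and the lift

module _ {ρ : X → Vec Word m} where

  maxℕ : ∀ {f g : X → ℕ} → PT ρ (unary ∘ f) → PT ρ (unary ∘ g) → PT ρ (λ x → unary (f x ⊔ g x))
  maxℕ {f} {g} p q = ext (plus p (monus q p)) λ x → cong unary (sym (m⊔n≡m+[n∸m] (f x) (g x)))
    where
    m⊔n≡m+[n∸m] : ∀ i j → i ⊔ j ≡ i + (j ∸ i)
    m⊔n≡m+[n∸m] zero    j       = refl
    m⊔n≡m+[n∸m] (suc i) zero    = cong suc (sym (+-identityʳ i))
    m⊔n≡m+[n∸m] (suc i) (suc j) = cong suc (m⊔n≡m+[n∸m] i j)

  minℕ : ∀ {f g : X → ℕ} → PT ρ (unary ∘ f) → PT ρ (unary ∘ g) → PT ρ (λ x → unary (f x ⊓ g x))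
  minℕ {f} {g} p q = ext (monus p (monus p q)) λ x → cong unary (m∸[m∸n]≡m⊓n (f x) (g x))
    where
    m∸[m∸n]≡m⊓n : ∀ i j → i ∸ (i ∸ j) ≡ i ⊓ j
    m∸[m∸n]≡m⊓n i j with ≤-total i j
    ... | inj₁ i≤j = trans (cong (i ∸_) (m≤n⇒m∸n≡0 i≤j)) (sym (m≤n⇒m⊓n≡m i≤j))
    ... | inj₂ j≤i = trans (m∸[m∸n]≡n j≤i) (sym (m≥n⇒m⊓n≡n j≤i))

  power : ∀ {f : X → ℕ} → PT ρ (unary ∘ f) → ∀ c → PT ρ (λ x → unary (f x ^ c))
  power p zero    = constℕ 1
  power p (suc c) = times p (power p c)

  edgeB : ∀ {w} {u v : X → ℕ} → PT ρ w → PT ρ (unary ∘ u) → PT ρ (unary ∘ v) → PT ρ (λ x → flag (edge (w x) (u x) (v x)))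
  edgeB pw pu pv = andB (notB (equal pu pv)) (bitB pw (plus (triangleℕ (maxℕ pu pv)) (minℕ pu pv)))

  unitW : ∀ {n a : X → ℕ} → PT ρ (unary ∘ n) → PT ρ (unary ∘ a) → PT ρ (λ x → unit (n x) (a x))
  unitW pn pa = app (zeros pa) (cons true (zeros (monus pn (cons true pa))))

  pickW : ∀ {n : X → ℕ} {K F : X → ℕ → Bool} → PT ρ (unary ∘ n) → PT (ρ ▹) (λ (x , j) → flag (K x j)) →
          PT (ρ ▹) (λ (x , j) → flag (F x j)) → PT ρ (λ x → pick (K x) (n x) (F x))
  pickW pn pK pF = forEach pn (ite pK (letter pF) nil)

index : {ρ : X → Vec Word m} → PT (ρ ▹) (unary ∘ proj₂)
index = var Fin.zero

module _ {ρ : X → Vec Word m} where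

  gadgetW : ∀ {c d a : X → ℕ} → PT ρ (unary ∘ c) → PT ρ (unary ∘ d) → PT ρ (unary ∘ a) →
            PT ρ (λ x → gadget (c x) (d x) (a x))
  gadgetW pc pd pa = forEach pa (forEach (wk pd)
    (unitW (plus (plus (wk (wk pc)) (times (wk index) (wk (wk pd)))) index) (wk index)))

  respaceB : ∀ {d D r s : X → ℕ} → PT ρ (unary ∘ d) → PT ρ (unary ∘ D) → PT ρ (unary ∘ r) → PT ρ (binary ∘ s) →
             PT ρ (λ x → binary (respace (d x) (D x) (r x) (s x)))
  respaceB {s = s} pd pD pr ps = sumB pr (shiftB (times (wk pD) index) (digitsB {s = s ∘ proj₁} (times (wk pd) index) (wk pd) (wk ps)))

  onesℕ : ∀ {f} → PT ρ f → PT ρ (λ x → unary (ones (f x)))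
  onesℕ p = fold (λ x w → unary (ones w)) p nil
    (λ { false → nil ; true → cons true (var (Fin.suc Fin.zero)) })
    (bd-≤ bd-size λ (x , w) → ≤-trans (≤-reflexive (length-replicate (ones w))) (≤-trans (ones≤ w) (m≤m+n _ _)))
    where
    ones≤ : ∀ w → ones w ≤ length w
    ones≤ []          = z≤n
    ones≤ (false ∷ w) = z≤n
    ones≤ (true ∷ w)  = s≤s (ones≤ w)

-- All quantities in `Kernelize` depend on this triple; bundled, its algorithms are carried under a
-- loop by one weakening.
record Inputs {X : Set} {m} (ρ : X → Vec Word m) (n k : X → ℕ) (w : X → Word) : Set₁ where
  constructor ⟪_,_,_⟫
  field
    order-in     : PT ρ (unary ∘ n)
    parameter-in : PT ρ (unary ∘ k)
    triangle-in  : PT ρ w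

open Inputs

module _ {ρ : X → Vec Word m} {n k : X → ℕ} {w : X → Word} where

  wkI : Inputs ρ n k w → Inputs (ρ ▹) (n ∘ proj₁) (k ∘ proj₁) (w ∘ proj₁)
  wkI i = ⟪ wk (order-in i) , wk (parameter-in i) , wk (triangle-in i) ⟫

  lightB : Inputs ρ n k w → ∀ {u : X → ℕ} → PT ρ (unary ∘ u) →
           PT ρ (λ x → flag (Degrees.light (n x) (k x) (edge (w x)) (u x)))
  lightB i pu = leq (count (order-in i) (edgeB (wk (triangle-in i)) (wk pu) index)) (parameter-in i)

module _ {ρ : X → Vec Word m} {n k : X → ℕ} {w : X → Word} (i : Inputs ρ n k w) where

  busyB : ∀ {u : X → ℕ} → PT ρ (unary ∘ u) → PT ρ (λ x → flag (Degrees.busy (n x) (k x) (edge (w x)) (u x)))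
  busyB pu = leq (constℕ 1) (count (order-in i) (andB (edgeB (wk (triangle-in i)) (wk pu) index) (lightB (wkI i) index)))

module _ {ρ : X → Vec Word m} {n k : X → ℕ} {w : X → Word} (i : Inputs ρ n k w) where

  coreB : ∀ {u : X → ℕ} → PT ρ (unary ∘ u) → PT ρ (λ x → flag (Kernelize.isCore (n x) (k x) (w x) (u x)))
  coreB pu = andB (lightB i pu) (busyB i pu)

module _ {ρ : X → Vec Word m} {n k : X → ℕ} {w : X → Word} (i : Inputs ρ n k w) where

  #coreℕ : PT ρ (λ x → unary (Kernelize.#core (n x) (k x) (w x)))
  #coreℕ = count (order-in i) (coreB (wkI i) index)

  #heavyℕ : PT ρ (λ x → unary (Kernelize.#heavy (n x) (k x) (w x)))
  #heavyℕ = count (order-in i) (notB (lightB (wkI i) index))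

  #freeℕ : PT ρ (λ x → unary (Kernelize.#free (n x) (k x) (w x)))
  #freeℕ = count (order-in i) (andB (lightB (wkI i) index) (notB (busyB (wkI i) index)))

  orderℕ : PT ρ (λ x → unary (Kernelize.order (n x) (k x) (w x)))
  orderℕ = plus #coreℕ (times #coreℕ (cons true #coreℕ))

  smallB : PT ρ (λ x → flag (Kernelize.small (n x) (k x) (w x)))
  smallB = leq #coreℕ (plus (parameter-in i) (times (parameter-in i) (parameter-in i)))

  kernelTriangleW : PT ρ (λ x → Kernelize.kernelTriangle (n x) (k x) (w x))
  kernelTriangleW = app
    (forEach (order-in i) (ite (coreB (wkI i) index)
      (pickW index (coreB (wkI (wkI i)) index) (edgeB (wk (wk (triangle-in i))) (wk index) index)) nil))
    (gadgetW #coreℕ (cons true #coreℕ) #coreℕ)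

  liftedB : ∀ {s : X → ℕ} → PT ρ (binary ∘ s) → PT ρ (λ x → binary (Kernelize.lifted (n x) (k x) (w x) (s x)))
  liftedB {s} ps = respaceB {s = scaled} D (constℕ 0) (cons true (parameter-in i))
    (shiftB {f = dilated} (times D #heavyℕ)
      (dilate {f = respaced} D #freeℕ (respaceB {s = s} (cons true #coreℕ) D (cons true #coreℕ) ps)))
    where
    D : PT ρ (λ x → unary (suc (n x)))
    D = cons true (order-in i)
    respaced dilated scaled : X → ℕ
    respaced x = let c = Kernelize.#core (n x) (k x) (w x) in respace (suc c) (suc (n x)) (suc c) (s x)
    dilated x  = (1 + 2 ^ suc (n x)) ^ Kernelize.#free (n x) (k x) (w x) * respaced x
    scaled x   = 2 ^ (suc (n x) * Kernelize.#heavy (n x) (k x) (w x)) * dilated x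

module _ {ρ : X → Vec Word m} {x′ : X → Word} {k : X → ℕ} (px : PT ρ x′) (pk : PT ρ (unary ∘ k)) where

  instanceInputs : Inputs ρ (ones ∘ x′) k (rest ∘ x′)
  instanceInputs = ⟪ onesℕ px , pk , dropℕ (cons true (onesℕ px)) px ⟫

  reducibleB : PT ρ (λ x → flag (reducible (x′ x , k x)))
  reducibleB = andB (equal (lengthℕ px) (cons true (plus (onesℕ px) (triangleℕ (onesℕ px))))) (smallB instanceInputs)

  reduceW : PT ρ (λ x → proj₁ (reduceI (x′ x , k x)))
  reduceW = ite reducibleB (app (orderℕ instanceInputs) (cons false (kernelTriangleW instanceInputs))) nil

  reduceℕ : PT ρ (λ x → unary (proj₂ (reduceI (x′ x , k x))))
  reduceℕ = ext (ite reducibleB (orderℕ instanceInputs) nil) λ x → lemma (reducible (x′ x , k x))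
    where
    lemma : ∀ b {v} → (if b then unary v else []) ≡ unary (if b then v else 0)
    lemma false = refl
    lemma true  = refl

theorem1p1 : PolynomialKernel #VertexCover
theorem1p1 = kernel , bound-polynomial
  where
  kernel : Kernel #VertexCover
  kernel = record
    { reduce           = reduceI
    ; lift             = liftI
    ; reduce-polytime  = polyTime encInstance encInstance reduceI
        (reduceW {x′ = proj₁} {proj₂} (var Fin.zero) (var (Fin.suc Fin.zero)) ∷
         reduceℕ {x′ = proj₁} {proj₂} (var Fin.zero) (var (Fin.suc Fin.zero)) ∷ [])
    ; lift-polytime    = polyTime encLift (λ s → binary s ∷ []) liftI
        (liftedB (instanceInputs {x′ = proj₁ ∘ proj₁} {proj₂ ∘ proj₁} (var Fin.zero) (var (Fin.suc Fin.zero)))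
                 {proj₂ ∘ proj₂} (var (Fin.suc (Fin.suc (Fin.suc (Fin.suc Fin.zero))))) ∷ [])
    ; bound            = bound
    ; bound-computable = computable (λ k → unary k ∷ []) (λ k → unary k ∷ []) bound
        (power (power (power (cons true (cons true (var Fin.zero))) 2) 4) 2 ∷ [])
    ; reduce-bounded   = reduceI-bounded
    ; lift-correct     = liftI-correct
    }
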